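{- Fix a finite set $AP$ of atomic propositions and an operator precedence matrix $M$ on $2^{AP}$. Given a POTL formula $\varphi$ over $AP$, it is possible to build an operator precedence automaton over $(2^{AP},M)$ accepting the language denoted by $\varphi$, i.e. the set of words $x=P(1)\cdots P(n)$ compatible with $M$ such that $(w,1)\models\varphi$ for the OP word $w$ with labels $P(1),\dots,P(n)$, with at most $2^{O(|\varphi|)}$ states, where $|\varphi|$ is the length of $\varphi$.
   Context: Let $AP$ be partitioned into normal propositions and structural labels, and let $\#\notin AP$ be an end marker; $\Sigma=2^{AP}$. An operator precedence matrix (OPM) $M$ on $\Sigma$ is a partial function $M:(\Sigma\cup\{\#\})^2\to\{\lessdot,\doteq,\gtrdot\}$, defined only on sets containing exactly one structural label, with $M(a,b)$ depending only on the structural labels in $a$ and $b$. Write $a\,\pi\,b$ for $M(a,b)=\pi$; by convention $\#\lessdot b$ for every $b$ and $a\gtrdot\#$ for every $a\in\Sigma$. A simple chain is a string $c_0c_1\dots c_\ell c_{\ell+1}$ with $\ell\ge1$, $c_0,c_{\ell+1}\in\Sigma\cup\{\#\}$, $c_1,\dots,c_\ell\in\Sigma$ and $c_0\lessdot c_1\doteq\dots\doteq c_\ell\gtrdot c_{\ell+1}$. A composed chain is a string $c_0s_0c_1s_1\dots c_\ell s_\ell c_{\ell+1}$ such that $c_0c_1\dots c_{\ell+1}$ is a simple chain and each $s_k\in\Sigma^*$ is either empty or such that $c_ks_kc_{k+1}$ is a chain; $(c_0,c_{\ell+1})$ is its context. A word $x\in\Sigma^*$ is compatible with $M$ if $M(c,d)$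 is defined for consecutive letters $c,d$ of $x$ and $M(a,b)$ is defined for each substring of $\#x\#$ that is a chain with context $(a,b)$. An OP word is $w=\langle U,M,P\rangle$ with $U=\{0,\dots,n+1\}$, $P(0)=P(n+1)=\#$, $P(1)\cdots P(n)$ compatible with $M$. Write $i\,\pi\,j$ if $P(i)\,\pi\,P(j)$. $\chi(i,j)$ holds iff $i<j-1$ and $P(i)\cdots P(j)$ is a chain. POTL formulas over $AP$: $\varphi::=a\mid\neg\varphi\mid\varphi\lor\varphi\mid\bigcirc^{\Pi}\varphi\mid\ominus^{\Pi}\varphi\mid\chi_F^{\Pi}\varphi\mid\chi_P^{\Pi}\varphi\mid\varphi\,\mathcal U_\chi^{\Pi}\,\varphi\mid\varphi\,\mathcal S_\chi^{\Pi}\,\varphi\mid\bigcirc_H^{\mu}\varphi\mid\ominus_H^{\mu}\varphi\mid\varphi\,\mathcal U_H^{\mu}\,\varphi\mid\varphi\,\mathcal S_H^{\mu}\,\varphi$, $a\in AP$, $\Pi\subseteq\{\lessdot,\doteq,\gtrdot\}$ nonempty, $\mu\in\{\lessdot,\gtrdot\}$. Semantics at position $i$ of $w$: $(w,i)\models a$ iff $a\in P(i)$; Booleans as usual. $\bigcirc^\Pi\varphi$: $i\,\pi\,(i+1)$ for some $\pi\in\Pi$ and $\varphi$ at $i+1$. $\ominus^\Pi\varphi$: $(i-1)\,\pi\,i$ for some $\pi\in\Pi$ and $\varphi$ at $i-1$. $\chi_F^\Pi\varphi$: some $j>i$ with $\chi(i,j)$, $i\,\pi\,j$ ($\pi\in\Pi$),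 $\varphi$ at $j$. $\chi_P^\Pi\varphi$: some $j<i$ with $\chi(j,i)$, $j\,\pi\,i$ ($\pi\in\Pi$), $\varphi$ at $j$. $\bigcirc_H^\lessdot\varphi$: some $h<i$ has $\chi(h,i)$, $h\lessdot i$, the set $\{k>i:\chi(h,k),h\lessdot k\}$ is nonempty and $\varphi$ holds at its minimum; $\ominus_H^\lessdot\varphi$: same with $\{k<i:\chi(h,k),h\lessdot k\}$, maximum. $\bigcirc_H^\gtrdot\varphi$: some $h>i$ has $\chi(i,h)$, $i\gtrdot h$, $\{k>i:\chi(k,h),k\gtrdot h\}$ nonempty and $\varphi$ at its minimum; $\ominus_H^\gtrdot\varphi$: same with $\{k<i:\chi(k,h),k\gtrdot h\}$, maximum. A path from $i$ to $j$ is $i=i_1<\dots<i_n=j$. For a set $\Gamma$ of paths, $(w,i)\models\varphi\,\mathcal U_\Gamma\,\psi$ iff for some $j\ge i$ a path in $\Gamma$ from $i$ to $j$ has $\varphi$ at $i_1,\dots,i_{n-1}$ and $\psi$ at $i_n$; $\varphi\,\mathcal S_\Gamma\,\psi$ iff for some $j\le i$ a path $j=i_1<\dots<i_n=i$ in $\Gamma$ has $\psi$ at $i_1$ and $\varphi$ at $i_2,\dots,i_n$. Summary path for $\Pi$: for each $p<n$, if $K_p=\{h\le j:\chi(i_p,h),\ i_p\,\pi\,h,\ \pi\in\Pi\}\ne\emptyset$ then $i_{p+1}=\max K_p$, else $i_{p+1}=i_p+1$ with $i_p\,\pi\,(i_p+1)$ for some $\pi\in\Pi$ (used by $\mathcal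 U_\chi^\Pi,\mathcal S_\chi^\Pi$). Yield-precedence hierarchical path: some $h<i$ has $\chi(h,i_p)$, $h\lessdot i_p$ for all $p$, no $k$ with $i_q<k<i_{q+1}$ and $\chi(h,k)$ (used by $\mathcal U_H^\lessdot,\mathcal S_H^\lessdot$). Take-precedence hierarchical path: some $h>j$ has $\chi(i_p,h)$, $i_p\gtrdot h$ for all $p$, no $k$ with $i_q<k<i_{q+1}$ and $\chi(k,h)$ (used by $\mathcal U_H^\gtrdot,\mathcal S_H^\gtrdot$). An operator precedence automaton (OPA) is $\mathcal A=(\Sigma,M,Q,I,F,\delta)$ with finite state set $Q$, $I,F\subseteq Q$, and $\delta=\delta_{push}\cup\delta_{shift}\cup\delta_{pop}$ with $\delta_{push},\delta_{shift}\subseteq Q\times\Sigma\times Q$, $\delta_{pop}\subseteq Q\times Q\times Q$. Configurations are $\langle x,q,\gamma\rangle$ with $x\in\Sigma^*\#$, $q\in Q$, $\gamma\in(\Sigma\times Q)^*\bot$; the top symbol of $\gamma$ is the letter of its topmost pair, or $\#$ if $\gamma=\bot$. Moves (with $b$ the next input symbol, possibly $\#$): push, if top $\lessdot b$: $\langle bx,p,\gamma\rangle\vdash\langle x,q,[b,p]\gamma\rangle$ for $(p,b,q)\in\delta_{push}$; shift, if $a\doteq b$: $\langle bx,q,[a,p]\gamma\rangle\vdash\langle x,r,[b,p]\gamma\rangle$ for $(q,b,r)\in\delta_{shift}$; pop, if $a\gtrdot b$: $\langle bx,q,[a,p]\gamma\rangle\vdash\langle bx,r,\gamma\rangle$ for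 $(q,p,r)\in\delta_{pop}$. $L(\mathcal A)=\{x\in\Sigma^*:\langle x\#,q_I,\bot\rangle\vdash^*\langle\#,q_F,\bot\rangle,\ q_I\in I,\ q_F\in F\}$. -}

module Defs where

open import Data.Nat using (ℕ; zero; suc; _+_; _*_; _∸_; _^_; _≤_; _<_)
open import Data.Fin using (Fin)
open import Data.Fin.Subset using (Subset; _∩_; ∣_∣; _∈_)
open import Data.Bool using (Bool; T)
open import Data.List using (List; []; _∷_; _++_; map; take; drop; length; [_])
open import Data.Maybe using (Maybe; just; nothing)
open import Data.Product using (Σ; ∃; _×_; _,_)
open import Data.Sum using (_⊎_)
open import Data.Empty using (⊥)
open import Relation.Nullary using (¬_)
open import Relation.Binary.PropositionalEquality using (_≡_)
open import Relation.Binary.Construct.Closure.ReflexiveTransitive using (Star)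

-- Atomic propositions: AP = Fin n.  The structural labels form the
-- subset S ⊆ AP; the normal propositions are the rest.
-- Σ = 2^AP is represented by Subset n.

Letter : ℕ → Set
Letter n = Subset n

data Prec : Set where
  ⋖ ≐ ⋗ : Prec

data Sym (n : ℕ) : Set where
  end : Sym n
  lt  : Letter n → Sym n

OneStruct : ∀ {n} → Subset n → Letter n → Set
OneStruct S a = ∣ a ∩ S ∣ ≡ 1

-- operator precedence matrix on Σ (values on # are fixed by convention)
record OPM {n : ℕ} (S : Subset n) : Set where
  field
    mat        : Letter n → Letter n → Maybe Prec
    onlyOne    : ∀ a b π → mat a b ≡ just π → OneStruct S a × OneStruct S b
    structOnly : ∀ a a′ b b′ → a ∩ S ≡ a′ ∩ S → b ∩ S ≡ b′ ∩ S →
                 mat a b ≡ mat a′ b′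

record PrecSet : Set where
  field
    hasYield hasEqual hasTake : Bool
    nonempty : T hasYield ⊎ T hasEqual ⊎ T hasTake

InΠ : PrecSet → Prec → Set
InΠ Π ⋖ = T (PrecSet.hasYield Π)
InΠ Π ≐ = T (PrecSet.hasEqual Π)
InΠ Π ⋗  = T (PrecSet.hasTake Π)

data HPrec : Set where
  hyield htake : HPrec

data Formula (n : ℕ) : Set where
  atom  : Fin n → Formula n
  ¬f    : Formula n → Formula n
  _∨f_  : Formula n → Formula n → Formula n
  nextΠ : PrecSet → Formula n → Formula n
  backΠ : PrecSet → Formula n → Formula n
  χF    : PrecSet → Formula n → Formula n
  χP    : PrecSet → Formula n → Formula n
  Uχ    : PrecSet → Formula n → Formula n → Formula n
  Sχ    : PrecSet → Formula n → Formula n → Formula n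
  nextH : HPrec → Formula n → Formula n
  backH : HPrec → Formula n → Formula n
  UH    : HPrec → Formula n → Formula n → Formula n
  SH    : HPrec → Formula n → Formula n → Formula n

size : ∀ {n} → Formula n → ℕ
size (atom _)    = 1
size (¬f φ)      = suc (size φ)
size (φ ∨f ψ)    = suc (size φ + size ψ)
size (nextΠ _ φ) = suc (size φ)
size (backΠ _ φ) = suc (size φ)
size (χF _ φ)    = suc (size φ)
size (χP _ φ)    = suc (size φ)
size (Uχ _ φ ψ)  = suc (size φ + size ψ)
size (Sχ _ φ ψ)  = suc (size φ + size ψ)
size (nextH _ φ) = suc (size φ)
size (backH _ φ) = suc (size φ)
size (UH _ φ ψ)  = suc (size φ + size ψ)
size (SH _ φ ψ)  = suc (size φ + size ψ)

data UPath (St : ℕ → ℕ → Set) (A B : ℕ → Set) : ℕ → ℕ → Set where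
  lastU : ∀ {i} → B i → UPath St A B i i
  consU : ∀ {i k j} → i < k → A i → St i k → UPath St A B k j → UPath St A B i j

data SPath (St : ℕ → ℕ → Set) (A B : ℕ → Set) : ℕ → ℕ → Set where
  firstS : ∀ {j} → A j → SPath St A B j j
  snocS  : ∀ {j k i} → SPath St A B j k → k < i → St k i → B i → SPath St A B j i

NoBetween : (ℕ → Set) → ℕ → ℕ → Set
NoBetween C a b = ∀ k → a < k → k < b → ¬ C k

module _ {n : ℕ} {S : Subset n} (M : OPM S) where

  open OPM M

  ext : Sym n → Sym n → Maybe Prec
  ext end    _      = just ⋖
  ext (lt a) end    = just ⋗
  ext (lt a) (lt b) = mat a b

  -- Chain a u b : the string a u b is a (simple or composed) chain with
  -- context (a , b);  u ∈ Σ*.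
  mutual
    data Chain : Sym n → List (Letter n) → Sym n → Set where
      chain : ∀ {a c s r b} → ext a (lt c) ≡ just ⋖ → Gap a s (lt c) →
              Run c r b → Chain a (s ++ c ∷ r) b

    -- Run c r b : c r b = c_k s_k c_{k+1} … c_ℓ s_ℓ b with
    -- c_k ≐ … ≐ c_ℓ ⋗ b and the s's empty or chains
    data Run : Letter n → List (Letter n) → Sym n → Set where
      stop : ∀ {c s b} → ext (lt c) b ≡ just ⋗ → Gap (lt c) s b → Run c s b
      next : ∀ {c d s r b} → ext (lt c) (lt d) ≡ just ≐ →
             Gap (lt c) s (lt d) → Run d r b → Run c (s ++ d ∷ r) b

    data Gap : Sym n → List (Letter n) → Sym n → Set where
      empty : ∀ {a b} → Gap a [] b
      nest  : ∀ {a s b} → Chain a s b → Gap a s b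

  Defined : Maybe Prec → Set
  Defined m = ∃ λ π → m ≡ just π

  Compatible : List (Letter n) → Set
  Compatible x =
    (∀ pre a b post → x ≡ pre ++ a ∷ b ∷ post → Defined (mat a b)) ×
    (∀ pre a u b post →
       end ∷ map lt x ++ [ end ] ≡ pre ++ a ∷ map lt u ++ b ∷ post →
       Chain a u b → Defined (ext a b))

  -- OP word with labels x = P(1)…P(n):  P(0) = P(n+1) = #
  pos : List (Letter n) → ℕ → Sym n
  pos x        zero          = end
  pos []       (suc i)       = end
  pos (a ∷ x)  (suc zero)    = lt a
  pos (a ∷ x)  (suc (suc i)) = pos x (suc i)

  module _ (x : List (Letter n)) where

    Rel : ℕ → ℕ → Prec → Set
    Rel i j π = i ≤ suc (length x) × j ≤ suc (length x) ×
                ext (pos x i) (pos x j) ≡ just π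

    RelΠ : PrecSet → ℕ → ℕ → Set
    RelΠ Π i j = ∃ λ π → InΠ Π π × Rel i j π

    chi : ℕ → ℕ → Set
    chi i j = suc i < j × j ≤ suc (length x) ×
              Chain (pos x i) (take (j ∸ suc i) (drop i x)) (pos x j)

    HY : ℕ → ℕ → Set
    HY h k = chi h k × Rel h k ⋖

    HT : ℕ → ℕ → Set
    HT k h = chi k h × Rel k h ⋗

    InK : PrecSet → ℕ → ℕ → ℕ → Set
    InK Π e a h = h ≤ e × chi a h × RelΠ Π a h

    -- one step of a summary path for Π ending at e
    SumStep : PrecSet → ℕ → ℕ → ℕ → Set
    SumStep Π e a b =
      (InK Π e a b × (∀ h → InK Π e a h → h ≤ b)) ⊎
      ((∀ h → ¬ InK Π e a h) × b ≡ suc a × RelΠ Π a (suc a))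

    sat : Formula n → ℕ → Set
    sat (atom p)    i = Σ (Letter n) λ a → pos x i ≡ lt a × p ∈ a
    sat (¬f φ)      i = ¬ sat φ i
    sat (φ ∨f ψ)    i = sat φ i ⊎ sat ψ i
    sat (nextΠ Π φ) i = RelΠ Π i (suc i) × sat φ (suc i)
    sat (backΠ Π φ) i = ∃ λ k → suc k ≡ i × RelΠ Π k i × sat φ k
    sat (χF Π φ)    i = ∃ λ j → i < j × chi i j × RelΠ Π i j × sat φ j
    sat (χP Π φ)    i = ∃ λ j → j < i × chi j i × RelΠ Π j i × sat φ j
    sat (Uχ Π φ ψ)  i = ∃ λ j → i ≤ j ×
      UPath (SumStep Π j) (λ p → sat φ p) (λ p → sat ψ p) i j
    sat (Sχ Π φ ψ)  i = ∃ λ j → j ≤ i ×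
      SPath (SumStep Π i) (λ p → sat ψ p) (λ p → sat φ p) j i
    sat (nextH hyield φ) i = ∃ λ h → h < i × HY h i ×
      ∃ λ k → i < k × HY h k × NoBetween (HY h) i k × sat φ k
    sat (backH hyield φ) i = ∃ λ h → h < i × HY h i ×
      ∃ λ k → k < i × HY h k × NoBetween (HY h) k i × sat φ k
    sat (nextH htake φ) i = ∃ λ h → i < h × HT i h ×
      ∃ λ k → i < k × HT k h × NoBetween (λ k′ → HT k′ h) i k × sat φ k
    sat (backH htake φ) i = ∃ λ h → i < h × HT i h ×
      ∃ λ k → k < i × HT k h × NoBetween (λ k′ → HT k′ h) k i × sat φ k
    sat (UH hyield φ ψ) i = ∃ λ j → i ≤ j × ∃ λ h → h < i ×
      UPath (NoBetween (chi h)) (λ p → HY h p × sat φ p)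
            (λ p → HY h p × sat ψ p) i j
    sat (SH hyield φ ψ) i = ∃ λ j → j ≤ i × ∃ λ h → h < j ×
      SPath (NoBetween (chi h)) (λ p → HY h p × sat ψ p)
            (λ p → HY h p × sat φ p) j i
    sat (UH htake φ ψ) i = ∃ λ j → i ≤ j × ∃ λ h → j < h ×
      UPath (NoBetween (λ k → chi k h)) (λ p → HT p h × sat φ p)
            (λ p → HT p h × sat ψ p) i j
    sat (SH htake φ ψ) i = ∃ λ j → j ≤ i × ∃ λ h → i < h ×
      SPath (NoBetween (λ k → chi k h)) (λ p → HT p h × sat ψ p)
            (λ p → HT p h × sat φ p) j i

  InLang : Formula n → List (Letter n) → Set
  InLang φ x = Compatible x × sat x φ 1

  record OPA (k : ℕ) : Set where
    field
      initial final : Fin k → Bool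
      δpush δshift  : Fin k → Letter n → Fin k → Bool
      δpop          : Fin k → Fin k → Fin k → Bool

  Config : ℕ → Set
  Config k = List (Letter n) × Fin k × List (Letter n × Fin k)

  topSym : ∀ {k} → List (Letter n × Fin k) → Sym n
  topSym []            = end
  topSym ((a , _) ∷ _) = lt a

  nextSym : List (Letter n) → Sym n
  nextSym []      = end
  nextSym (b ∷ _) = lt b

  data Move {k} (A : OPA k) : Config k → Config k → Set where
    push  : ∀ {b x p q γ} → ext (topSym γ) (lt b) ≡ just ⋖ →
            T (OPA.δpush A p b q) →
            Move A (b ∷ x , p , γ) (x , q , (b , p) ∷ γ)
    shift : ∀ {a b x p q r γ} → ext (lt a) (lt b) ≡ just ≐ →
            T (OPA.δshift A q b r) →
            Move A (b ∷ x , q , (a , p) ∷ γ) (x , r , (b , p) ∷ γ)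
    pop   : ∀ {a x p q r γ} → ext (lt a) (nextSym x) ≡ just ⋗ →
            T (OPA.δpop A q p r) →
            Move A (x , q , (a , p) ∷ γ) (x , r , γ)

  Accepts : ∀ {k} → OPA k → List (Letter n) → Set
  Accepts {k} A x = ∃ λ (qI : Fin k) → ∃ λ (qF : Fin k) →
    T (OPA.initial A qI) × T (OPA.final A qF) ×
    Star (Move A) (x , qI , []) ([] , qF , [])

{-# OPTIONS --safe #-}
module Submission where

-- The positions i and j of a word are joined by an edge when, at some point
-- of the operator precedence parse, i is the topmost stacked position and j
-- the next one to be read; this happens exactly when j = i + 1 or χ(i,j).
-- Runs of an automaton are therefore labellings of the edges by states, with
-- one constraint per push, shift and pop.  Edges never cross, so a summary
-- path can be replaced by an arbitrary path of edges, and every POTL operator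
-- becomes a next or until operator for one of three relations: edges of a
-- given kind, consecutive positions h yields to, consecutive positions taking
-- precedence over h.  The automaton guesses, for every modal subformula, two
-- bits per position and one bit per edge; local constraints force them to be
-- the true values, as the fixpoint equations involved run along well-founded
-- relations.  A state is what is known about the current edge, so every
-- subformula contributes a constant factor to the number of states.

open import Defs
open import Data.Nat
open import Data.Nat.Properties
open import Data.Nat.Tactic.RingSolver using (solve-∀)
open import Data.Bool using (Bool; true; false; T; not; _∧_; _∨_; if_then_else_)
import Data.Bool as Bool
open import Data.Empty using (⊥; ⊥-elim)
open import Data.Fin using (Fin; zero; suc; combine; remQuot)
open import Data.Fin.Properties using (remQuot-combine)
import Data.Fin.Properties as Fin
open import Data.Fin.Subset using (Subset; _∈_)
open import Data.Fin.Subset.Properties using (_∈?_)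
open import Data.List using (List; []; _∷_; _++_; map; take; drop; length; [_])
open import Data.List.Properties using (take++drop≡id; length-drop; length-take; map-injective; ∷-injective; map-++; ++-assoc)
open import Data.Maybe using (Maybe; just; nothing)
import Data.Maybe.Properties as Maybe
open import Data.Product hiding (map)
open import Data.Sum using (_⊎_; inj₁; inj₂)
open import Data.Unit using (⊤; tt)
open import Data.Vec using (Vec; []; _∷_; replicate)
open import Function using (_∘_; id; flip)
open import Relation.Nullary
open import Relation.Nullary.Decidable using (T?; map′; toWitness; fromWitness)
open import Relation.Binary.Construct.Closure.ReflexiveTransitive using (Star; ε; _◅_; _◅◅_)
import Relation.Binary.Construct.Closure.ReflexiveTransitive as Star
open import Relation.Binary.Definitions using (tri<; tri≈; tri>; DecidableEquality)
open import Relation.Binary.PropositionalEquality hiding ([_])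

-- Edges of the parse

-- A guess is usable under negation only if it cannot be wrong in either direction. Each checker
-- must therefore have a consistent labelling on every word whose edges all carry a precedence, and
-- must give the right truth values in all of its consistent labellings; negation then merely flips
-- an output. Edges need a bit of their own because one position can have unboundedly many of them:
-- a disjunction over these edges has to be accumulated from one to the next. For siblings this is
-- unnecessary, since a single pop already meets two consecutive ones. A state holds the symbols at
-- both ends of its edge, because the checks depend on the precedence between them. This costs a
-- factor that depends only on `n` and is paid once for the whole formula. Compatibility needs no
-- check: a run is stuck at an undefined precedence, and an accepting run visits all edges.

module Geometry (N : ℕ) (r : ℕ → ℕ → Maybe Prec) where

  -- Edge h j: at some point of the parse, h is the topmost stacked position
  -- and j the next one to be read.  Open h k i: the topmost handle starts
  -- at k, was pushed on top of h, and has been read up to i.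
  mutual
    data Edge : ℕ → ℕ → Set where
      adj : ∀ {i} → i ≤ N → Edge i (suc i)
      pop : ∀ {h k i j} → Open h k i → Edge i j → r i j ≡ just ⋗ → Edge h j

    data Open : ℕ → ℕ → ℕ → Set where
      start : ∀ {h k} → Edge h k → k ≤ N → r h k ≡ just ⋖ → Open h k k
      more  : ∀ {h k c d} → Open h k c → Edge c d → d ≤ N → r c d ≡ just ≐ →
              Open h k d

  mutual
    edge-< : ∀ {i j} → Edge i j → i < j
    edge-< (adj _)     = ≤-refl
    edge-< (pop o e _) = <-trans (open-< o) (edge-< e)

    open-< : ∀ {h k i} → Open h k i → h < i
    open-< (start e _ _)  = edge-< e
    open-< (more o e _ _) = <-trans (open-< o) (edge-< e)

  open-start-≤ : ∀ {h k i} → Open h k i → k ≤ i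
  open-start-≤ (start _ _ _)  = ≤-refl
  open-start-≤ (more o e _ _) = ≤-trans (open-start-≤ o) (<⇒≤ (edge-< e))

  edge-≤ : ∀ {i j} → Edge i j → j ≤ suc N
  edge-≤ (adj p)     = s≤s p
  edge-≤ (pop _ e _) = edge-≤ e

  open-≤ : ∀ {h k i} → Open h k i → i ≤ N
  open-≤ (start _ p _)  = p
  open-≤ (more _ _ p _) = p

  open-first : ∀ {h k i} → Open h k i → Edge h k × k ≤ N × r h k ≡ just ⋖
  open-first (start e p q)  = e , p , q
  open-first (more o _ _ _) = open-first o

  clash : ∀ {m : Maybe Prec} {π ρ} → π ≢ ρ → m ≡ just π → m ≡ just ρ → ⊥
  clash ne refl refl = ne refl

  -- Uniqueness and nesting of edges

  mutual
    -- The edges into `j` arise one after another: a pop at `j` replaces the left end by the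
    -- position below it on the stack, and it requires ⋗. An edge with another relation is thus the
    -- last of the series.
    termR : ∀ {h h′ j} → Edge h j → r h j ≢ just ⋗ → Edge h′ j → h ≤ h′
    termR e n (adj _) = s≤s⁻¹ (edge-< e)
    termR e n (pop {i = i} o e′ q) with m≤n⇒m<n∨m≡n (termR e n e′)
    ... | inj₂ refl = ⊥-elim (n q)
    ... | inj₁ h<i  = termR-pop e n o e′ q h<i

    termR-pop : ∀ {h h′ k i j} → Edge h j → r h j ≢ just ⋗ →
                Open h′ k i → Edge i j → r i j ≡ just ⋗ → h < i → h ≤ h′
    termR-pop (adj _) n o e′ q h<i = ⊥-elim (<⇒≱ (edge-< e′) h<i)
    termR-pop {i = i} (pop {i = i′} o₁ e₁ q₁) n o e′ q h<i with <-cmp i i′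
    ... | tri< i<i′ _ _ = ⊥-elim (<⇒≱ h<i (gapL o₁ e₁ e′ i<i′))
    ... | tri≈ _ refl _ = ≤-reflexive (proj₁ (detO o₁ o))
    ... | tri> _ _ i′<i = ≤-trans (<⇒≤ (open-< o₁)) (gapL o e′ e₁ i′<i)

    -- In that series a pop jumps from the end `i` of a handle directly to the position `h` on which
    -- the handle rests.
    gapL : ∀ {h k i j m} → Open h k i → Edge i j → Edge m j → m < i → m ≤ h
    gapL o e (adj _) m<i = ⊥-elim (<⇒≱ (edge-< e) m<i)
    gapL {i = i} o e (pop {i = i′} o₁ e₁ _) m<i with <-cmp i i′
    ... | tri< i<i′ _ _ = ⊥-elim (<⇒≱ m<i (gapL o₁ e₁ e i<i′))
    ... | tri≈ _ refl _ = ≤-reflexive (proj₁ (detO o₁ o))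
    ... | tri> _ _ i′<i = ≤-trans (<⇒≤ (open-< o₁)) (gapL o e e₁ i′<i)

    -- A position is read once, at its only incoming edge without ⋗, which `termR` identifies by
    -- applying it in both directions. The relation on that edge decides between push and shift.
    detO : ∀ {h k h′ k′ i} → Open h k i → Open h′ k′ i → h ≡ h′ × k ≡ k′
    detO (start e _ q) (start e′ _ q′) =
      ≤-antisym (termR e (λ t → clash (λ ()) q t) e′)
                (termR e′ (λ t → clash (λ ()) q′ t) e) , refl
    detO (start e _ q) (more o e′ _ q′)
      with refl ← ≤-antisym (termR e (λ t → clash (λ ()) q t) e′)
                            (termR e′ (λ t → clash (λ ()) q′ t) e)
      = ⊥-elim (clash (λ ()) q q′)
    detO (more o e _ q) (start e′ _ q′)
      with refl ← ≤-antisym (termR e (λ t → clash (λ ()) q t) e′)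
                            (termR e′ (λ t → clash (λ ()) q′ t) e)
      = ⊥-elim (clash (λ ()) q q′)
    detO (more o e _ q) (more o′ e′ _ q′)
      with refl ← ≤-antisym (termR e (λ t → clash (λ ()) q t) e′)
                            (termR e′ (λ t → clash (λ ()) q′ t) e)
      = detO o o′

  unique-parent : ∀ {h h′ j} → Edge h j → r h j ≢ just ⋗ →
                  Edge h′ j → r h′ j ≢ just ⋗ → h ≡ h′
  unique-parent e n e′ n′ = ≤-antisym (termR e n e′) (termR e′ n′ e)

  mutual
    -- Induction on the second edge. If its handle ends before `h`, the edge from there to `b`
    -- crosses already. Otherwise `h` lies strictly inside an edge of the handle, which crosses
    -- again, or is read by the handle. In the last case `termR` gives the reading edge the lowest
    -- left end of all edges into `h`, while `i` is lower still.
    no-cross : ∀ {i h a b} → Edge i h → Edge a b → i < a → a < h → h < b → ⊥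
    no-cross e (adj _) i<a a<h h<b = <⇒≱ a<h (s≤s⁻¹ h<b)
    no-cross {h = h} e (pop {i = l} o e′ _) i<a a<h h<b with <-≤-connex l h
    ... | inj₁ l<h = no-cross e e′ (<-trans i<a (open-< o)) l<h h<b
    ... | inj₂ h≤l = no-cross-open e o i<a a<h h≤l

    no-cross-open : ∀ {i h a k l} → Edge i h → Open a k l →
                    i < a → a < h → h ≤ l → ⊥
    no-cross-open e (start e′ _ q) i<a a<h h≤k with m≤n⇒m<n∨m≡n h≤k
    ... | inj₁ h<k  = no-cross e e′ i<a a<h h<k
    ... | inj₂ refl = <⇒≱ i<a (termR e′ (clash (λ ()) q) e)
    no-cross-open {h = h} e (more {c = c} o e′ _ q) i<a a<h h≤d
      with m≤n⇒m<n∨m≡n h≤d | <-≤-connex c h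
    ... | inj₂ refl | _ =
      <⇒≱ (<-trans i<a (open-< o)) (termR e′ (clash (λ ()) q) e)
    ... | inj₁ h<d | inj₁ c<h = no-cross e e′ (<-trans i<a (open-< o)) c<h h<d
    ... | inj₁ h<d | inj₂ h≤c = no-cross-open e o i<a a<h h≤c

  edge-nested : ∀ {i h a b} → Edge i h → Edge a b → i < a → a < h → b ≤ h
  edge-nested e e′ i<a a<h = ≮⇒≥ (no-cross e e′ i<a a<h)

  no-edge-in-open : ∀ {h k c m} → Open h k c → Edge h m → k < m → m ≤ c → ⊥
  no-edge-in-open (start _ _ _) e k<m m≤k = <⇒≱ k<m m≤k
  no-edge-in-open {m = m} (more {c = c} o e′ _ q) e k<m m≤d
    with m≤n⇒m<n∨m≡n m≤d | <-≤-connex c m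
  ... | inj₂ refl | _ = <⇒≱ (open-< o) (termR e′ (clash (λ ()) q) e)
  ... | inj₁ m<d | inj₁ c<m = no-cross e e′ (open-< o) c<m m<d
  ... | inj₁ m<d | inj₂ m≤c = no-edge-in-open o e k<m m≤c

  -- Counterpart of `gapL`: after the edge to `k`, the next edge out of `h` is the one left by
  -- popping the handle begun at `k`. An earlier right end would lie inside the handle or cross its
  -- last edge.
  gapR : ∀ {h k i j m} → Open h k i → Edge i j → Edge h m → k < m → j ≤ m
  gapR {i = i} {m = m} o e e′ k<m with <-≤-connex i m
  ... | inj₁ i<m = ≮⇒≥ (no-cross e′ e (open-< o) i<m)
  ... | inj₂ m≤i = ⊥-elim (no-edge-in-open o e′ k<m m≤i)

  mutual
    -- An edge out of `h` is superseded by a longer one only when its right end has been pushed on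
    -- top of `h` and the handle begun there has been popped.
    termL : ∀ {h j j′} → Edge h j → Edge h j′ → j < j′ → r h j ≡ just ⋖
    termL e (adj _) j<j′ = ⊥-elim (<⇒≱ (edge-< e) (s≤s⁻¹ j<j′))
    termL {j = j} e (pop {k = k} o e′ _) j<j′ with <-cmp j k
    ... | tri< j<k _ _  = termL-open e o j<k
    ... | tri≈ _ refl _ = proj₂ (proj₂ (open-first o))
    ... | tri> _ _ k<j  = ⊥-elim (<⇒≱ j<j′ (gapR o e′ e k<j))

    termL-open : ∀ {h j k i} → Edge h j → Open h k i → j < k → r h j ≡ just ⋖
    termL-open e (start e′ _ _)  = termL e e′
    termL-open e (more o _ _ _) = termL-open e o

  unique-child : ∀ {h j j′} → Edge h j → r h j ≢ just ⋖ →
                 Edge h j′ → r h j′ ≢ just ⋖ → j ≡ j′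
  unique-child {j = j} {j′} e n e′ n′ with <-cmp j j′
  ... | tri< below _ _ = ⊥-elim (n (termL e e′ below))
  ... | tri≈ _ q _  = q
  ... | tri> _ _ gt = ⊥-elim (n′ (termL e′ e gt))

  open-edge-< : ∀ {h k i j} → Open h k i → Edge i j → k < j
  open-edge-< o e = ≤-<-trans (open-start-≤ o) (edge-< e)

  unique-popped : ∀ {h k i k′ i′ j} → Open h k i → Edge i j →
                  Open h k′ i′ → Edge i′ j → i ≡ i′ × k ≡ k′
  unique-popped {i = i} {i′ = i′} o e o′ e′ with <-cmp i i′
  ... | tri< below _ _ = ⊥-elim (<⇒≱ (open-< o) (gapL o′ e′ e below))
  ... | tri≈ _ refl _ = refl , proj₂ (detO o o′)
  ... | tri> _ _ gt = ⊥-elim (<⇒≱ (open-< o′) (gapL o e e′ gt))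

  -- Existence of edges when every edge carries a precedence

  module Total
    (r-source : ∀ j → r 0 j ≡ just ⋖)
    (r-target : ∀ i → 1 ≤ i → i ≤ N → r i (suc N) ≡ just ⋗)
    (defined  : ∀ {i j} → Edge i j → ∃ λ π → r i j ≡ just π)
    where

    inner-target : ∀ {i j} → 1 ≤ i → Edge i j → r i j ≢ just ⋗ → j ≤ N
    inner-target {i} 1≤i e n with m≤n⇒m<n∨m≡n (edge-≤ e)
    ... | inj₁ j<  = s≤s⁻¹ j<
    ... | inj₂ refl = ⊥-elim (n (r-target i 1≤i (s≤s⁻¹ (edge-< e))))

    inner-source : ∀ {i j} → r i j ≢ just ⋖ → 1 ≤ i
    inner-source {zero} {j} n = ⊥-elim (n (r-source j))
    inner-source {suc i} n = s≤s z≤n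

    Popped : ℕ → ℕ → Set
    Popped h k = ∃₂ λ i j → Open h k i × Edge i j × r i j ≡ just ⋗

    private
      -- Two nested measures: `f` bounds the distance from the last position read to the end of the
      -- word, `g` that from the right end of the current edge out of it. A yield starts a nested
      -- handle, whose pop lengthens this edge; an equality extends the handle; a take finishes it.
      popped-from : ∀ f {h k c} → suc N ≤ f + c → Open h k c → Popped h k
      popped-loop : ∀ f g {h k c d} → suc N ≤ suc f + c → Open h k c →
                    suc N ≤ g + d → Edge c d → Popped h k

      popped-from zero p o = ⊥-elim (<⇒≱ p (open-≤ o))
      popped-from (suc f) p o =
        popped-loop f (suc N) p o (m≤m+n (suc N) _) (adj (open-≤ o))

      popped-loop f g {c = c} {d} p o b e with defined e
      ... | ⋗ , q = _ , _ , o , e , q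
      ... | ≐ , q = popped-from f
        (≤-trans p (≤-trans (≤-reflexive (sym (+-suc f c))) (+-monoʳ-≤ f (edge-< e))))
        (more o e (inner-target 1≤c e (clash (λ ()) q)) q)
        where 1≤c = ≤-<-trans z≤n (open-< o)
      popped-loop f zero {c = c} p o b e | ⋖ , q =
        ⊥-elim (<⇒≱ b (inner-target (≤-<-trans z≤n (open-< o)) e (clash (λ ()) q)))
      popped-loop f (suc g) {c = c} {d} p o b e | ⋖ , q
        with popped-from f
               (≤-trans p (≤-trans (≤-reflexive (sym (+-suc f c))) (+-monoʳ-≤ f (edge-< e))))
               (start e (inner-target (≤-<-trans z≤n (open-< o)) e (clash (λ ()) q)) q)
      ... | _ , j , o′ , e′ , q′ =
        popped-loop f g p o
          (≤-trans b (≤-trans (≤-reflexive (sym (+-suc g d)))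
                              (+-monoʳ-≤ g (open-edge-< o′ e′))))
          (pop o′ e′ q′)

    popped : ∀ {h k} → Edge h k → k ≤ N → r h k ≡ just ⋖ → Popped h k
    popped e p q = popped-from (suc N) (m≤m+n (suc N) _) (start e p q)

    Opened : ℕ → Set
    Opened i = ∃₂ λ h k → Open h k i

    private
      -- The edges into `i` are followed, beginning with the adjacent one, until one permits
      -- reading. Each pop needs the handle ending at the left end, obtained by recursion on the
      -- smaller position (`f`), and lowers the left end (`g`).
      opened-from : ∀ f {i} → i ≤ f → 1 ≤ i → i ≤ N → Opened i
      opened-loop : ∀ f g {p i} → i ≤ suc f → i ≤ N → p ≤ g → Edge p i → Opened i

      opened-from zero    i≤0 1≤i _ = ⊥-elim (<⇒≱ 1≤i i≤0)
      opened-from (suc f) {suc i} i≤ 1≤i i≤N =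
        opened-loop f i i≤ i≤N ≤-refl (adj (<⇒≤ i≤N))

      opened-loop f g i≤ i≤N p≤g e with defined e
      ... | ⋖ , q = _ , _ , start e i≤N q
      ... | ≐ , q with opened-from f (s≤s⁻¹ (≤-trans (edge-< e) i≤))
                         (inner-source (clash (λ ()) q))
                         (<⇒≤ (<-≤-trans (edge-< e) i≤N))
      ...   | _ , _ , o = _ , _ , more o e i≤N q
      opened-loop f zero i≤ i≤N p≤0 e | ⋗ , q =
        ⊥-elim (<⇒≱ (inner-source (clash (λ ()) q)) p≤0)
      opened-loop f (suc g) i≤ i≤N p≤g e | ⋗ , q
        with opened-from f (s≤s⁻¹ (≤-trans (edge-< e) i≤))
               (inner-source (clash (λ ()) q))
               (<⇒≤ (<-≤-trans (edge-< e) i≤N))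
      ... | _ , _ , o =
        opened-loop f g i≤ i≤N (s≤s⁻¹ (≤-trans (open-< o) p≤g)) (pop o e q)

    opened : ∀ {i} → 1 ≤ i → i ≤ N → Opened i
    opened = opened-from _ ≤-refl

    private
      outer-loop : ∀ g {d} → suc N ≤ g + d → Edge 0 d → Edge 0 (suc N)
      outer-loop g {d} b e with m≤n⇒m<n∨m≡n (edge-≤ e)
      ... | inj₂ refl = e
      outer-loop zero b e | inj₁ d< = ⊥-elim (<⇒≱ d< b)
      outer-loop (suc g) {d} b e | inj₁ d<
        with popped e (s≤s⁻¹ d<) (r-source d)
      ... | _ , _ , o , e′ , q = outer-loop g
        (≤-trans b (≤-trans (≤-reflexive (sym (+-suc g d)))
                            (+-monoʳ-≤ g (open-edge-< o e′))))
        (pop o e′ q)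

    outer-edge : Edge 0 (suc N)
    outer-edge = outer-loop (suc N) (m≤m+n (suc N) 1) (adj z≤n)

    private
      exit-loop : ∀ g {i d} → 1 ≤ i → suc N ≤ g + d → Edge i d →
                  ∃ λ j → Edge i j × r i j ≢ just ⋖
      exit-loop g 1≤i b e with defined e
      ... | ≐ , q = _ , e , clash (λ ()) q
      ... | ⋗ , q = _ , e , clash (λ ()) q
      exit-loop zero 1≤i b e | ⋖ , q =
        ⊥-elim (<⇒≱ b (inner-target 1≤i e (clash (λ ()) q)))
      exit-loop (suc g) {d = d} 1≤i b e | ⋖ , q
        with popped e (inner-target 1≤i e (clash (λ ()) q)) q
      ... | _ , _ , o , e′ , q′ = exit-loop g 1≤i
        (≤-trans b (≤-trans (≤-reflexive (sym (+-suc g d)))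
                            (+-monoʳ-≤ g (open-edge-< o e′))))
        (pop o e′ q′)

    exit : ∀ {i} → 1 ≤ i → i ≤ N → ∃ λ j → Edge i j × r i j ≢ just ⋖
    exit 1≤i i≤N = exit-loop (suc N) 1≤i (m≤m+n (suc N) _) (adj i≤N)

    entrance : ∀ {j} → 1 ≤ j → j ≤ suc N → ∃ λ h → Edge h j × r h j ≢ just ⋗
    entrance 1≤j j≤ with m≤n⇒m<n∨m≡n j≤
    ... | inj₂ refl = 0 , outer-edge , clash (λ ()) (r-source (suc N))
    ... | inj₁ (s≤s j≤N) with opened 1≤j j≤N
    ...   | _ , _ , start e _ q  = _ , e , clash (λ ()) q
    ...   | _ , _ , more _ e _ q = _ , e , clash (λ ()) q

    private
      -- The edges out of `h` are enumerated in increasing order: `gapR` says that popping yields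
      -- the very next one, `termL` that none follows an edge without ⋖.
      edge-loop : ∀ g {h m} j → suc j ≤ g + m → m ≤ j → Edge h m → Dec (Edge h j)
      edge-loop g j b m≤j e with m≤n⇒m<n∨m≡n m≤j
      ... | inj₂ refl = yes e
      edge-loop zero j b m≤j e | inj₁ _ = ⊥-elim (<⇒≱ b m≤j)
      edge-loop (suc g) {h} {m} j b m≤j e | inj₁ m<j with defined e
      ... | ≐ , q = no λ e′ → clash (λ ()) q (termL e e′ m<j)
      ... | ⋗ , q = no λ e′ → clash (λ ()) q (termL e e′ m<j)
      ... | ⋖ , q with m ≤? N
      ...   | no m≰N = no λ e′ → m≰N (s≤s⁻¹ (<-≤-trans m<j (edge-≤ e′)))
      ...   | yes m≤N with popped e m≤N q
      ...     | _ , j′ , o , e′ , q′ with j′ ≤? j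
      ...       | no j′≰j = no λ e″ → j′≰j (gapR o e′ e″ m<j)
      ...       | yes j′≤j = edge-loop g j
        (≤-trans b (≤-trans (≤-reflexive (sym (+-suc g m)))
                            (+-monoʳ-≤ g (open-edge-< o e′))))
        j′≤j (pop o e′ q′)

    edge? : ∀ h j → Dec (Edge h j)
    edge? h j with h <? j | h ≤? N
    ... | no h≮j  | _       = no λ e → h≮j (edge-< e)
    ... | yes _   | no h≰N  = no λ e → h≰N (s≤s⁻¹ (<-≤-trans (edge-< e) (edge-≤ e)))
    ... | yes h<j | yes h≤N = edge-loop (suc j) j (m≤m+n (suc j) _) h<j (adj h≤N)

-- Edges and chains of a word

drop-tail : ∀ {A : Set} m (x : List A) {a y} → drop m x ≡ a ∷ y → drop (suc m) x ≡ y
drop-tail zero    (a ∷ x) refl = refl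
drop-tail (suc m) (a ∷ x) q    = drop-tail m x q

drop-prefix : ∀ {A : Set} m (x : List A) s {v} → drop m x ≡ s ++ v →
              drop (m + length s) x ≡ v
drop-prefix m x []      q rewrite +-identityʳ m = q
drop-prefix m x (a ∷ s) q rewrite +-suc m (length s) =
  drop-prefix (suc m) x s (drop-tail m x q)

length-prefix : ∀ {A : Set} (x : List A) {m a y} → drop m x ≡ a ∷ y → m < length x
length-prefix (a ∷ x) {zero}  q = s≤s z≤n
length-prefix (a ∷ x) {suc m} q = s≤s (length-prefix x q)

drop-all : ∀ {A : Set} (x : List A) {m} → drop m x ≡ [] → length x ≤ m
drop-all []      q = z≤n
drop-all (a ∷ x) {suc m} q = s≤s (drop-all x q)

drop-beyond : ∀ {A : Set} (x : List A) {m} → length x ≤ m → drop m x ≡ []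
drop-beyond []      {zero}  _ = refl
drop-beyond []      {suc m} _ = refl
drop-beyond (a ∷ x) {suc m} (s≤s p) = drop-beyond x p

take-prefix : ∀ {A : Set} (s : List A) {v} → take (length s) (s ++ v) ≡ s
take-prefix []      = refl
take-prefix (a ∷ s) = cong (a ∷_) (take-prefix s)

length-around : ∀ {A : Set} h (s : List A) c u →
                h + length (s ++ c ∷ u) ≡ suc (h + length s) + length u
length-around h []      c u rewrite +-identityʳ h = +-suc h (length u)
length-around h (a ∷ s) c u rewrite +-suc h (length s) | +-suc h (length (s ++ c ∷ u)) =
  cong suc (length-around h s c u)

module Word {n : ℕ} {S : Subset n} (M : OPM S) (x : List (Letter n)) where

  N : ℕ
  N = length x

  P : ℕ → Sym n
  P = pos M x

  r : ℕ → ℕ → Maybe Prec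
  r i j = ext M (P i) (P j)

  open Geometry N r public

  pos-next : ∀ y m → pos M y (suc m) ≡ nextSym M (drop m y)
  pos-next []      zero    = refl
  pos-next []      (suc m) = refl
  pos-next (a ∷ y) zero    = refl
  pos-next (a ∷ y) (suc m) = pos-next y m

  P-letter : ∀ {m b y} → drop m x ≡ b ∷ y → P (suc m) ≡ lt b
  P-letter {m} q = trans (pos-next x m) (cong (nextSym M) q)

  letter-at : ∀ {m c} → P (suc m) ≡ lt c → drop m x ≡ c ∷ drop (suc m) x
  letter-at {m} {c} q with drop m x in eq
  ... | [] with () ← trans (sym q) (trans (pos-next x m) (cong (nextSym M) eq))
  ... | b ∷ y rewrite drop-tail m x eq
    with refl ← trans (sym q) (P-letter {m} eq) = refl

  letter-exists : ∀ {i} → 1 ≤ i → i ≤ N → ∃ λ c → P i ≡ lt c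
  letter-exists {suc m} _ i≤N with drop m x in eq
  ... | []    = ⊥-elim (<⇒≱ i≤N (drop-all x eq))
  ... | b ∷ y = b , P-letter {m} eq

  P-target : P (suc N) ≡ end
  P-target = trans (pos-next x N) (cong (nextSym M) (drop-beyond x ≤-refl))

  r-source : ∀ j → r 0 j ≡ just ⋖
  r-source j = refl

  r-target : ∀ i → 1 ≤ i → i ≤ N → r i (suc N) ≡ just ⋗
  r-target i p q with letter-exists p q
  ... | c , eq rewrite eq | P-target = refl

  -- Position `h + 1` carries the list entry with index `h`, so the letters strictly between `h` and
  -- `j` begin at `drop h x`.
  Seg : ℕ → List (Letter n) → ℕ → Set
  Seg h u j = (∃ λ v → drop h x ≡ u ++ v) × j ≡ suc h + length u

  seg-compose : ∀ {h s k c u j} → Seg h s k → P k ≡ lt c → Seg k u j →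
                Seg h (s ++ c ∷ u) j
  seg-compose {h} {s} {c = c} {u} ((v , p) , refl) q ((w , p′) , refl) =
    (w , trans p (trans (cong (s ++_) eq) (sym (++-assoc s (c ∷ u) w)))) ,
    cong suc (sym (length-around h s c u))
    where
    eq : v ≡ (c ∷ u) ++ w
    eq = trans (sym (drop-prefix h x s p))
           (trans (letter-at {h + length s} q) (cong (c ∷_) p′))

  seg-split : ∀ {h j c u} s → Seg h (s ++ c ∷ u) j →
              let k = suc h + length s in
              Seg h s k × P k ≡ lt c × Seg k u j × k < j
  seg-split {h} {c = c} {u} s ((v , p) , refl) =
    ((c ∷ u ++ v , p′) , refl) , P-letter {h + length s} here ,
    ((v , drop-tail (h + length s) x here) , cong suc (length-around h s c u)) ,
    s≤s (≤-trans (m≤m+n _ (length u)) (≤-reflexive (sym (length-around h s c u))))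
    where
    p′ = trans p (++-assoc s (c ∷ u) v)
    here = drop-prefix h x s p′

  SegGap SegChain : ℕ → ℕ → Set
  SegGap   h j = ∃ λ u → Seg h u j × Gap M (P h) u (P j)
  SegChain h j = ∃ λ u → Seg h u j × Chain M (P h) u (P j)

  mutual
    edge⇒gap : ∀ {h j} → Edge h j → SegGap h j
    edge⇒gap {h} (adj _) = [] , ((_ , refl) , cong suc (sym (+-identityʳ h))) , empty
    edge⇒gap (pop o e q) = map₂ (map₂ nest) (pop⇒chain o e q)

    pop⇒chain : ∀ {h k i j} → Open h k i → Edge i j → r i j ≡ just ⋗ → SegChain h j
    pop⇒chain {i = i} {j} o e q
      with letter-exists (≤-<-trans z≤n (open-< o)) (open-≤ o) | edge⇒gap e
    ... | c , eq | u , s , g = open⇒chain o eq s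
      (stop (subst (λ a → ext M a (P j) ≡ just ⋗) eq q)
            (subst (λ a → Gap M a u (P j)) eq g))

    -- `Open` grows at its last position while `Run` unfolds from its first letter. The handle is
    -- taken apart from the right with the `Run` as accumulator; conversely, `run⇒edge` goes from
    -- left to right and accumulates the `Open`.
    open⇒chain : ∀ {h k i j c u} → Open h k i → P i ≡ lt c → Seg i u j →
                 Run M c u (P j) → SegChain h j
    open⇒chain {h} {k} (start e _ q) eq s run with edge⇒gap e
    ... | u , s′ , g = _ , seg-compose s′ eq s ,
      chain (subst (λ b → ext M (P h) b ≡ just ⋖) eq q)
            (subst (λ b → Gap M (P h) u b) eq g) run
    open⇒chain (more {c = c} {d} o e _ q) eq s run
      with letter-exists (≤-<-trans z≤n (open-< o)) (open-≤ o) | edge⇒gap e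
    ... | _ , eq′ | _ , s′ , g = open⇒chain o eq′ (seg-compose s′ eq s)
      (next (subst₂ (λ a b → ext M a b ≡ just ≐) eq′ eq q)
            (subst₂ (λ a b → Gap M a _ b) eq′ eq g) run)

  mutual
    gap⇒edge : ∀ {h j a s b} → Gap M a s b → a ≡ P h → b ≡ P j → Seg h s j →
               j ≤ suc N → Edge h j
    gap⇒edge {h} empty _ _ (_ , refl) j≤ rewrite +-identityʳ h = adj (s≤s⁻¹ j≤)
    gap⇒edge (nest c) p q s j≤ = chain⇒edge c p q s j≤

    chain⇒edge : ∀ {h j a s b} → Chain M a s b → a ≡ P h → b ≡ P j → Seg h s j →
                 j ≤ suc N → Edge h j
    chain⇒edge {h} {j} (chain {s = s} q g run) refl refl sg j≤
      with sg₁ , eq , sg₂ , k<j ← seg-split s sg =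
      run⇒edge (start (gap⇒edge g refl (sym eq) sg₁ (≤-trans (<⇒≤ k<j) j≤))
                      (s≤s⁻¹ (≤-trans k<j j≤))
                      (subst (λ b → ext M (P h) b ≡ just ⋖) (sym eq) q))
               eq run refl sg₂ j≤

    run⇒edge : ∀ {h k i j c s b} → Open h k i → P i ≡ lt c → Run M c s b →
               b ≡ P j → Seg i s j → j ≤ suc N → Edge h j
    run⇒edge {j = j} o eq (stop q g) refl sg j≤ =
      pop o (gap⇒edge g (sym eq) refl sg j≤)
            (subst (λ a → ext M a (P j) ≡ just ⋗) (sym eq) q)
    run⇒edge o eq (next {s = s} q g run) refl sg j≤
      with sg₁ , eq′ , sg₂ , k<j ← seg-split s sg =
      run⇒edge (more o (gap⇒edge g (sym eq) (sym eq′) sg₁ (≤-trans (<⇒≤ k<j) j≤))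
                     (s≤s⁻¹ (≤-trans k<j j≤))
                     (subst₂ (λ a b → ext M a b ≡ just ≐) (sym eq) (sym eq′) q))
               eq′ run refl sg₂ j≤

  seg-take : ∀ {h j u} → Seg h u j → u ≡ take (j ∸ suc h) (drop h x)
  seg-take {h} {u = u} ((v , p) , refl)
    rewrite p | m+n∸m≡n h (length u) = sym (take-prefix u)

  take-seg : ∀ {h j} → h < j → j ≤ suc N → Seg h (take (j ∸ suc h) (drop h x)) j
  take-seg {h} {suc j} (s≤s h≤j) (s≤s j≤N) =
    (drop (j ∸ h) (drop h x) , sym (take++drop≡id (j ∸ h) (drop h x))) ,
    cong suc (sym (trans (cong (h +_) len) (m+[n∸m]≡n h≤j)))
    where
    len : length (take (j ∸ h) (drop h x)) ≡ j ∸ h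
    len = trans (length-take (j ∸ h) (drop h x))
      (m≤n⇒m⊓n≡m (≤-trans (∸-monoˡ-≤ h j≤N) (≤-reflexive (sym (length-drop h x)))))

  chi⇒edge : ∀ {i j} → chi M x i j → Edge i j
  chi⇒edge (i< , j≤ , c) = chain⇒edge c refl refl (take-seg (<⇒≤ i<) j≤) j≤

  edge⇒chi : ∀ {i j} → Edge i j → suc i < j → chi M x i j
  edge⇒chi {i} e i< with edge⇒gap e
  ... | [] , (_ , refl) , _ = ⊥-elim (<-irrefl (cong suc (sym (+-identityʳ i))) i<)
  ... | u@(_ ∷ _) , sg , nest c =
    i< , edge-≤ e , subst (λ u → Chain M (P i) u _) (seg-take sg) c

  -- Compatibility as definedness on all edges

  AllDefined : Set
  AllDefined = ∀ {i j} → Edge i j → Defined M (r i j)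

  -- Edges out of 0 or into `N + 1` fall under the conventions for #. Any other edge joins two
  -- letters that are consecutive or enclose a chain, which are the two clauses of compatibility.
  compatible⇒defined : Compatible M x → AllDefined
  compatible⇒defined (adjacent , chained) {zero} {j} e = ⋖ , refl
  compatible⇒defined (adjacent , chained) {suc m} {j} e
    with m≤n⇒m<n∨m≡n (edge-≤ e)
  ... | inj₂ refl =
    ⋗ , r-target (suc m) (s≤s z≤n) (s≤s⁻¹ (edge-< e))
  ... | inj₁ (s≤s j≤N)
    with letter-exists (s≤s z≤n) (<⇒≤ (<-≤-trans (edge-< e) j≤N))
       | letter-exists (≤-<-trans z≤n (edge-< e)) j≤N | edge⇒gap e
  ... | a , pa | b , pb | u , ((v , p) , refl) , g rewrite pa | pb with g
  ...   | empty = adjacent (take m x) a b (drop (suc (suc m)) x)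
    (trans (sym (take++drop≡id m x)) (cong (take m x ++_)
      (trans (letter-at {m} pa) (cong (a ∷_)
        (letter-at (subst (λ i → P (suc (suc i)) ≡ lt b) (+-identityʳ m) pb))))))
  ...   | nest c = chained (end ∷ map lt (take m x)) (lt a) u (lt b)
                           (map lt (drop k x) ++ [ end ])
    (cong (end ∷_) (trans (cong (λ y → map lt y ++ [ end ]) whole) (mapped (take m x))))
    c
    where
    k = suc (suc m) + length u
    whole : x ≡ take m x ++ a ∷ u ++ b ∷ drop k x
    whole = trans (sym (take++drop≡id m x)) (cong (take m x ++_)
      (trans (letter-at {m} pa) (cong (a ∷_) (trans p (cong (u ++_)
        (trans (sym (drop-prefix (suc m) x u p)) (letter-at pb)))))))
    mapped : ∀ w → map lt (w ++ a ∷ u ++ b ∷ drop k x) ++ [ end ] ≡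
             map lt w ++ lt a ∷ map lt u ++ lt b ∷ map lt (drop k x) ++ [ end ]
    mapped [] rewrite map-++ lt u (b ∷ drop k x) =
      cong (lt a ∷_) (++-assoc (map lt u) _ _)
    mapped (c ∷ w) = cong (lt c ∷_) (mapped w)

  private
    drop-++ : ∀ (p : List (Letter n)) {q} → x ≡ p ++ q → drop (length p) x ≡ q
    drop-++ p = drop-prefix 0 x p

    -- Compatibility looks for chains in the word with its end markers; this brings an occurrence
    -- whose context consists of letters back into the word itself.
    inner-letter : ∀ y p {c : Letter n} {q} → map lt y ++ [ end ] ≡ p ++ lt c ∷ q →
      ∃₂ λ p′ q′ → p ≡ map lt p′ × q ≡ map lt q′ ++ [ end ] × y ≡ p′ ++ c ∷ q′
    inner-letter []      (_ ∷ [])    ()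
    inner-letter []      (_ ∷ _ ∷ _) ()
    inner-letter (a ∷ y) []      refl = [] , y , refl , refl , refl
    inner-letter (a ∷ y) (_ ∷ p) q with refl , q′ ← ∷-injective q
      with p′ , q″ , refl , e , refl ← inner-letter y p q′ =
      a ∷ p′ , q″ , refl , e , refl

  lt-injective : ∀ {a b : Letter n} → lt a ≡ lt b → a ≡ b
  lt-injective refl = refl

  defined⇒compatible : AllDefined → Compatible M x
  defined⇒compatible d = adjacent , chained
    where
    at-letters : ∀ pre a u b post → x ≡ pre ++ a ∷ u ++ b ∷ post →
                 Gap M (lt a) u (lt b) → Defined M (OPM.mat M a b)
    at-letters pre a u b post eq g =
      subst₂ (λ a b → Defined M (ext M a b)) pa pb
        (d (gap⇒edge g (sym pa) (sym pb) ((_ , tl) , refl)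
                     (s≤s (<⇒≤ (length-prefix x here)))))
      where
      i = suc (length pre)
      hd = drop-++ pre eq
      tl = drop-tail (length pre) x hd
      here = drop-prefix i x u tl
      pa = P-letter {length pre} hd
      pb = P-letter {i + length u} here

    adjacent : ∀ pre a b post → x ≡ pre ++ a ∷ b ∷ post → Defined M (OPM.mat M a b)
    adjacent pre a b post eq = at-letters pre a [] b post eq empty

    chained : ∀ pre a u b post →
       end ∷ map lt x ++ [ end ] ≡ pre ++ a ∷ map lt u ++ b ∷ post →
       Chain M a u b → Defined M (ext M a b)
    chained pre end u b post eq c = ⋖ , refl
    chained pre (lt a) u end post eq c = ⋗ , refl
    chained [] (lt a) u (lt b) post () c
    chained (_ ∷ pre) (lt a) u (lt b) post eq c
      with p , q , refl , e , refl ← inner-letter x pre (proj₂ (∷-injective eq))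
      with p′ , q′ , e′ , _ , refl ← inner-letter q (map lt u) (sym e)
      with refl ← map-injective lt-injective e′ =
      at-letters p a u b q′ refl (nest c)

-- Runs as labellings of edges

module Runs {n : ℕ} {S : Subset n} (M : OPM S) (x : List (Letter n))
            {k : ℕ} (A : OPA M k) where
  open Word M x
  open OPA A

  -- The state stored with a stacked letter is the one before the push, hence the label of the edge
  -- `h s` on which the handle was begun; shifts keep it. This is why `pop-ok` refers to `ℓ h s`.
  record Labelling (ℓ : ℕ → ℕ → Fin k) : Set where
    field
      initial-ok : T (initial (ℓ 0 1))
      final-ok   : T (final (ℓ 0 (suc N)))
      push-ok    : ∀ {h j b} → Edge h j → P j ≡ lt b → r h j ≡ just ⋖ →
                   T (δpush (ℓ h j) b (ℓ j (suc j)))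
      shift-ok   : ∀ {h j b} → Edge h j → P j ≡ lt b → r h j ≡ just ≐ →
                   T (δshift (ℓ h j) b (ℓ j (suc j)))
      pop-ok     : ∀ {h s i j} → Open h s i → Edge i j → r i j ≡ just ⋗ →
                   T (δpop (ℓ i j) (ℓ h s) (ℓ h j))

  -- From a labelling to an accepting run

  module _ {ℓ : ℕ → ℕ → Fin k} (L : Labelling ℓ) where
    open Labelling L

    private
      Steps = Star (Move M A)

    mutual
      -- An edge is the part of a run from the moment after `h` has been read up to some moment at
      -- which `j` is next and the stack is as before. What lies below is never touched, so `γ` is
      -- arbitrary. When `j` is next, `drop (pred j) x` is unread.
      edge-run : ∀ {h j γ} → Edge h j → topSym M γ ≡ P h →
                 Steps (drop h x , ℓ h (suc h) , γ) (drop (pred j) x , ℓ h j , γ)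
      edge-run (adj _) t = ε
      edge-run {j = suc m} (pop {h} {s} {i} o e q) t with open-run o t
      ... | c , eq , steps = steps ◅◅ edge-run e (sym eq) ◅◅
        pop (subst₂ (λ a b → ext M a b ≡ just ⋗) eq (pos-next x m) q) (pop-ok o e q) ◅ ε
      edge-run {j = zero} e@(pop _ _ _) t with () ← edge-< e

      open-run : ∀ {h s i γ} → Open h s i → topSym M γ ≡ P h →
                 ∃ λ c → P i ≡ lt c ×
                 Steps (drop h x , ℓ h (suc h) , γ)
                       (drop i x , ℓ i (suc i) , (c , ℓ h s) ∷ γ)
      open-run {i = zero} o t with () ← open-< o
      open-run {h} {i = i@(suc m)} {γ} (start e p q) t with letter-exists (s≤s z≤n) p
      ... | c , eq = c , eq , edge-run e t ◅◅
        subst (λ y → Steps (y , ℓ h i , γ) (drop i x , ℓ i (suc i) , (c , ℓ h i) ∷ γ))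
          (sym (letter-at eq))
          (push (subst₂ (λ a b → ext M a b ≡ just ⋖) (sym t) eq q) (push-ok e eq q) ◅ ε)
      open-run {h} {s} {i@(suc m)} {γ} (more {c = d} o e p q) t
        with letter-exists (s≤s z≤n) p | open-run o t
      ... | c , eq | a , eq′ , steps = c , eq , steps ◅◅ edge-run e (sym eq′) ◅◅
        subst (λ y → Steps (y , ℓ d i , (a , ℓ h s) ∷ γ)
                           (drop i x , ℓ i (suc i) , (c , ℓ h s) ∷ γ))
          (sym (letter-at eq))
          (shift (subst₂ (λ a b → ext M a b ≡ just ≐) eq′ eq q) (shift-ok e eq q) ◅ ε)

    labelling⇒accepts : Edge 0 (suc N) → Accepts M A x
    labelling⇒accepts e = ℓ 0 1 , ℓ 0 (suc N) , initial-ok , final-ok ,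
      subst (λ y → Steps (x , ℓ 0 1 , []) (y , ℓ 0 (suc N) , [])) (drop-beyond x ≤-refl) (edge-run e refl)

  -- From an accepting run to a labelling

  -- The parser visits the edges by increasing right end and, for equal right
  -- ends, by decreasing left end.
  Before UpTo : ℕ → ℕ → ℕ → ℕ → Set
  Before h j a b = b < j ⊎ (b ≡ j × h < a)
  UpTo   h j a b = b < j ⊎ (b ≡ j × h ≤ a)

  upTo-split : ∀ {h j a b} → UpTo h j a b → Before h j a b ⊎ (a ≡ h × b ≡ j)
  upTo-split (inj₁ p) = inj₁ (inj₁ p)
  upTo-split (inj₂ (p , q)) with m≤n⇒m<n∨m≡n q
  ... | inj₁ q′ = inj₁ (inj₂ (p , q′))
  ... | inj₂ q′ = inj₂ (sym q′ , p)

  record Produced (ℓ : ℕ → ℕ → Fin k) (a b : ℕ) : Set where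
    field
      by-init  : a ≡ 0 → b ≡ 1 → T (initial (ℓ a b))
      by-push  : ∀ {g c} → b ≡ suc a → Edge g a → P a ≡ lt c → r g a ≡ just ⋖ →
                 T (δpush (ℓ g a) c (ℓ a b))
      by-shift : ∀ {g c} → b ≡ suc a → Edge g a → P a ≡ lt c → r g a ≡ just ≐ →
                 T (δshift (ℓ g a) c (ℓ a b))
      by-pop   : ∀ {s i} → Open a s i → Edge i b → r i b ≡ just ⋗ →
                 T (δpop (ℓ i b) (ℓ a s) (ℓ a b))
  open Produced

  data Stack (ℓ : ℕ → ℕ → Fin k) : ℕ → List (Letter n × Fin k) → Set where
    bottom : Stack ℓ 0 []
    entry  : ∀ {g s h c p γ} → Open g s h → P h ≡ lt c → p ≡ ℓ g s → Stack ℓ g γ →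
             Stack ℓ h ((c , p) ∷ γ)

  topSym-stack : ∀ {ℓ h γ} → Stack ℓ h γ → topSym M γ ≡ P h
  topSym-stack bottom           = refl
  topSym-stack (entry _ eq _ _) = sym eq

  record Invariant (ℓ : ℕ → ℕ → Fin k) (h j : ℕ) : Set where
    field
      current  : Edge h j
      produced : ∀ {a b} → Edge a b → UpTo h j a b → Produced ℓ a b
      defined  : ∀ {a b} → Edge a b → Before h j a b → Defined M (r a b)
  open Invariant

  -- The move that produces a label involves only labels of edges visited no later, so labelling a
  -- new edge leaves all earlier facts intact.
  produced-cong : ∀ {ℓ ℓ′ a b} → (∀ {c d} → UpTo a b c d → ℓ c d ≡ ℓ′ c d) →
                  Edge a b → Produced ℓ a b → Produced ℓ′ a b
  produced-cong {ℓ} {ℓ′} {a} {b} same e p = record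
    { by-init  = λ u v → subst (T ∘ initial) here (by-init p u v)
    ; by-push  = λ {_} {c} u v w q → subst₂ (λ s t → T (δpush s c t))
                   (same (inj₁ (edge-< e))) here (by-push p u v w q)
    ; by-shift = λ {_} {c} u v w q → subst₂ (λ s t → T (δshift s c t))
                   (same (inj₁ (edge-< e))) here (by-shift p u v w q)
    ; by-pop   = λ o e′ q → subst (λ t → T (δpop _ _ t)) here
                   (subst₂ (λ s t → T (δpop s t _))
                     (same (inj₂ (refl , <⇒≤ (open-< o))))
                     (same (inj₁ (open-edge-< o e′)))
                     (by-pop p o e′ q))
    }
    where here = same (inj₂ (refl , ≤-refl))

  stack-cong : ∀ {ℓ ℓ′ h γ} → (∀ {c d} → d ≤ h → ℓ c d ≡ ℓ′ c d) →
               Stack ℓ h γ → Stack ℓ′ h γ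
  stack-cong same bottom = bottom
  stack-cong same (entry o eq p st) = entry o eq
    (trans p (same (open-start-≤ o)))
    (stack-cong (λ d≤g → same (≤-trans d≤g (<⇒≤ (open-< o)))) st)

  abstract
    update : (ℕ → ℕ → Fin k) → ℕ → ℕ → Fin k → ℕ → ℕ → Fin k
    update ℓ h j q a b = if ⌊ a ≟ h ×-dec b ≟ j ⌋ then q else ℓ a b

    update-new : ∀ ℓ h j q → update ℓ h j q h j ≡ q
    update-new ℓ h j q with h ≟ h ×-dec j ≟ j
    ... | yes _ = refl
    ... | no n  = ⊥-elim (n (refl , refl))

    update-old : ∀ ℓ {h j} q {a b} → ¬ (a ≡ h × b ≡ j) → ℓ a b ≡ update ℓ h j q a b
    update-old ℓ {h} {j} q {a} {b} n with a ≟ h ×-dec b ≟ j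
    ... | yes p = ⊥-elim (n p)
    ... | no _  = refl

  upTo-trans : ∀ {h j a b c d} → UpTo h j a b → UpTo a b c d → UpTo h j c d
  upTo-trans (inj₁ p) (inj₁ q) = inj₁ (<-trans q p)
  upTo-trans (inj₁ p) (inj₂ (refl , _)) = inj₁ p
  upTo-trans (inj₂ (refl , p)) (inj₁ q) = inj₁ q
  upTo-trans (inj₂ (refl , p)) (inj₂ (refl , q)) = inj₂ (refl , ≤-trans p q)

  record Next (h j h′ j′ : ℕ) : Set where
    field
      later : ¬ UpTo h j h′ j′
      only  : ∀ {a b} → Edge a b → Before h′ j′ a b → UpTo h j a b

  module _ {ℓ : ℕ → ℕ → Fin k} {h j h′ j′ : ℕ} {q : Fin k} (nx : Next h j h′ j′) where
    open Next nx

    update-same : ∀ {c d} → UpTo h j c d → ℓ c d ≡ update ℓ h′ j′ q c d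
    update-same u = update-old ℓ q λ { (refl , refl) → later u }

    extend : Invariant ℓ h j → Edge h′ j′ → Defined M (r h j) →
             Produced (update ℓ h′ j′ q) h′ j′ → Invariant (update ℓ h′ j′ q) h′ j′
    extend inv e d p = record { current = e ; produced = prod ; defined = def }
      where
      prod : ∀ {a b} → Edge a b → UpTo h′ j′ a b → Produced (update ℓ h′ j′ q) a b
      prod e′ u with upTo-split u
      ... | inj₂ (refl , refl) = p
      ... | inj₁ bf = produced-cong (λ u′ → update-same (upTo-trans (only e′ bf) u′))
                        e′ (produced inv e′ (only e′ bf))
      def : ∀ {a b} → Edge a b → Before h′ j′ a b → Defined M (r a b)
      def e′ bf with upTo-split (only e′ bf)
      ... | inj₁ bf′ = defined inv e′ bf′
      ... | inj₂ (refl , refl) = d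

  -- By `termR` an edge without ⋗ is the last one visited with its right end. The first with right
  -- end `j + 1` is the adjacent one, having the largest possible left end.
  next-read : ∀ {h j} → Edge h j → r h j ≢ just ⋗ → Next h j j (suc j)
  next-read {h} {j} e n = record { later = later ; only = only }
    where
    later : ¬ UpTo h j j (suc j)
    later (inj₁ p)       = <⇒≱ p (n≤1+n j)
    later (inj₂ (p , _)) = 1+n≢n p
    only : ∀ {a b} → Edge a b → Before j (suc j) a b → UpTo h j a b
    only e′ (inj₁ p) with m≤n⇒m<n∨m≡n (s≤s⁻¹ p)
    ... | inj₁ b<j  = inj₁ b<j
    ... | inj₂ refl = inj₂ (refl , termR e n e′)
    only e′ (inj₂ (refl , p)) = ⊥-elim (<⇒≱ (edge-< e′) p)

  next-pop : ∀ {g s h j} → Open g s h → Edge h j → Next h j g j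
  next-pop {g} {s} {h} {j} o e = record { later = later ; only = only }
    where
    later : ¬ UpTo h j g j
    later (inj₁ p)       = <-irrefl refl p
    later (inj₂ (_ , p)) = <⇒≱ (open-< o) p
    only : ∀ {a b} → Edge a b → Before g j a b → UpTo h j a b
    only e′ (inj₁ p) = inj₁ p
    only e′ (inj₂ (refl , p)) = inj₂ (refl , ≮⇒≥ λ q → <⇒≱ p (gapL o e e′ q))

  module _ {h j : ℕ} {ℓ : ℕ → ℕ → Fin k} {q : Fin k} (e : Edge h j) where
    private ℓ′ = update ℓ j (suc j) q

    produced-push : ∀ {b} → P j ≡ lt b → r h j ≡ just ⋖ → T (δpush (ℓ h j) b q) →
                    Produced ℓ′ j (suc j)
    produced-push {b} pj rel t = record
      { by-init  = λ { refl → ⊥-elim (n≮0 (edge-< e)) }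
      ; by-push  = λ {g} {c} _ e′ pc rel′ → push-case e′ pc rel′
      ; by-shift = λ _ e′ _ rel′ → ⊥-elim (clash (λ ()) rel
          (subst (λ g → r g j ≡ _) (unique-parent e′ (clash (λ ()) rel′) e (clash (λ ()) rel)) rel′))
      ; by-pop   = λ o e′ _ → ⊥-elim (<⇒≱ (edge-< e′) (open-< o))
      }
      where
      push-case : ∀ {g c} → Edge g j → P j ≡ lt c → r g j ≡ just ⋖ →
                  T (δpush (ℓ′ g j) c (ℓ′ j (suc j)))
      push-case e′ pc rel′
        with refl ← unique-parent e′ (clash (λ ()) rel′) e (clash (λ ()) rel)
        with refl ← trans (sym pj) pc
        = subst₂ (λ s u → T (δpush s b u))
            (update-old ℓ q λ { (_ , p) → 1+n≢n (sym p) })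
            (sym (update-new ℓ j (suc j) q)) t

    produced-shift : ∀ {b} → P j ≡ lt b → r h j ≡ just ≐ → T (δshift (ℓ h j) b q) →
                     Produced ℓ′ j (suc j)
    produced-shift {b} pj rel t = record
      { by-init  = λ { refl → ⊥-elim (n≮0 (edge-< e)) }
      ; by-push  = λ _ e′ _ rel′ → ⊥-elim (clash (λ ()) rel
          (subst (λ g → r g j ≡ _) (unique-parent e′ (clash (λ ()) rel′) e (clash (λ ()) rel)) rel′))
      ; by-shift = λ {g} {c} _ e′ pc rel′ → shift-case e′ pc rel′
      ; by-pop   = λ o e′ _ → ⊥-elim (<⇒≱ (edge-< e′) (open-< o))
      }
      where
      shift-case : ∀ {g c} → Edge g j → P j ≡ lt c → r g j ≡ just ≐ →
                   T (δshift (ℓ′ g j) c (ℓ′ j (suc j)))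
      shift-case e′ pc rel′
        with refl ← unique-parent e′ (clash (λ ()) rel′) e (clash (λ ()) rel)
        with refl ← trans (sym pj) pc
        = subst₂ (λ s u → T (δshift s b u))
            (update-old ℓ q λ { (_ , p) → 1+n≢n (sym p) })
            (sym (update-new ℓ j (suc j) q)) t

  produced-pop : ∀ {ℓ g s h j q} → Open g s h → Edge h j →
                 T (δpop (ℓ h j) (ℓ g s) q) → Produced (update ℓ g j q) g j
  produced-pop {ℓ} {g} {s} {h} {j} {q} o e t = record
    { by-init  = λ { refl refl → ⊥-elim (<⇒≱ (edge-< e) (open-< o)) }
    ; by-push  = λ { refl → ⊥-elim (<⇒≱ (edge-< e) (open-< o)) }
    ; by-shift = λ { refl → ⊥-elim (<⇒≱ (edge-< e) (open-< o)) }
    ; by-pop   = λ o′ e′ _ → pop-case o′ e′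
    }
    where
    ℓ′ = update ℓ g j q
    pop-case : ∀ {s′ i} → Open g s′ i → Edge i j → T (δpop (ℓ′ i j) (ℓ′ g s′) (ℓ′ g j))
    pop-case o′ e′ with refl , refl ← unique-popped o′ e′ o e =
      subst (λ u → T (δpop (ℓ′ h j) (ℓ′ g s) u)) (sym (update-new ℓ g j q))
        (subst₂ (λ u v → T (δpop u v q))
          (update-old ℓ q λ { (p , _) → <-irrefl (sym p) (open-< o) })
          (update-old ℓ q λ { (_ , p) → <-irrefl p (open-edge-< o e) }) t)

  Outcome : Set
  Outcome = Edge 0 (suc N) × AllDefined × ∃ Labelling

  private
    -- Compatibility is read off here: a move was enabled at every edge before the outer one, so its
    -- precedence is defined, and on the outer edge # yields by convention.
    conclude : ∀ {ℓ} → Invariant ℓ 0 (suc N) → T (final (ℓ 0 (suc N))) → Outcome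
    conclude {ℓ} inv f = current inv , def , ℓ , record
      { initial-ok = by-init (at (adj z≤n)) refl refl
      ; final-ok   = f
      ; push-ok    = λ e eq q → by-push (at (adj (inner eq e))) refl e eq q
      ; shift-ok   = λ e eq q → by-shift (at (adj (inner eq e))) refl e eq q
      ; pop-ok     = λ o e q → by-pop (at (pop o e q)) o e q
      }
      where
      upTo : ∀ {a b} → Edge a b → UpTo 0 (suc N) a b
      upTo e with m≤n⇒m<n∨m≡n (edge-≤ e)
      ... | inj₁ p = inj₁ p
      ... | inj₂ p = inj₂ (p , z≤n)
      at : ∀ {a b} → Edge a b → Produced ℓ a b
      at e = produced inv e (upTo e)
      def : AllDefined
      def e with upTo-split (upTo e)
      ... | inj₁ bf = defined inv e bf
      ... | inj₂ (refl , refl) = ⋖ , refl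
      inner : ∀ {h j b} → P j ≡ lt b → Edge h j → j ≤ N
      inner eq e with m≤n⇒m<n∨m≡n (edge-≤ e)
      ... | inj₁ p = s≤s⁻¹ p
      ... | inj₂ refl with () ← trans (sym P-target) eq

    simulate : ∀ {y q γ qF} ℓ h m → Star (Move M A) (y , q , γ) ([] , qF , []) →
               T (final qF) → drop m x ≡ y → ℓ h (suc m) ≡ q → Stack ℓ h γ →
               Invariant ℓ h (suc m) → Outcome
    simulate ℓ h m ε f d refl bottom inv
      with refl ← ≤-antisym (s≤s⁻¹ (edge-≤ (current inv))) (drop-all x d) = conclude inv f
    simulate ℓ h m (push {b = b} {q = q} rel t ◅ steps) f d refl st inv =
      simulate (update ℓ (suc m) (suc (suc m)) q) (suc m) (suc m) steps f
        (drop-tail m x d) (update-new ℓ _ _ q)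
        (entry (start e (length-prefix x d) rel′) pb (update-same nx (inj₂ (refl , ≤-refl)))
          (stack-cong (λ d≤h → update-same nx (inj₁ (≤-<-trans d≤h (edge-< e)))) st))
        (extend nx inv (adj (length-prefix x d)) (⋖ , rel′) (produced-push e pb rel′ t))
      where
      e    = current inv
      pb   = P-letter {m} d
      rel′ = subst₂ (λ a b → ext M a b ≡ just ⋖) (topSym-stack st) (sym pb) rel
      nx   = next-read e (clash (λ ()) rel′)
    simulate ℓ h m (shift {r = q} rel t ◅ steps) f d refl (entry o eq p st) inv =
      simulate (update ℓ (suc m) (suc (suc m)) q) (suc m) (suc m) steps f
        (drop-tail m x d) (update-new ℓ _ _ q)
        (entry (more o e (length-prefix x d) rel′) pb
          (trans p (update-same nx (inj₁ (s≤s (≤-trans (open-start-≤ o) (s≤s⁻¹ (edge-< e)))))))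
          (stack-cong (λ d≤g → update-same nx
            (inj₁ (≤-<-trans d≤g (<-trans (open-< o) (edge-< e))))) st))
        (extend nx inv (adj (length-prefix x d)) (≐ , rel′) (produced-shift e pb rel′ t))
      where
      e    = current inv
      pb   = P-letter {m} d
      rel′ = subst₂ (λ a b → ext M a b ≡ just ≐) (sym eq) (sym pb) rel
      nx   = next-read e (clash (λ ()) rel′)
    simulate ℓ h m (pop {r = q} rel t ◅ steps) f d refl (entry {g = g} o eq refl st) inv =
      simulate (update ℓ g (suc m) q) g m steps f d (update-new ℓ _ _ q)
        (stack-cong (λ d≤g → update-same nx
            (inj₁ (≤-<-trans d≤g (<-trans (open-< o) (edge-< e))))) st)
        (extend nx inv (pop o e rel′) (⋗ , rel′) (produced-pop o e t))
      where
      e    = current inv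
      rel′ = subst₂ (λ a b → ext M a b ≡ just ⋗) (sym eq)
               (trans (cong (nextSym M) (sym d)) (sym (pos-next x m))) rel
      nx   = next-pop o e

  accepts⇒labelling : Accepts M A x → Outcome
  accepts⇒labelling (qI , qF , i , f , steps) =
    -- Only the label of the edge from 0 to 1 is meant; every other edge receives its label when the
    -- run reaches it.
    simulate (λ _ _ → qI) 0 0 steps f refl refl bottom record
      { current  = adj z≤n
      ; produced = λ e u → first e u
      ; defined  = λ e u → ⊥-elim (none e u)
      }
    where
    first : ∀ {a b} → Edge a b → UpTo 0 1 a b → Produced (λ _ _ → qI) a b
    first e (inj₁ (s≤s z≤n)) with () ← edge-< e
    first {a} e (inj₂ (refl , _)) with refl ← n≤0⇒n≡0 (s≤s⁻¹ (edge-< e)) = record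
      { by-init  = λ _ _ → i
      ; by-push  = λ _ e′ → ⊥-elim (n≮0 (edge-< e′))
      ; by-shift = λ _ e′ → ⊥-elim (n≮0 (edge-< e′))
      ; by-pop   = λ o e′ → ⊥-elim (<⇒≱ (edge-< e′) (open-< o))
      }
    none : ∀ {a b} → Edge a b → ¬ Before 0 1 a b
    none e (inj₁ (s≤s z≤n)) with () ← edge-< e
    none e (inj₂ (refl , p)) = <⇒≱ (edge-< e) p

-- Modes and their local checks

infix 2 _iff_
_iff_ : Set → Set → Set
A iff B = (A → B) × (B → A)

iff-trans : ∀ {A B C : Set} → A iff B → B iff C → A iff C
iff-trans (f , g) (f′ , g′) = f′ ∘ f , g ∘ g′

iff-sym : ∀ {A B : Set} → A iff B → B iff A
iff-sym = swap

T-ext : ∀ {a b} → T a iff T b → a ≡ b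
T-ext {false} {false} _       = refl
T-ext {false} {true}  (_ , g) = ⊥-elim (g tt)
T-ext {true}  {false} (f , _) = ⊥-elim (f tt)
T-ext {true}  {true}  _       = refl

T-cong : ∀ {a b} → a ≡ b → T a iff T b
T-cong refl = id , id

T-∧ : ∀ a {b} → T (a ∧ b) iff (T a × T b)
T-∧ true  = (tt ,_) , proj₂
T-∧ false = (λ ()) , proj₁

T-∨ : ∀ a {b} → T (a ∨ b) iff (T a ⊎ T b)
T-∨ true  = inj₁ , λ _ → tt
T-∨ false = inj₂ , λ { (inj₂ t) → t }

T-not : ∀ a → T (not a) iff ¬ T a
T-not true  = (λ ()) , λ f → f tt
T-not false = (λ _ ()) , λ _ → tt

×-iff : ∀ {A A′ B B′ : Set} → A iff A′ → B iff B′ → (A × B) iff (A′ × B′)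
×-iff (f , g) (f′ , g′) = (λ (a , b) → f a , f′ b) , λ (a , b) → g a , g′ b

⊎-iff : ∀ {A A′ B B′ : Set} → A iff A′ → B iff B′ → (A ⊎ B) iff (A′ ⊎ B′)
⊎-iff (f , g) (f′ , g′) =
  (λ { (inj₁ a) → inj₁ (f a) ; (inj₂ b) → inj₂ (f′ b) }) ,
  (λ { (inj₁ a) → inj₁ (g a) ; (inj₂ b) → inj₂ (g′ b) })

¬-iff : ∀ {A B : Set} → A iff B → (¬ A) iff (¬ B)
¬-iff (f , g) = (_∘ g) , (_∘ f)

∧-iff : ∀ {a b A B} → T a iff A → T b iff B → T (a ∧ b) iff (A × B)
∧-iff {a} p q = iff-trans (T-∧ a) (×-iff p q)

∨-iff : ∀ {a b A B} → T a iff A → T b iff B → T (a ∨ b) iff (A ⊎ B)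
∨-iff {a} p q = iff-trans (T-∨ a) (⊎-iff p q)

not-iff : ∀ {a A} → T a iff A → T (not a) iff (¬ A)
not-iff {a} p = iff-trans (T-not a) (¬-iff p)

⌊⌋-iff : ∀ {A : Set} (d : Dec A) → T ⌊ d ⌋ iff A
⌊⌋-iff (yes a) = (λ _ → a) , λ _ → tt
⌊⌋-iff (no n)  = (λ ()) , n

equal-by : ∀ {a b A B} → T a iff A → T b iff B → A iff B → a ≡ b
equal-by p q s = T-ext (iff-trans p (iff-trans s (iff-sym q)))

false-by : ∀ {a A} → T a iff A → ¬ A → a ≡ false
false-by p n = T-ext ((λ t → n (proj₁ p t)) , ⊥-elim)

¬T-false : ∀ {a} → a ≡ false → ¬ T a
¬T-false refl ()

_≟π_ : DecidableEquality Prec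
⋖ ≟π ⋖ = yes refl
⋖ ≟π ≐ = no λ ()
⋖ ≟π ⋗ = no λ ()
≐ ≟π ⋖ = no λ ()
≐ ≟π ≐ = yes refl
≐ ≟π ⋗ = no λ ()
⋗ ≟π ⋖ = no λ ()
⋗ ≟π ≐ = no λ ()
⋗ ≟π ⋗ = yes refl

_≟ρ_ : DecidableEquality (Maybe Prec)
_≟ρ_ = Maybe.≡-dec _≟π_

isYield isTake : Maybe Prec → Bool
isYield ρ = ⌊ ρ ≟ρ just ⋖ ⌋
isTake  ρ = ⌊ ρ ≟ρ just ⋗ ⌋

-- A kind of edges, given by adjacency and precedence.
Kind : Set
Kind = Bool → Maybe Prec → Bool

-- A mode stands for a relation between positions: edges of some kind, or
-- consecutive yield (take) siblings; F and P are the two directions.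
data Mode : Set where
  edgeF edgeP                   : Kind → Mode
  yieldF yieldP takeF takeP : Mode

-- val is the claim that the position is related to one where goal holds;
-- guard is the claim that the position occurs at all in the mode's hierarchy.
record Claim : Set where
  constructor claim
  field val guard goal : Bool
open Claim

-- acc accumulates the disjunction of goal over the edges sharing the left
-- end (edgeF, later edges only) or the right end (edgeP, up to this edge).
record Obs : Set where
  constructor obs
  field
    adjacent : Bool
    rel      : Maybe Prec
    top look : Claim
    acc      : Bool
open Obs

hitF hitP : Kind → Obs → Bool
hitF K o = K (adjacent o) (rel o) ∧ goal (look o)
hitP K o = K (adjacent o) (rel o) ∧ goal (top o)

-- The premise `rel o ≢ just ⋗` singles out the last edge into the right end (`unique-parent`), and
-- `rel o ≢ just ⋖` the last edge out of the left end (`unique-child`). The sibling guards are fixed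
-- there. For `edgeF` nothing follows the last edge out, hence `acc` is false on it.
EdgeOk InitOk FinOk : Mode → Obs → Set
EdgeOk (edgeF K) o = (T (guard (top o)) × T (guard (look o))) ×
  (T (adjacent o) → val (top o) ≡ hitF K o ∨ acc o) × (rel o ≢ just ⋖ → acc o ≡ false)
EdgeOk (edgeP K) o = (T (guard (top o)) × T (guard (look o))) ×
  (T (adjacent o) → acc o ≡ hitP K o) × (rel o ≢ just ⋗ → val (look o) ≡ acc o)
EdgeOk yieldF o = rel o ≢ just ⋗ → guard (look o) ≡ isYield (rel o) ∧ not (adjacent o)
EdgeOk yieldP o = rel o ≢ just ⋗ → guard (look o) ≡ isYield (rel o) ∧ not (adjacent o)
EdgeOk takeF  o = rel o ≢ just ⋖ → guard (top o) ≡ isTake (rel o) ∧ not (adjacent o)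
EdgeOk takeP  o = rel o ≢ just ⋖ → guard (top o) ≡ isTake (rel o) ∧ not (adjacent o)

-- Position 0 has no edge into it and, as # yields to everything, no edge out of it without ⋖. The
-- bits that other positions receive at such edges are set here.
InitOk (edgeF _) o = ⊤
InitOk (edgeP _) o = val (top o) ≡ false
InitOk yieldF    o = guard (top o) ≡ false
InitOk yieldP    o = guard (top o) ≡ false
InitOk takeF     o = guard (top o) ≡ false
InitOk takeP     o = guard (top o) ≡ false

-- The outer edge is the last one out of 0 although it carries ⋖, so `acc` is closed separately.
-- Position `N + 1` has no successor in the forward modes and no parent in the take modes.
FinOk (edgeF _) o = acc o ≡ false × val (look o) ≡ false
FinOk (edgeP _) o = ⊤
FinOk yieldF    o = val (look o) ≡ false
FinOk yieldP    o = ⊤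
FinOk takeF     o = guard (look o) ≡ false
FinOk takeP     o = guard (look o) ≡ false

-- PopOk m q p o: q is the popped edge, p the edge at which its handle was
-- pushed, and o the resulting edge.
PopOk : Mode → Obs → Obs → Obs → Set
PopOk (edgeF K) q p o = acc p ≡ hitF K o ∨ acc o
PopOk (edgeP K) q p o = acc o ≡ acc q ∨ hitP K o
PopOk yieldF q p o =
  val (look p) ≡ not (adjacent p) ∧ (isYield (rel o) ∧ goal (look o))
PopOk yieldP q p o =
  rel o ≡ just ⋖ → val (look o) ≡ not (adjacent p) ∧ goal (look p)
PopOk takeF q p o =
  rel o ≡ just ⋗ → val (top o) ≡ not (adjacent q) ∧ goal (top q)
PopOk takeP q p o =
  val (top q) ≡ not (adjacent q) ∧ (isTake (rel o) ∧ goal (top o))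

edgeOk? : ∀ m o → Dec (EdgeOk m o)
edgeOk? (edgeF K) o = (T? _ ×-dec T? _) ×-dec (T? _ →-dec _ Bool.≟ _) ×-dec
                      (¬? (rel o ≟ρ just ⋖) →-dec _ Bool.≟ _)
edgeOk? (edgeP K) o = (T? _ ×-dec T? _) ×-dec (T? _ →-dec _ Bool.≟ _) ×-dec
                      (¬? (rel o ≟ρ just ⋗) →-dec _ Bool.≟ _)
edgeOk? yieldF o = ¬? (rel o ≟ρ just ⋗) →-dec _ Bool.≟ _
edgeOk? yieldP o = ¬? (rel o ≟ρ just ⋗) →-dec _ Bool.≟ _
edgeOk? takeF  o = ¬? (rel o ≟ρ just ⋖) →-dec _ Bool.≟ _
edgeOk? takeP  o = ¬? (rel o ≟ρ just ⋖) →-dec _ Bool.≟ _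

initOk? : ∀ m o → Dec (InitOk m o)
initOk? (edgeF _) o = yes tt
initOk? (edgeP _) o = _ Bool.≟ _
initOk? yieldF    o = _ Bool.≟ _
initOk? yieldP    o = _ Bool.≟ _
initOk? takeF     o = _ Bool.≟ _
initOk? takeP     o = _ Bool.≟ _

finOk? : ∀ m o → Dec (FinOk m o)
finOk? (edgeF _) o = _ Bool.≟ _ ×-dec _ Bool.≟ _
finOk? (edgeP _) o = yes tt
finOk? yieldF    o = _ Bool.≟ _
finOk? yieldP    o = yes tt
finOk? takeF     o = _ Bool.≟ _
finOk? takeP     o = _ Bool.≟ _

popOk? : ∀ m q p o → Dec (PopOk m q p o)
popOk? (edgeF K) q p o = _ Bool.≟ _
popOk? (edgeP K) q p o = _ Bool.≟ _
popOk? yieldF    q p o = _ Bool.≟ _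
popOk? yieldP    q p o = rel o ≟ρ just ⋖ →-dec _ Bool.≟ _
popOk? takeF     q p o = rel o ≟ρ just ⋗ →-dec _ Bool.≟ _
popOk? takeP     q p o = _ Bool.≟ _

-- Meaning of the modes and correctness of their checks

module Modes
  (N : ℕ) (r : ℕ → ℕ → Maybe Prec)
  (r-source : ∀ j → r 0 j ≡ just ⋖)
  (r-target : ∀ i → 1 ≤ i → i ≤ N → r i (suc N) ≡ just ⋗)
  (defined  : ∀ {i j} → Geometry.Edge N r i j → ∃ λ π → r i j ≡ just π)
  where
  open Geometry N r
  open Total r-source r-target defined

  Yields Takes : ℕ → ℕ → Set
  Yields h i = Edge h i × suc h < i × r h i ≡ just ⋖
  Takes  i h = Edge i h × suc i < h × r i h ≡ just ⋗

  YieldStep TakeStep : ℕ → ℕ → Set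
  YieldStep i k = ∃ λ h → Yields h i × Yields h k × i < k × NoBetween (Edge h) i k
  TakeStep  i k = ∃ λ h → Takes i h × Takes k h × i < k ×
                  NoBetween (λ m → Edge m h) i k

  EdgeStep : Kind → ℕ → ℕ → Set
  EdgeStep K i j = Edge i j × T (K ⌊ j ≟ suc i ⌋ (r i j))

  Step : Mode → ℕ → ℕ → Set
  Step (edgeF K) i j = EdgeStep K i j
  Step (edgeP K) i j = EdgeStep K j i
  Step yieldF    i j = YieldStep i j
  Step yieldP    i j = YieldStep j i
  Step takeF     i j = TakeStep i j
  Step takeP     i j = TakeStep j i

  Guard : Mode → ℕ → Set
  Guard (edgeF _) i = ⊤
  Guard (edgeP _) i = ⊤
  Guard yieldF    i = ∃ λ h → Yields h i
  Guard yieldP    i = ∃ λ h → Yields h i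
  Guard takeF     i = ∃ λ h → Takes i h
  Guard takeP     i = ∃ λ h → Takes i h

  yields-≤ : ∀ {h i} → Yields h i → i ≤ suc N
  yields-≤ (e , _) = edge-≤ e

  takes-≤ : ∀ {i h} → Takes i h → i ≤ suc N
  takes-≤ (e , _) = ≤-trans (<⇒≤ (edge-< e)) (edge-≤ e)

  step-≤ : ∀ m {i j} → Step m i j → j ≤ suc N
  step-≤ (edgeF K) (e , _) = edge-≤ e
  step-≤ (edgeP K) (e , _) = ≤-trans (<⇒≤ (edge-< e)) (edge-≤ e)
  step-≤ yieldF (_ , _ , y , _) = yields-≤ y
  step-≤ yieldP (_ , y , _)     = yields-≤ y
  step-≤ takeF  (_ , _ , y , _) = takes-≤ y
  step-≤ takeP  (_ , y , _)     = takes-≤ y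

  adjacent-iff : ∀ h j → T ⌊ j ≟ suc h ⌋ iff j ≡ suc h
  adjacent-iff h j = ⌊⌋-iff (j ≟ suc h)

  far : ∀ {h j} → Edge h j → ¬ j ≡ suc h → suc h < j
  far e n = ≤∧≢⇒< (edge-< e) (n ∘ sym)

  near : ∀ {h j} → suc h < j → ¬ j ≡ suc h
  near p q = <-irrefl (sym q) p

  -- Popping the handle begun at `i` moves the right end of the edge out of `h` from `i` to the next
  -- one, so consecutive yield siblings are the two ends of one pop.
  yieldStep⇒pop : ∀ {i k} → YieldStep i k → ∃₂ λ h l →
    Yields h i × r h k ≡ just ⋖ × Open h i l × Edge l k × r l k ≡ just ⋗
  yieldStep⇒pop (h , y@(e , _ , q) , (e′ , _ , q′) , i<k , none)
    with popped e (s≤s⁻¹ (<-≤-trans i<k (edge-≤ e′))) q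
  ... | l , k′ , o , e₁ , q₁ with m≤n⇒m<n∨m≡n (gapR o e₁ e′ i<k)
  ...   | inj₁ k′<k = ⊥-elim (none k′ (open-edge-< o e₁) k′<k (pop o e₁ q₁))
  ...   | inj₂ refl = h , l , y , q′ , o , e₁ , q₁

  pop⇒yieldStep : ∀ {h i l k} → Yields h i → Open h i l → Edge l k → r l k ≡ just ⋗ →
                  r h k ≡ just ⋖ → YieldStep i k
  pop⇒yieldStep y o e q q′ = _ , y ,
    (pop o e q , ≤-trans (s≤s (open-< o)) (edge-< e) , q′) , open-edge-< o e ,
    λ m i<m m<k e′ → <⇒≱ m<k (gapR o e e′ i<m)

  -- Mirror image: popping the handle that ends at `k` and rests on `i` moves the left end of the
  -- edge into `h` from `k` to `i`.
  takeStep⇒pop : ∀ {i k} → TakeStep i k → ∃₂ λ m h →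
    Takes k h × r i h ≡ just ⋗ × Open i m k
  takeStep⇒pop (h , (e , _ , q) , t@(e′ , _ , q′) , i<k , none)
    with opened (≤-<-trans z≤n i<k) (s≤s⁻¹ (<-≤-trans (edge-< e′) (edge-≤ e′)))
  ... | g , m , o with m≤n⇒m<n∨m≡n (gapL o e′ e i<k)
  ...   | inj₁ i<g  = ⊥-elim (none g i<g (open-< o) (pop o e′ q′))
  ...   | inj₂ refl = m , h , t , q , o

  pop⇒takeStep : ∀ {i m k h} → Open i m k → Takes k h → r i h ≡ just ⋗ → TakeStep i k
  pop⇒takeStep o t@(e , _ , q) q′ = _ ,
    (pop o e q , ≤-trans (s≤s (open-< o)) (edge-< e) , q′) , t , open-< o ,
    λ m i<m m<k e′ → <⇒≱ i<m (gapL o e e′ m<k)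

  module _ {h k i j : ℕ} (o : Open h k i) (e : Edge i j) (q : r i j ≡ just ⋗) (Γ : ℕ → Set) where

    yieldF-pop : (∃ λ k′ → YieldStep k k′ × Γ k′) iff
                 ((¬ k ≡ suc h) × r h j ≡ just ⋖ × Γ j)
    yieldF-pop = to , from
      where
      to : (∃ λ k′ → YieldStep k k′ × Γ k′) → (¬ k ≡ suc h) × r h j ≡ just ⋖ × Γ j
      to (k′ , st , g) with yieldStep⇒pop st
      ... | h′ , _ , (e₁ , p₁ , q₁) , q₂ , o₂ , e₂ , q₃
        with e₀ , _ , q₀ ← open-first o
        with refl ← unique-parent e₁ (clash (λ ()) q₁) e₀ (clash (λ ()) q₀)
        with refl ← ≤-antisym (gapR o₂ e₂ (pop o e q) (open-edge-< o e))
                              (gapR o e (pop o₂ e₂ q₃) (open-edge-< o₂ e₂))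
        = near p₁ , q₂ , g
      from : (¬ k ≡ suc h) × r h j ≡ just ⋖ × Γ j → ∃ λ k′ → YieldStep k k′ × Γ k′
      from (n , q′ , g) with open-first o
      ... | e₀ , _ , q₀ = j , pop⇒yieldStep (e₀ , far e₀ n , q₀) o e q q′ , g

    yieldP-pop : r h j ≡ just ⋖ →
                 (∃ λ k′ → YieldStep k′ j × Γ k′) iff ((¬ k ≡ suc h) × Γ k)
    yieldP-pop q′ = to , from
      where
      to : (∃ λ k′ → YieldStep k′ j × Γ k′) → (¬ k ≡ suc h) × Γ k
      to (k′ , st , g) with yieldStep⇒pop st
      ... | h′ , _ , (e₁ , p₁ , q₁) , q₂ , o₂ , e₂ , q₃
        with refl ← unique-parent (pop o₂ e₂ q₃) (clash (λ ()) q₂)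
                                  (pop o e q) (clash (λ ()) q′)
        with _ , refl ← unique-popped o₂ e₂ o e = near p₁ , g
      from : (¬ k ≡ suc h) × Γ k → ∃ λ k′ → YieldStep k′ j × Γ k′
      from (n , g) with open-first o
      ... | e₀ , _ , q₀ = k , pop⇒yieldStep (e₀ , far e₀ n , q₀) o e q q′ , g

    takeF-pop : r h j ≡ just ⋗ →
                (∃ λ k′ → TakeStep h k′ × Γ k′) iff ((¬ j ≡ suc i) × Γ i)
    takeF-pop q′ = to , from
      where
      to : (∃ λ k′ → TakeStep h k′ × Γ k′) → (¬ j ≡ suc i) × Γ i
      to (k′ , st , g) with takeStep⇒pop st
      ... | _ , _ , (e₁ , p₁ , q₁) , q₂ , o₂
        with refl ← unique-child (pop o₂ e₁ q₁) (clash (λ ()) q₂)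
                                 (pop o e q) (clash (λ ()) q′)
        with refl , _ ← unique-popped o₂ e₁ o e = near p₁ , g
      from : (¬ j ≡ suc i) × Γ i → ∃ λ k′ → TakeStep h k′ × Γ k′
      from (n , g) = i , pop⇒takeStep o (e , far e n , q) q′ , g

    takeP-pop : (∃ λ k′ → TakeStep k′ i × Γ k′) iff
                ((¬ j ≡ suc i) × r h j ≡ just ⋗ × Γ h)
    takeP-pop = to , from
      where
      to : (∃ λ k′ → TakeStep k′ i × Γ k′) → (¬ j ≡ suc i) × r h j ≡ just ⋗ × Γ h
      to (k′ , st , g) with takeStep⇒pop st
      ... | _ , _ , (e₁ , p₁ , q₁) , q₂ , o₂
        with refl , _ ← detO o₂ o
        with refl ← unique-child e₁ (clash (λ ()) q₁) e (clash (λ ()) q)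
        = near p₁ , q₂ , g
      from : (¬ j ≡ suc i) × r h j ≡ just ⋗ × Γ h → ∃ λ k′ → TakeStep k′ i × Γ k′
      from (n , q′ , g) = h , pop⇒takeStep o (e , far e n , q) q′ , g

  -- A yielding parent of `j` can only be the left end of the unique edge into `j` without ⋗, so an
  -- existential question becomes a test on a single edge.
  yields-at : ∀ {h j} → Edge h j → r h j ≢ just ⋗ →
              (∃ λ h′ → Yields h′ j) iff (r h j ≡ just ⋖ × (¬ j ≡ suc h))
  yields-at e n =
    (λ (h′ , e′ , p , q) → case e′ p q (unique-parent e′ (clash (λ ()) q) e n)) ,
    (λ (q , f) → _ , e , far e f , q)
    where
    case : ∀ {h h′ j} → Edge h′ j → suc h′ < j → r h′ j ≡ just ⋖ → h′ ≡ h →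
           r h j ≡ just ⋖ × (¬ j ≡ suc h)
    case e′ p q refl = q , near p

  takes-at : ∀ {i j} → Edge i j → r i j ≢ just ⋖ →
             (∃ λ h → Takes i h) iff (r i j ≡ just ⋗ × (¬ j ≡ suc i))
  takes-at e n =
    (λ (h′ , e′ , p , q) → case e′ p q (unique-child e′ (clash (λ ()) q) e n)) ,
    (λ (q , f) → _ , e , far e f , q)
    where
    case : ∀ {i h h′} → Edge i h′ → suc i < h′ → r i h′ ≡ just ⋗ → h′ ≡ h →
           r i h ≡ just ⋗ × (¬ h ≡ suc i)
    case e′ p q refl = q , near p

  no-yields-0 : ¬ (∃ λ h → Yields h 0)
  no-yields-0 (_ , e , _) = n≮0 (edge-< e)

  no-takes-0 : ¬ (∃ λ h → Takes 0 h)
  no-takes-0 (h , _ , _ , q) = clash (λ ()) (r-source h) q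

  no-takes-end : ¬ (∃ λ h → Takes (suc N) h)
  no-takes-end (_ , e , _) = <⇒≱ (edge-< e) (edge-≤ e)

  bounded-search : ∀ {Q : ℕ → Set} v → (∀ j → Dec (Q j)) → (∀ {j} → Q j → j < v) →
                   Dec (∃ Q)
  bounded-search v Q? b =
    map′ (λ (j , _ , p) → j , p) (λ (j , p) → j , b p , p) (anyUpTo? Q? v)

  yields? : ∀ h i → Dec (Yields h i)
  yields? h i = edge? h i ×-dec suc h <? i ×-dec r h i ≟ρ just ⋖

  takes? : ∀ i h → Dec (Takes i h)
  takes? i h = edge? i h ×-dec suc i <? h ×-dec r i h ≟ρ just ⋗

  noBetween? : ∀ {C : ℕ → Set} → (∀ m → Dec (C m)) → ∀ a b → Dec (NoBetween C a b)
  noBetween? C? a b = map′ (λ f m p q c → f (m , q , p , c)) (λ f (m , q , p , c) → f m p q c)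
    (¬? (anyUpTo? (λ m → a <? m ×-dec C? m) b))

  yieldStep? : ∀ i k → Dec (YieldStep i k)
  yieldStep? i k = bounded-search i
    (λ h → yields? h i ×-dec yields? h k ×-dec i <? k ×-dec noBetween? (edge? h) i k)
    (λ ((e , _) , _) → edge-< e)

  takeStep? : ∀ i k → Dec (TakeStep i k)
  takeStep? i k = bounded-search (suc (suc N))
    (λ h → takes? i h ×-dec takes? k h ×-dec i <? k ×-dec noBetween? (λ m → edge? m h) i k)
    (λ ((e , _) , _) → s≤s (edge-≤ e))

  edgeStep? : ∀ K i j → Dec (EdgeStep K i j)
  edgeStep? K i j = edge? i j ×-dec T? _

  step? : ∀ m i j → Dec (Step m i j)
  step? (edgeF K) i j = edgeStep? K i j
  step? (edgeP K) i j = edgeStep? K j i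
  step? yieldF    i j = yieldStep? i j
  step? yieldP    i j = yieldStep? j i
  step? takeF     i j = takeStep? i j
  step? takeP     i j = takeStep? j i

  guard? : ∀ m i → Dec (Guard m i)
  guard? (edgeF _) i = yes tt
  guard? (edgeP _) i = yes tt
  guard? yieldF    i = bounded-search i (λ h → yields? h i) (edge-< ∘ proj₁)
  guard? yieldP    i = bounded-search i (λ h → yields? h i) (edge-< ∘ proj₁)
  guard? takeF     i = bounded-search _ (takes? i) (s≤s ∘ edge-≤ ∘ proj₁)
  guard? takeP     i = bounded-search _ (takes? i) (s≤s ∘ edge-≤ ∘ proj₁)

  measure : Mode → ℕ → ℕ
  measure (edgeF _) i = suc N ∸ i
  measure (edgeP _) i = i
  measure yieldF    i = suc N ∸ i
  measure yieldP    i = i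
  measure takeF     i = suc N ∸ i
  measure takeP     i = i

  step-measure : ∀ m {i j} → Step m i j → measure m j < measure m i
  step-measure (edgeF K) (e , _) = ∸-monoʳ-< (edge-< e) (edge-≤ e)
  step-measure (edgeP K) (e , _) = edge-< e
  step-measure yieldF (_ , _ , y , p , _) = ∸-monoʳ-< p (yields-≤ y)
  step-measure yieldP (_ , _ , _ , p , _) = p
  step-measure takeF  (_ , _ , t , p , _) = ∸-monoʳ-< p (takes-≤ t)
  step-measure takeP  (_ , _ , _ , p , _) = p

  module _ (m : Mode) (val guard goal : ℕ → Bool) where

    see : (ℕ → ℕ → Bool) → ℕ → ℕ → Obs
    see acc h j = obs ⌊ j ≟ suc h ⌋ (r h j)
      (claim (val h) (guard h) (goal h)) (claim (val j) (guard j) (goal j)) (acc h j)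

    record Checks (acc : ℕ → ℕ → Bool) : Set where
      field
        init : InitOk m (see acc 0 1)
        fin  : FinOk m (see acc 0 (suc N))
        edge : ∀ {h j} → Edge h j → EdgeOk m (see acc h j)
        popc : ∀ {h k i j} → Open h k i → Edge i j → r i j ≡ just ⋗ →
               PopOk m (see acc i j) (see acc h k) (see acc h j)

    GuardCorrect : Set
    GuardCorrect = ∀ {i} → i ≤ suc N → T (guard i) iff Guard m i

    Reaches : ℕ → Set
    Reaches i = ∃ λ j → Step m i j × T (goal j)

    -- Outside the hierarchy of a mode the checks may leave `val` free, which is why the output of a
    -- modal operator is conjoined with its guard.
    ValCorrect : Set
    ValCorrect = ∀ {i} → i ≤ suc N → Guard m i → T (val i) iff Reaches i

  open Checks

  edge-yield-end : ∀ {i j} → Edge i j → r i j ≡ just ⋖ → N < j → i ≡ 0 × j ≡ suc N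
  edge-yield-end {zero}  e q N<j = refl , ≤-antisym (edge-≤ e) N<j
  edge-yield-end {suc i} e q N<j =
    ⊥-elim (<⇒≱ N<j (inner-target (s≤s z≤n) e (clash (λ ()) q)))

  module EdgeF (K : Kind) (val guard goal : ℕ → Bool) where

    Later : ℕ → ℕ → Set
    Later i j = ∃ λ j′ → j < j′ × EdgeStep K i j′ × T (goal j′)

    Hit : ℕ → ℕ → Bool
    Hit i j = K ⌊ j ≟ suc i ⌋ (r i j) ∧ goal j

    later-pop : ∀ {i j l m} → Open i j l → Edge l m → r l m ≡ just ⋗ →
                Later i j iff (T (Hit i m) ⊎ Later i m)
    later-pop {i} {j} {l} {m} o e q = to , from
      where
      to : Later i j → T (Hit i m) ⊎ Later i m
      to (j′ , j<j′ , (e′ , t) , g) with m≤n⇒m<n∨m≡n (gapR o e e′ j<j′)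
      ... | inj₁ m<j′ = inj₂ (j′ , m<j′ , (e′ , t) , g)
      ... | inj₂ refl = inj₁ (proj₂ (T-∧ _) (t , g))
      from : T (Hit i m) ⊎ Later i m → Later i j
      from (inj₁ h) with t , g ← proj₁ (T-∧ _) h =
        m , open-edge-< o e , (pop o e q , t) , g
      from (inj₂ (j′ , m<j′ , s)) = j′ , <-trans (open-edge-< o e) m<j′ , s

    later-none : ∀ {i j} → Edge i j → r i j ≢ just ⋖ → ¬ Later i j
    later-none e n (_ , p , (e′ , _) , _) = n (termL e e′ p)

    reaches-iff : ∀ {i} → i ≤ N →
                  Reaches (edgeF K) val guard goal i iff (T (Hit i (suc i)) ⊎ Later i (suc i))
    reaches-iff {i} i≤N = to , from
      where
      to : Reaches (edgeF K) val guard goal i → T (Hit i (suc i)) ⊎ Later i (suc i)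
      to (j , (e , t) , g) with m≤n⇒m<n∨m≡n (edge-< e)
      ... | inj₁ p    = inj₂ (j , p , (e , t) , g)
      ... | inj₂ refl = inj₁ (proj₂ (T-∧ _) (t , g))
      from : T (Hit i (suc i)) ⊎ Later i (suc i) → Reaches (edgeF K) val guard goal i
      from (inj₁ h) with t , g ← proj₁ (T-∧ _) h = suc i , (adj i≤N , t) , g
      from (inj₂ (j , _ , s)) = j , s

    module _ {acc : ℕ → ℕ → Bool} (C : Checks (edgeF K) val guard goal acc) where

      -- The bit of an edge is determined by that of the next edge out of the same position, so the
      -- induction descends from the longest edge; `g` bounds the distance to `N + 1`.
      acc-iff : ∀ g {i j} → suc N ≤ g + j → Edge i j → T (acc i j) iff Later i j
      acc-iff g {i} {j} b e with r i j ≟ρ just ⋖ | j ≤? N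
      ... | no n | _ = (λ t → ⊥-elim (¬T-false (proj₂ (proj₂ (edge C e)) n) t)) ,
                       (λ p → ⊥-elim (later-none e n p))
      acc-iff g b e | yes q | no j≰N with refl , refl ← edge-yield-end e q (≰⇒> j≰N) =
        (λ t → ⊥-elim (¬T-false (proj₁ (fin C)) t)) ,
        (λ (_ , p , (e′ , _) , _) → ⊥-elim (<⇒≱ p (edge-≤ e′)))
      acc-iff zero b e | yes q | yes j≤N = ⊥-elim (<⇒≱ b j≤N)
      acc-iff (suc g) {i} {j} b e | yes q | yes j≤N with popped e j≤N q
      ... | l , m , o , e′ , q′ =
        iff-trans (T-cong (popc C o e′ q′))
          (iff-trans (∨-iff (id , id) (acc-iff g
              (≤-trans b (≤-trans (≤-reflexive (sym (+-suc g j)))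
                                  (+-monoʳ-≤ g (open-edge-< o e′))))
              (pop o e′ q′)))
            (iff-sym (later-pop o e′ q′)))

      val-correct : ValCorrect (edgeF K) val guard goal
      val-correct {i} i≤ _ with m≤n⇒m<n∨m≡n i≤
      ... | inj₂ refl =
        (λ t → ⊥-elim (¬T-false (proj₂ (fin C)) t)) ,
        (λ (_ , (e , _) , _) → ⊥-elim (<⇒≱ (edge-< e) (edge-≤ e)))
      ... | inj₁ (s≤s i≤N) =
        iff-trans (T-cong (proj₁ (proj₂ (edge C (adj i≤N))) (proj₂ (adjacent-iff i _) refl)))
          (iff-trans (∨-iff (id , id) (acc-iff (suc N) (m≤m+n (suc N) _) (adj i≤N)))
            (iff-sym (reaches-iff i≤N)))

      guard-correct : GuardCorrect (edgeF K) val guard goal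
      guard-correct {zero} i≤ = (λ _ → tt) , λ _ → proj₁ (proj₁ (edge C (adj z≤n)))
      guard-correct {suc i} i≤ = (λ _ → tt) , λ _ → proj₂ (proj₁ (edge C (adj (s≤s⁻¹ i≤))))

    later? : ∀ i j → Dec (Later i j)
    later? i j = bounded-search (suc (suc N))
      (λ j′ → j <? j′ ×-dec edgeStep? K i j′ ×-dec T? _)
      (λ (_ , (e , _) , _) → s≤s (edge-≤ e))

    checkable : GuardCorrect (edgeF K) val guard goal →
                (∀ {i} → i ≤ suc N → T (val i) iff Reaches (edgeF K) val guard goal i) →
                ∃ (Checks (edgeF K) val guard goal)
    checkable gc vc = (λ i j → ⌊ later? i j ⌋) , record
      { init = tt
      ; fin  = false-by (⌊⌋-iff (later? 0 (suc N)))
                 (λ (_ , p , (e , _) , _) → <⇒≱ p (edge-≤ e)) ,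
               false-by (vc ≤-refl) (λ (_ , (e , _) , _) → <⇒≱ (edge-< e) (edge-≤ e))
      ; edge = λ e → (proj₂ (gc (<⇒≤ (<-≤-trans (edge-< e) (edge-≤ e)))) tt ,
                      proj₂ (gc (edge-≤ e)) tt) ,
                     near-case e ,
                     (λ n → false-by (⌊⌋-iff (later? _ _)) (later-none e n))
      ; popc = λ o e q → equal-by (⌊⌋-iff (later? _ _))
                 (∨-iff (id , id) (⌊⌋-iff (later? _ _))) (later-pop o e q)
      }
      where
      near-case : ∀ {h j} → Edge h j → T ⌊ j ≟ suc h ⌋ → val h ≡ Hit h j ∨ ⌊ later? h j ⌋
      near-case {h} {j} e t with refl ← proj₁ (adjacent-iff h j) t =
        equal-by (vc (<⇒≤ (edge-≤ e))) (∨-iff (id , id) (⌊⌋-iff (later? _ _)))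
          (reaches-iff (s≤s⁻¹ (edge-≤ e)))

  module EdgeP (K : Kind) (val guard goal : ℕ → Bool) where

    Earlier : ℕ → ℕ → Set
    Earlier h j = ∃ λ h′ → h ≤ h′ × EdgeStep K h′ j × T (goal h′)

    Hit : ℕ → ℕ → Bool
    Hit h j = K ⌊ j ≟ suc h ⌋ (r h j) ∧ goal h

    earlier-adj : ∀ {h} → h ≤ N → Earlier h (suc h) iff T (Hit h (suc h))
    earlier-adj {h} h≤N = to , from
      where
      to : Earlier h (suc h) → T (Hit h (suc h))
      to (h′ , p , (e , t) , g) with refl ← ≤-antisym p (s≤s⁻¹ (edge-< e)) =
        proj₂ (T-∧ _) (t , g)
      from : T (Hit h (suc h)) → Earlier h (suc h)
      from x with t , g ← proj₁ (T-∧ _) x = h , ≤-refl , (adj h≤N , t) , g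

    earlier-pop : ∀ {h k i j} → Open h k i → Edge i j → r i j ≡ just ⋗ →
                  Earlier h j iff (Earlier i j ⊎ T (Hit h j))
    earlier-pop {h} {k} {i} {j} o e q = to , from
      where
      to : Earlier h j → Earlier i j ⊎ T (Hit h j)
      to (h′ , p , (e′ , t) , g) with m≤n⇒m<n∨m≡n p
      ... | inj₂ refl = inj₂ (proj₂ (T-∧ _) (t , g))
      ... | inj₁ h<h′ =
        inj₁ (h′ , ≮⇒≥ (λ h′<i → <⇒≱ h<h′ (gapL o e e′ h′<i)) , (e′ , t) , g)
      from : Earlier i j ⊎ T (Hit h j) → Earlier h j
      from (inj₁ (h′ , p , s)) = h′ , ≤-trans (<⇒≤ (open-< o)) p , s
      from (inj₂ x) with t , g ← proj₁ (T-∧ _) x = h , ≤-refl , (pop o e q , t) , g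

    reaches-iff : ∀ {h j} → Edge h j → r h j ≢ just ⋗ →
                  Reaches (edgeP K) val guard goal j iff Earlier h j
    reaches-iff e n = (λ (h′ , (e′ , t) , g) → h′ , termR e n e′ , (e′ , t) , g) ,
                      (λ (h′ , _ , s) → h′ , s)

    module _ {acc : ℕ → ℕ → Bool} (C : Checks (edgeP K) val guard goal acc) where

      acc-iff : ∀ {h j} → Edge h j → T (acc h j) iff Earlier h j
      acc-iff (adj p) =
        iff-trans (T-cong (proj₁ (proj₂ (edge C (adj p))) (proj₂ (adjacent-iff _ _) refl)))
          (iff-sym (earlier-adj p))
      acc-iff (pop o e q) =
        iff-trans (T-cong (popc C o e q))
          (iff-trans (∨-iff (acc-iff e) (id , id)) (iff-sym (earlier-pop o e q)))

      val-correct : ValCorrect (edgeP K) val guard goal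
      val-correct {zero} i≤ _ =
        (λ t → ⊥-elim (¬T-false (init C) t)) ,
        (λ (_ , (e , _) , _) → ⊥-elim (n≮0 (edge-< e)))
      val-correct {suc i} i≤ _ with entrance (s≤s z≤n) i≤
      ... | h , e , n = iff-trans (T-cong (proj₂ (proj₂ (edge C e)) n))
                          (iff-trans (acc-iff e) (iff-sym (reaches-iff e n)))

      guard-correct : GuardCorrect (edgeP K) val guard goal
      guard-correct {zero} i≤ = (λ _ → tt) , λ _ → proj₁ (proj₁ (edge C (adj z≤n)))
      guard-correct {suc i} i≤ = (λ _ → tt) , λ _ → proj₂ (proj₁ (edge C (adj (s≤s⁻¹ i≤))))

    earlier? : ∀ h j → Dec (Earlier h j)
    earlier? h j = bounded-search j
      (λ h′ → h ≤? h′ ×-dec edgeStep? K h′ j ×-dec T? _)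
      (λ (_ , (e , _) , _) → edge-< e)

    checkable : GuardCorrect (edgeP K) val guard goal →
                (∀ {i} → i ≤ suc N → T (val i) iff Reaches (edgeP K) val guard goal i) →
                ∃ (Checks (edgeP K) val guard goal)
    checkable gc vc = (λ h j → ⌊ earlier? h j ⌋) , record
      { init = false-by (vc z≤n) (λ (_ , (e , _) , _) → n≮0 (edge-< e))
      ; fin  = tt
      ; edge = λ e → (proj₂ (gc (<⇒≤ (<-≤-trans (edge-< e) (edge-≤ e)))) tt ,
                      proj₂ (gc (edge-≤ e)) tt) ,
                     near-case e ,
                     (λ n → equal-by (vc (edge-≤ e)) (⌊⌋-iff (earlier? _ _))
                              (reaches-iff e n))
      ; popc = λ o e q → equal-by (⌊⌋-iff (earlier? _ _))
                 (∨-iff (⌊⌋-iff (earlier? _ _)) (id , id)) (earlier-pop o e q)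
      }
      where
      near-case : ∀ {h j} → Edge h j → T ⌊ j ≟ suc h ⌋ → ⌊ earlier? h j ⌋ ≡ Hit h j
      near-case {h} {j} e t with refl ← proj₁ (adjacent-iff h j) t =
        equal-by (⌊⌋-iff (earlier? _ _)) (id , id) (earlier-adj (s≤s⁻¹ (edge-≤ e)))

  isYield-iff : ∀ ρ → T (isYield ρ) iff ρ ≡ just ⋖
  isYield-iff ρ = ⌊⌋-iff (ρ ≟ρ just ⋖)

  isTake-iff : ∀ ρ → T (isTake ρ) iff ρ ≡ just ⋗
  isTake-iff ρ = ⌊⌋-iff (ρ ≟ρ just ⋗)

  yield-test : ∀ h j → T (isYield (r h j) ∧ not ⌊ j ≟ suc h ⌋) iff
               (r h j ≡ just ⋖ × (¬ j ≡ suc h))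
  yield-test h j = ∧-iff (isYield-iff _) (not-iff (adjacent-iff h j))

  take-test : ∀ h j → T (isTake (r h j) ∧ not ⌊ j ≟ suc h ⌋) iff
              (r h j ≡ just ⋗ × (¬ j ≡ suc h))
  take-test h j = ∧-iff (isTake-iff _) (not-iff (adjacent-iff h j))

  module _ {guard : ℕ → Bool} where

    yield-guard-correct :
      guard 0 ≡ false →
      (∀ {h j} → Edge h j → r h j ≢ just ⋗ → guard j ≡ isYield (r h j) ∧ not ⌊ j ≟ suc h ⌋) →
      ∀ {i} → i ≤ suc N → T (guard i) iff (∃ λ h → Yields h i)
    yield-guard-correct g0 ge {zero} i≤ =
      (λ t → ⊥-elim (¬T-false g0 t)) , (λ y → ⊥-elim (no-yields-0 y))
    yield-guard-correct g0 ge {suc i} i≤ with entrance (s≤s z≤n) i≤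
    ... | h , e , n = iff-trans (T-cong (ge e n))
                        (iff-trans (yield-test h _) (iff-sym (yields-at e n)))

    take-guard-correct :
      guard 0 ≡ false → guard (suc N) ≡ false →
      (∀ {h j} → Edge h j → r h j ≢ just ⋖ → guard h ≡ isTake (r h j) ∧ not ⌊ j ≟ suc h ⌋) →
      ∀ {i} → i ≤ suc N → T (guard i) iff (∃ λ h → Takes i h)
    take-guard-correct g0 g1 ge {zero} i≤ =
      (λ t → ⊥-elim (¬T-false g0 t)) , (λ y → ⊥-elim (no-takes-0 y))
    take-guard-correct g0 g1 ge {suc i} i≤ with m≤n⇒m<n∨m≡n i≤
    ... | inj₂ refl = (λ t → ⊥-elim (¬T-false g1 t)) , (λ y → ⊥-elim (no-takes-end y))
    ... | inj₁ (s≤s i≤N) with exit (s≤s z≤n) i≤N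
    ...   | j , e , n = iff-trans (T-cong (ge e n))
                          (iff-trans (take-test _ j) (iff-sym (takes-at e n)))

    yield-guard-edge : (∀ {i} → i ≤ suc N → T (guard i) iff (∃ λ h → Yields h i)) →
      ∀ {h j} → Edge h j → r h j ≢ just ⋗ → guard j ≡ isYield (r h j) ∧ not ⌊ j ≟ suc h ⌋
    yield-guard-edge gc {h} {j} e n =
      equal-by (gc (edge-≤ e)) (yield-test h j) (yields-at e n)

    take-guard-edge : (∀ {i} → i ≤ suc N → T (guard i) iff (∃ λ h → Takes i h)) →
      ∀ {h j} → Edge h j → r h j ≢ just ⋖ → guard h ≡ isTake (r h j) ∧ not ⌊ j ≟ suc h ⌋
    take-guard-edge gc {h} {j} e n =
      equal-by (gc (<⇒≤ (<-≤-trans (edge-< e) (edge-≤ e)))) (take-test h j) (takes-at e n)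

  module _ {val guard goal : ℕ → Bool} where

    guards-correct : ∀ m {acc} → Checks m val guard goal acc → GuardCorrect m val guard goal
    guards-correct (edgeF K) C = EdgeF.guard-correct K val guard goal C
    guards-correct (edgeP K) C = EdgeP.guard-correct K val guard goal C
    guards-correct yieldF C = yield-guard-correct (init C) (edge C)
    guards-correct yieldP C = yield-guard-correct (init C) (edge C)
    guards-correct takeF  C = take-guard-correct (init C) (fin C) (edge C)
    guards-correct takeP  C = take-guard-correct (init C) (fin C) (edge C)

    private
      yieldF-test : ∀ h k j →
        T (not ⌊ k ≟ suc h ⌋ ∧ (isYield (r h j) ∧ goal j)) iff
        ((¬ k ≡ suc h) × r h j ≡ just ⋖ × T (goal j))
      yieldF-test h k j =
        ∧-iff (not-iff (adjacent-iff h k)) (∧-iff (isYield-iff _) (id , id))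

      takeP-test : ∀ h i j →
        T (not ⌊ j ≟ suc i ⌋ ∧ (isTake (r h j) ∧ goal h)) iff
        ((¬ j ≡ suc i) × r h j ≡ just ⋗ × T (goal h))
      takeP-test h i j =
        ∧-iff (not-iff (adjacent-iff i j)) (∧-iff (isTake-iff _) (id , id))

      far-test : ∀ h k i → T (not ⌊ k ≟ suc h ⌋ ∧ goal i) iff ((¬ k ≡ suc h) × T (goal i))
      far-test h k i = ∧-iff (not-iff (adjacent-iff h k)) (id , id)

      Γ : ℕ → Set
      Γ = T ∘ goal

    -- In the sibling modes one pop fixes the value of a guarded position: that of the handle begun
    -- there (`yieldF`), the one creating the edge from its parent (`yieldP`) or to its parent
    -- (`takeF`), or that of the handle ending there (`takeP`).
    vals-correct : ∀ m {acc} → Checks m val guard goal acc → ValCorrect m val guard goal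
    vals-correct (edgeF K) C = EdgeF.val-correct K val guard goal C
    vals-correct (edgeP K) C = EdgeP.val-correct K val guard goal C
    vals-correct yieldF C {i} i≤ (h , e , _ , q) with m≤n⇒m<n∨m≡n i≤
    ... | inj₂ refl = (λ t → ⊥-elim (¬T-false (fin C) t)) ,
                      (λ (_ , (_ , _ , y , p , _) , _) → ⊥-elim (<⇒≱ p (yields-≤ y)))
    ... | inj₁ (s≤s i≤N) with popped e i≤N q
    ...   | _ , j , o , e′ , q′ = iff-trans (T-cong (popc C o e′ q′))
              (iff-trans (yieldF-test h i j) (iff-sym (yieldF-pop o e′ q′ Γ)))
    vals-correct yieldP C {i} i≤ (h , adj _ , p , q) = ⊥-elim (<-irrefl refl p)
    vals-correct yieldP C {i} i≤ (h , pop {k = k} o e q′ , p , q) =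
      iff-trans (T-cong (popc C o e q′ q))
        (iff-trans (far-test h k k) (iff-sym (yieldP-pop o e q′ Γ q)))
    vals-correct takeF C {i} i≤ (h , adj _ , p , q) = ⊥-elim (<-irrefl refl p)
    vals-correct takeF C {i} i≤ (h , pop {i = l} o e q′ , p , q) =
      iff-trans (T-cong (popc C o e q′ q))
        (iff-trans (far-test l h l) (iff-sym (takeF-pop o e q′ Γ q)))
    vals-correct takeP C {i} i≤ (h , e , p , q)
      with opened (inner-source (clash (λ ()) q)) (s≤s⁻¹ (<-≤-trans (edge-< e) (edge-≤ e)))
    ... | g , _ , o = iff-trans (T-cong (popc C o e q))
                        (iff-trans (takeP-test g i h) (iff-sym (takeP-pop o e q Γ)))

    -- The assumption on `val` is not restricted to guarded positions, because a pop also constrains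
    -- positions outside the hierarchy, such as a handle start adjacent to `h`.
    checkable : ∀ m → GuardCorrect m val guard goal →
                (∀ {i} → i ≤ suc N → T (val i) iff Reaches m val guard goal i) →
                ∃ (Checks m val guard goal)
    checkable (edgeF K) gc vc = EdgeF.checkable K val guard goal gc vc
    checkable (edgeP K) gc vc = EdgeP.checkable K val guard goal gc vc
    checkable yieldF gc vc = (λ _ _ → false) , record
      { init = false-by (gc z≤n) no-yields-0
      ; fin  = false-by (vc ≤-refl) λ (_ , (_ , _ , y , p , _) , _) → <⇒≱ p (yields-≤ y)
      ; edge = yield-guard-edge gc
      ; popc = λ {h} {k} {i} {j} o e q →
          equal-by (vc (≤-trans (<⇒≤ (open-edge-< o e)) (edge-≤ e)))
            (yieldF-test h k j) (yieldF-pop o e q Γ)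
      }
    checkable yieldP gc vc = (λ _ _ → false) , record
      { init = false-by (gc z≤n) no-yields-0
      ; fin  = tt
      ; edge = yield-guard-edge gc
      ; popc = λ {h} {k} o e q q′ →
          equal-by (vc (edge-≤ e)) (far-test h k k) (yieldP-pop o e q Γ q′)
      }
    checkable takeF gc vc = (λ _ _ → false) , record
      { init = false-by (gc z≤n) no-takes-0
      ; fin  = false-by (gc ≤-refl) no-takes-end
      ; edge = take-guard-edge gc
      ; popc = λ {i = i} {j} o e q q′ →
          equal-by (vc (<⇒≤ (<-trans (open-< o) (s≤s (open-≤ o)))))
            (far-test i j i) (takeF-pop o e q Γ q′)
      }
    checkable takeP gc vc = (λ _ _ → false) , record
      { init = false-by (gc z≤n) no-takes-0
      ; fin  = false-by (gc ≤-refl) no-takes-end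
      ; edge = take-guard-edge gc
      ; popc = λ {h} {_} {i} {j} o e q →
          equal-by (vc (<⇒≤ (s≤s (open-≤ o)))) (takeP-test h i j) (takeP-pop o e q Γ)
      }

-- Normal forms of the operators

-- `G` is demanded at the last position too: even a hierarchical path of a single position needs its
-- parent `h`.
data Until (G : ℕ → Set) (R : ℕ → ℕ → Set) (A B : ℕ → Set) (i : ℕ) : Set where
  here  : G i → B i → Until G R A B i
  there : ∀ {j} → G i → A i → R i j → Until G R A B j → Until G R A B i

until-map : ∀ {G G′ A A′ B B′ : ℕ → Set} {R R′ : ℕ → ℕ → Set} →
            (∀ {i} → G i → G′ i) → (∀ {i} → G i → A i → A′ i) → (∀ {i} → G i → B i → B′ i) →
            (∀ {i j} → R i j → R′ i j) → ∀ {i} → Until G R A B i → Until G′ R′ A′ B′ i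
until-map g a b r (here p q)      = here (g p) (b p q)
until-map g a b r (there p q s u) = there (g p) (a p q) (r s) (until-map g a b r u)

module _ {St : ℕ → ℕ → Set} {A B : ℕ → Set} where

  star⇒upath : ∀ {i j} → Star (λ a b → a < b × A a × St a b) i j → B j → UPath St A B i j
  star⇒upath ε                 b = lastU b
  star⇒upath ((p , a , s) ◅ u) b = consU p a s (star⇒upath u b)

  star⇒spath : ∀ {j k i} → SPath St A B j k →
               Star (λ a b → a < b × B b × St a b) k i → SPath St A B j i
  star⇒spath p ε = p
  star⇒spath p ((q , b , s) ◅ u) = star⇒spath (snocS p q s b) u

  upath-≤ : ∀ {i j} → UPath St A B i j → i ≤ j
  upath-≤ (lastU _)       = ≤-refl
  upath-≤ (consU p _ _ u) = ≤-trans (<⇒≤ p) (upath-≤ u)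

  spath-≤ : ∀ {j i} → SPath St A B j i → j ≤ i
  spath-≤ (firstS _)      = ≤-refl
  spath-≤ (snocS u p _ _) = ≤-trans (spath-≤ u) (<⇒≤ p)

-- Hierarchical paths: Par h p says that p is a child of h, so a child
-- determines the common parent of the whole path.
module Hierarchy (Par : ℕ → ℕ → Set) (C : ℕ → ℕ → Set)
                 (unique : ∀ {h h′ p} → Par h p → Par h′ p → h ≡ h′) where

  Sibling : ℕ → ℕ → Set
  Sibling i k = ∃ λ h → Par h i × Par h k × i < k × NoBetween (C h) i k

  module _ {A B : ℕ → Set} where

    HU HS : ℕ → ℕ → ℕ → Set
    HU h = UPath (NoBetween (C h)) (λ p → Par h p × A p) (λ p → Par h p × B p)
    HS h = SPath (NoBetween (C h)) (λ p → Par h p × B p) (λ p → Par h p × A p)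

    HU-start : ∀ {h i j} → HU h i j → Par h i
    HU-start (lastU (p , _))       = p
    HU-start (consU _ (p , _) _ _) = p

    HU-end : ∀ {h i j} → HU h i j → Par h j
    HU-end (lastU (p , _))   = p
    HU-end (consU _ _ _ u) = HU-end u

    HS-end : ∀ {h j i} → HS h j i → Par h i
    HS-end (firstS (p , _))      = p
    HS-end (snocS _ _ _ (p , _)) = p

    HS-start : ∀ {h j i} → HS h j i → Par h j
    HS-start (firstS (p , _)) = p
    HS-start (snocS u _ _ _)  = HS-start u

    HU⇒until : ∀ {h i j} → HU h i j → Until (λ i → ∃ λ h → Par h i) Sibling A B i
    HU⇒until (lastU (p , b)) = here (_ , p) b
    HU⇒until (consU q (p , a) s u) =
      there (_ , p) a (_ , p , HU-start u , q , s) (HU⇒until u)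

    until⇒HU : ∀ {i} → Until (λ i → ∃ λ h → Par h i) Sibling A B i → ∃₂ λ h j → HU h i j
    until⇒HU (here (h , p) b) = h , _ , lastU (p , b)
    until⇒HU (there _ a (h , p , p′ , q , s) u) with until⇒HU u
    ... | h′ , j , v with refl ← unique p′ (HU-start v) = h , j , consU q (p , a) s v

    HS⇒until : ∀ {h j i} → HS h j i → Until (λ i → ∃ λ h → Par h i) (flip Sibling) A B i
    HS⇒until (firstS (p , b)) = here (_ , p) b
    HS⇒until (snocS u q s (p , a)) =
      there (_ , p) a (_ , HS-end u , p , q , s) (HS⇒until u)

    until⇒HS : ∀ {i} → Until (λ i → ∃ λ h → Par h i) (flip Sibling) A B i →
               ∃₂ λ h j → HS h j i
    until⇒HS (here (h , p) b) = h , _ , firstS (p , b)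
    until⇒HS (there _ a (h , p , p′ , q , s) u) with until⇒HS u
    ... | h′ , j , v with refl ← unique p (HS-end v) = h , j , snocS v q s (p′ , a)

maximum : ∀ {Q : ℕ → Set} → (∀ h → Dec (Q h)) → ∀ e →
          (∃ λ h → (h ≤ e × Q h) × (∀ h′ → h′ ≤ e × Q h′ → h′ ≤ h)) ⊎
          (∀ h → ¬ (h ≤ e × Q h))
maximum Q? e with Q? e
... | yes q = inj₁ (e , (≤-refl , q) , λ _ → proj₁)
maximum Q? zero    | no n = inj₂ λ { _ (z≤n , q) → n q }
maximum {Q} Q? (suc e) | no n with maximum Q? e
... | inj₁ (h , (p , q) , f) = inj₁ (h , (m≤n⇒m≤1+n p , q) , λ h′ (p′ , q′) → f h′ (drop-top p′ q′ , q′))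
  where
  drop-top : ∀ {h′} → h′ ≤ suc e → Q h′ → h′ ≤ e
  drop-top p′ q′ with m≤n⇒m<n∨m≡n p′
  ... | inj₁ p<   = s≤s⁻¹ p<
  ... | inj₂ refl = ⊥-elim (n q′)
... | inj₂ f = inj₂ none
  where
  none : ∀ h → ¬ (h ≤ suc e × Q h)
  none h (p , q) with m≤n⇒m<n∨m≡n p
  ... | inj₁ p<   = f h (s≤s⁻¹ p< , q)
  ... | inj₂ refl = n q

_∋ᵇ_ : PrecSet → Maybe Prec → Bool
Π ∋ᵇ nothing = false
Π ∋ᵇ just ⋖  = PrecSet.hasYield Π
Π ∋ᵇ just ≐  = PrecSet.hasEqual Π
Π ∋ᵇ just ⋗  = PrecSet.hasTake Π

adjacentIn chainIn edgeIn : PrecSet → Kind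
adjacentIn Π a ρ = a ∧ Π ∋ᵇ ρ
chainIn    Π a ρ = not a ∧ Π ∋ᵇ ρ
edgeIn     Π a ρ = Π ∋ᵇ ρ

module Semantics {n : ℕ} {S : Subset n} (M : OPM S) (x : List (Letter n))
                 (allDefined : Word.AllDefined M x) where
  open Word M x
  open Modes N r r-source r-target allDefined

  ∋ᵇ-iff : ∀ Π ρ → T (Π ∋ᵇ ρ) iff (∃ λ π → InΠ Π π × ρ ≡ just π)
  ∋ᵇ-iff Π ρ = to ρ , from
    where
    to : ∀ ρ → T (Π ∋ᵇ ρ) → ∃ λ π → InΠ Π π × ρ ≡ just π
    to (just ⋖) t = ⋖ , t , refl
    to (just ≐) t = ≐ , t , refl
    to (just ⋗) t = ⋗ , t , refl
    from : ∀ {ρ} → (∃ λ π → InΠ Π π × ρ ≡ just π) → T (Π ∋ᵇ ρ)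
    from (⋖ , t , refl) = t
    from (≐ , t , refl) = t
    from (⋗ , t , refl) = t

  relΠ⇒ : ∀ {Π i j} → RelΠ M x Π i j → T (Π ∋ᵇ r i j)
  relΠ⇒ {Π} (π , t , _ , _ , q) = proj₂ (∋ᵇ-iff Π _) (π , t , q)

  edge⇒relΠ : ∀ {Π i j} → Edge i j → T (Π ∋ᵇ r i j) → RelΠ M x Π i j
  edge⇒relΠ {Π} e t with proj₁ (∋ᵇ-iff Π _) t
  ... | π , p , q = π , p , ≤-trans (<⇒≤ (edge-< e)) (edge-≤ e) , edge-≤ e , q

  edge⇒rel : ∀ {i j π} → Edge i j → r i j ≡ just π → Rel M x i j π
  edge⇒rel e q = ≤-trans (<⇒≤ (edge-< e)) (edge-≤ e) , edge-≤ e , q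

  adjacentStep : ∀ {Π i j} → EdgeStep (adjacentIn Π) i j iff (j ≡ suc i × RelΠ M x Π i j)
  adjacentStep {Π} {i} {j} = to , from
    where
    to : EdgeStep (adjacentIn Π) i j → j ≡ suc i × RelΠ M x Π i j
    to (e , t) with p , q ← proj₁ (T-∧ _) t = proj₁ (adjacent-iff i j) p , edge⇒relΠ e q
    from : j ≡ suc i × RelΠ M x Π i j → EdgeStep (adjacentIn Π) i j
    from (refl , ρ@(_ , _ , _ , b , _)) =
      adj (s≤s⁻¹ b) , proj₂ (T-∧ _) (proj₂ (adjacent-iff i j) refl , relΠ⇒ ρ)

  chainStep : ∀ {Π i j} → EdgeStep (chainIn Π) i j iff (chi M x i j × RelΠ M x Π i j)
  chainStep {Π} {i} {j} = to , from
    where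
    to : EdgeStep (chainIn Π) i j → chi M x i j × RelΠ M x Π i j
    to (e , t) with p , q ← proj₁ (T-∧ _) t =
      edge⇒chi e (far e (proj₁ (not-iff (adjacent-iff i j)) p)) , edge⇒relΠ e q
    from : chi M x i j × RelΠ M x Π i j → EdgeStep (chainIn Π) i j
    from (c , ρ) = chi⇒edge c ,
      proj₂ (T-∧ _) (proj₂ (not-iff (adjacent-iff i j)) (near (proj₁ c)) , relΠ⇒ ρ)

  yields-iff : ∀ {h k} → HY M x h k iff Yields h k
  yields-iff = (λ (c , _ , _ , q) → chi⇒edge c , proj₁ c , q) ,
               (λ (e , p , q) → edge⇒chi e p , edge⇒rel e q)

  takes-iff : ∀ {k h} → HT M x k h iff Takes k h
  takes-iff = (λ (c , _ , _ , q) → chi⇒edge c , proj₁ c , q) ,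
              (λ (e , p , q) → edge⇒chi e p , edge⇒rel e q)

  -- By `termL` every edge out of `h` that is shorter than the one to `k` carries ⋖, so the minimum
  -- over ⋖-chains and the minimum over all chains agree.
  yield-between : ∀ {h i k} → Yields h i → Yields h k →
                  NoBetween (HY M x h) i k iff NoBetween (Edge h) i k
  yield-between (_ , p , _) (e , _) =
    (λ f m i<m m<k e′ → f m i<m m<k
      (proj₂ yields-iff (e′ , <-trans p i<m , termL e′ e m<k))) ,
    (λ f m i<m m<k y → f m i<m m<k (proj₁ (proj₁ yields-iff y)))

  take-between : ∀ {h i k} → Takes i h → Takes k h →
                 NoBetween (λ m → HT M x m h) i k iff NoBetween (λ m → Edge m h) i k
  take-between {h} {i} (e , _) (e′ , _) =
    (λ f m i<m m<k e″ → f m i<m m<k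
      (proj₂ takes-iff (e″ , <-≤-trans (s≤s m<k) (edge-< e′) , takes e″ i<m))) ,
    (λ f m i<m m<k y → f m i<m m<k (proj₁ (proj₁ takes-iff y)))
    where
    takes : ∀ {m} → Edge m h → i < m → r m h ≡ just ⋗
    takes {m} e″ i<m with r m h ≟ρ just ⋗
    ... | yes q = q
    ... | no q  = ⊥-elim (<⇒≱ i<m (termR e″ q e))

  NextForm : Mode → (ℕ → Set) → ℕ → Set
  NextForm m A i = Guard m i × ∃ λ j → Step m i j × A j

  UntilForm : Mode → (ℕ → Set) → (ℕ → Set) → ℕ → Set
  UntilForm m = Until (Guard m) (Step m)

  module _ {φ : Formula n} where
    private A = sat M x φ

    nextΠ-form : ∀ {Π i} → sat M x (nextΠ Π φ) i iff NextForm (edgeF (adjacentIn Π)) A i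
    nextΠ-form = (λ (ρ , a) → tt , _ , proj₂ adjacentStep (refl , ρ) , a) , from
      where
      from : ∀ {Π i} → NextForm (edgeF (adjacentIn Π)) A i → sat M x (nextΠ Π φ) i
      from (_ , j , s , a) with refl , ρ ← proj₁ adjacentStep s = ρ , a

    backΠ-form : ∀ {Π i} → sat M x (backΠ Π φ) i iff NextForm (edgeP (adjacentIn Π)) A i
    backΠ-form = (λ (k , q , ρ , a) → tt , k , proj₂ adjacentStep (sym q , ρ) , a) ,
                 (λ (_ , k , s , a) → let q , ρ = proj₁ adjacentStep s in k , sym q , ρ , a)

    χF-form : ∀ {Π i} → sat M x (χF Π φ) i iff NextForm (edgeF (chainIn Π)) A i
    χF-form = (λ (j , _ , c , ρ , a) → tt , j , proj₂ chainStep (c , ρ) , a) ,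
              (λ (_ , j , s , a) → let c , ρ = proj₁ chainStep s in
                 j , edge-< (proj₁ s) , c , ρ , a)

    χP-form : ∀ {Π i} → sat M x (χP Π φ) i iff NextForm (edgeP (chainIn Π)) A i
    χP-form = (λ (j , _ , c , ρ , a) → tt , j , proj₂ chainStep (c , ρ) , a) ,
              (λ (_ , j , s , a) → let c , ρ = proj₁ chainStep s in
                 j , edge-< (proj₁ s) , c , ρ , a)

    nextHY-form : ∀ {i} → sat M x (nextH hyield φ) i iff NextForm yieldF A i
    nextHY-form =
      (λ (h , _ , y , k , p , y′ , f , a) →
        let u = proj₁ yields-iff y ; v = proj₁ yields-iff y′ in
        (h , u) , k , (h , u , v , p , proj₁ (yield-between u v) f) , a) ,
      (λ (_ , k , (h , u , v , p , f) , a) →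
        h , edge-< (proj₁ u) , proj₂ yields-iff u , k , p , proj₂ yields-iff v ,
        proj₂ (yield-between u v) f , a)

    backHY-form : ∀ {i} → sat M x (backH hyield φ) i iff NextForm yieldP A i
    backHY-form =
      (λ (h , _ , y , k , p , y′ , f , a) →
        let u = proj₁ yields-iff y ; v = proj₁ yields-iff y′ in
        (h , u) , k , (h , v , u , p , proj₁ (yield-between v u) f) , a) ,
      (λ (_ , k , (h , v , u , p , f) , a) →
        h , edge-< (proj₁ u) , proj₂ yields-iff u , k , p , proj₂ yields-iff v ,
        proj₂ (yield-between v u) f , a)

    nextHT-form : ∀ {i} → sat M x (nextH htake φ) i iff NextForm takeF A i
    nextHT-form =
      (λ (h , _ , y , k , p , y′ , f , a) →
        let u = proj₁ takes-iff y ; v = proj₁ takes-iff y′ in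
        (h , u) , k , (h , u , v , p , proj₁ (take-between u v) f) , a) ,
      (λ (_ , k , (h , u , v , p , f) , a) →
        h , edge-< (proj₁ u) , proj₂ takes-iff u , k , p , proj₂ takes-iff v ,
        proj₂ (take-between u v) f , a)

    backHT-form : ∀ {i} → sat M x (backH htake φ) i iff NextForm takeP A i
    backHT-form =
      (λ (h , _ , y , k , p , y′ , f , a) →
        let u = proj₁ takes-iff y ; v = proj₁ takes-iff y′ in
        (h , u) , k , (h , v , u , p , proj₁ (take-between v u) f) , a) ,
      (λ (_ , k , (h , v , u , p , f) , a) →
        h , edge-< (proj₁ u) , proj₂ takes-iff u , k , p , proj₂ takes-iff v ,
        proj₂ (take-between v u) f , a)

  hy-unique : ∀ {h h′ p} → HY M x h p → HY M x h′ p → h ≡ h′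
  hy-unique y y′ with e , _ , q ← proj₁ yields-iff y with e′ , _ , q′ ← proj₁ yields-iff y′ =
    unique-parent e (clash (λ ()) q) e′ (clash (λ ()) q′)

  ht-unique : ∀ {h h′ p} → HT M x p h → HT M x p h′ → h ≡ h′
  ht-unique y y′ with e , _ , q ← proj₁ takes-iff y with e′ , _ , q′ ← proj₁ takes-iff y′ =
    unique-child e (clash (λ ()) q) e′ (clash (λ ()) q′)

  module YieldH = Hierarchy (HY M x) (chi M x) hy-unique
  module TakeH  = Hierarchy (λ h p → HT M x p h) (λ h p → chi M x p h) ht-unique

  -- Beyond a child of `h` no position is adjacent to `h`, so edges out of `h` and chains mean the
  -- same there.
  yield-sibling : ∀ {i k} → YieldH.Sibling i k iff YieldStep i k
  yield-sibling =
    (λ (h , y , y′ , p , f) → let u = proj₁ yields-iff y in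
      h , u , proj₁ yields-iff y′ , p ,
      λ m i<m m<k e → f m i<m m<k (edge⇒chi e (<-trans (proj₁ (proj₂ u)) i<m))) ,
    (λ (h , u , v , p , f) → h , proj₂ yields-iff u , proj₂ yields-iff v , p ,
      λ m i<m m<k c → f m i<m m<k (chi⇒edge c))

  take-sibling : ∀ {i k} → TakeH.Sibling i k iff TakeStep i k
  take-sibling =
    (λ (h , y , y′ , p , f) → let v = proj₁ takes-iff y′ in
      h , proj₁ takes-iff y , v , p ,
      λ m i<m m<k e → f m i<m m<k (edge⇒chi e (<-≤-trans (s≤s m<k) (edge-< (proj₁ v))))) ,
    (λ (h , u , v , p , f) → h , proj₂ takes-iff u , proj₂ takes-iff v , p ,
      λ m i<m m<k c → f m i<m m<k (chi⇒edge c))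

  hy-< : ∀ {h k} → HY M x h k → h < k
  hy-< y = edge-< (proj₁ (proj₁ yields-iff y))

  ht-< : ∀ {k h} → HT M x k h → k < h
  ht-< y = edge-< (proj₁ (proj₁ takes-iff y))

  module _ {φ ψ : Formula n} where
    private
      A = sat M x φ
      B = sat M x ψ

    UHY-form : ∀ {i} → sat M x (UH hyield φ ψ) i iff UntilForm yieldF A B i
    UHY-form =
      (λ (j , _ , h , _ , u) → until-map (map₂ (proj₁ yields-iff)) (λ _ a → a) (λ _ b → b)
        (proj₁ yield-sibling) (YieldH.HU⇒until u)) ,
      (λ u → let h , j , v = YieldH.until⇒HU (until-map (map₂ (proj₂ yields-iff))
                   (λ _ a → a) (λ _ b → b) (proj₂ yield-sibling) u) in
        j , upath-≤ v , h , hy-< (YieldH.HU-start v) , v)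

    SHY-form : ∀ {i} → sat M x (SH hyield φ ψ) i iff UntilForm yieldP A B i
    SHY-form =
      (λ (j , _ , h , _ , u) → until-map (map₂ (proj₁ yields-iff)) (λ _ a → a) (λ _ b → b)
        (proj₁ yield-sibling) (YieldH.HS⇒until u)) ,
      (λ u → let h , j , v = YieldH.until⇒HS (until-map (map₂ (proj₂ yields-iff))
                   (λ _ a → a) (λ _ b → b) (proj₂ yield-sibling) u) in
        j , spath-≤ v , h , hy-< (YieldH.HS-start v) , v)

    UHT-form : ∀ {i} → sat M x (UH htake φ ψ) i iff UntilForm takeF A B i
    UHT-form =
      (λ (j , _ , h , _ , u) → until-map (map₂ (proj₁ takes-iff)) (λ _ a → a) (λ _ b → b)
        (proj₁ take-sibling) (TakeH.HU⇒until u)) ,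
      (λ u → let h , j , v = TakeH.until⇒HU (until-map (map₂ (proj₂ takes-iff))
                   (λ _ a → a) (λ _ b → b) (proj₂ take-sibling) u) in
        j , upath-≤ v , h , ht-< (TakeH.HU-end v) , v)

    SHT-form : ∀ {i} → sat M x (SH htake φ ψ) i iff UntilForm takeP A B i
    SHT-form =
      (λ (j , _ , h , _ , u) → until-map (map₂ (proj₁ takes-iff)) (λ _ a → a) (λ _ b → b)
        (proj₁ take-sibling) (TakeH.HS⇒until u)) ,
      (λ u → let h , j , v = TakeH.until⇒HS (until-map (map₂ (proj₂ takes-iff))
                   (λ _ a → a) (λ _ b → b) (proj₂ take-sibling) u) in
        j , spath-≤ v , h , ht-< (TakeH.HS-end v) , v)

  -- Summary paths as arbitrary paths of edges

  module Summary (Π : PrecSet) where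

    Link : ℕ → ℕ → Set
    Link = EdgeStep (edgeIn Π)

    link? : ∀ i h → Dec (suc i < h × Link i h)
    link? i h = suc i <? h ×-dec edgeStep? (edgeIn Π) i h

    inK-iff : ∀ {e i h} → InK M x Π e i h iff (h ≤ e × suc i < h × Link i h)
    inK-iff = (λ (p , c , ρ) → p , proj₁ c , chi⇒edge c , relΠ⇒ ρ) ,
              (λ (p , q , e , t) → p , edge⇒chi e q , edge⇒relΠ e t)

    sumStep⇒link : ∀ {e a b} → SumStep M x Π e a b → Link a b
    sumStep⇒link (inj₁ (k , _)) = proj₂ (proj₂ (proj₁ inK-iff k))
    sumStep⇒link (inj₂ (_ , refl , ρ@(_ , _ , _ , b , _))) = adj (s≤s⁻¹ b) , relΠ⇒ ρ

    module _ {C D : ℕ → Set} where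

      -- Each step carries a property of its source and one of its target. Until needs φ everywhere
      -- but at the last position and since everywhere but at the first, so one treatment serves
      -- both.
      LinkPath : ℕ → ℕ → Set
      LinkPath = Star (λ a b → Link a b × C a × D b)

      link-≤ : ∀ {i e} → LinkPath i e → i ≤ e
      link-≤ ε = ≤-refl
      link-≤ (((e , _) , _) ◅ u) = ≤-trans (<⇒≤ (edge-< e)) (link-≤ u)

      -- A path of edges starting inside an edge from i to h and ending
      -- at or after h passes through h, since edges do not cross.
      visits : ∀ {i h k e} → Edge i h → i < k → k ≤ h → h ≤ e → D k →
               LinkPath k e → D h × LinkPath h e
      visits eh i<k k≤h h≤e d u with m≤n⇒m<n∨m≡n k≤h
      ... | inj₂ refl = d , u
      visits eh i<k k≤h h≤e d ε | inj₁ k<h = ⊥-elim (<⇒≱ k<h h≤e)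
      visits eh i<k k≤h h≤e d ((l@(e , _) , c , d′) ◅ u) | inj₁ k<h =
        visits eh (<-trans i<k (edge-< e)) (edge-nested eh e i<k k<h) h≤e d′ u

      -- From `i` a summary path must take the longest admissible chain not passing `e`. By `visits`
      -- the given path meets its end `h`, so everything before `h` can be cut out. If there is no
      -- such chain, the first step of the given path is adjacent and is kept.
      condense : ∀ f {i e} → e ≤ f + i → LinkPath i e →
                 Star (λ a b → SumStep M x Π e a b × a < b × C a × D b) i e
      condense f b ε = ε
      condense zero b ((l@(e′ , _) , c , d) ◅ u) =
        ⊥-elim (<⇒≱ (<-≤-trans (edge-< e′) (link-≤ u)) b)
      condense (suc f) {i} {e} b (_◅_ {j = k} (l@(e′ , t) , c , d) u)
        with maximum (link? i) e | m≤n⇒m<n∨m≡n (edge-< e′)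
      ... | inj₁ (h , (h≤e , p , l′@(eh , _)) , mx) | near? =
        (inj₁ (proj₂ inK-iff (h≤e , p , l′) , λ h′ κ → mx h′ (proj₁ inK-iff κ)) ,
         edge-< eh , c , proj₁ rest) ◅
        condense f (≤-trans b (≤-trans (≤-reflexive (sym (+-suc f i)))
                                       (+-monoʳ-≤ f (edge-< eh)))) (proj₂ rest)
        where
        k≤h : suc i < k ⊎ suc i ≡ k → k ≤ h
        k≤h (inj₁ q)    = mx k (link-≤ u , q , l)
        k≤h (inj₂ refl) = <⇒≤ p
        rest : D h × LinkPath h e
        rest = visits eh (edge-< e′) (k≤h near?) h≤e d u
      ... | inj₂ none | inj₁ q = ⊥-elim (none k (link-≤ u , q , l))
      ... | inj₂ none | inj₂ refl =
        (inj₂ ((λ h κ → none h (proj₁ inK-iff κ)) , refl , edge⇒relΠ e′ t) ,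
         edge-< e′ , c , d) ◅
        condense f (≤-trans b (≤-reflexive (sym (+-suc f i)))) u

    module _ {φ ψ : Formula n} where
      private
        A = sat M x φ
        B = sat M x ψ

      until⇒links : ∀ {i} → UntilForm (edgeF (edgeIn Π)) A B i →
                    ∃ λ j → LinkPath {A} {λ _ → ⊤} i j × B j
      until⇒links (here _ b) = _ , ε , b
      until⇒links (there _ a l u) with until⇒links u
      ... | j , v , b = j , (l , a , tt) ◅ v , b

      since⇒links : ∀ {i} → UntilForm (edgeP (edgeIn Π)) A B i →
                    ∃ λ j → B j × LinkPath {λ _ → ⊤} {A} j i
      since⇒links (here _ b) = _ , b , ε
      since⇒links (there _ a l u) with since⇒links u
      ... | j , b , v = j , b , v ◅◅ (l , tt , a) ◅ ε

      upath⇒until : ∀ {e i j} → UPath (SumStep M x Π e) A B i j →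
                    UntilForm (edgeF (edgeIn Π)) A B i
      upath⇒until (lastU b)       = here tt b
      upath⇒until (consU _ a s u) = there tt a (sumStep⇒link s) (upath⇒until u)

      spath⇒until : ∀ {e i j} → SPath (SumStep M x Π e) B A j i →
                    UntilForm (edgeP (edgeIn Π)) A B i
      spath⇒until (firstS b)      = here tt b
      spath⇒until (snocS u _ s a) = there tt a (sumStep⇒link s) (spath⇒until u)

      Uχ-form : ∀ {i} → sat M x (Uχ Π φ ψ) i iff UntilForm (edgeF (edgeIn Π)) A B i
      Uχ-form {i} = (λ (_ , _ , u) → upath⇒until u) , from
        where
        from : UntilForm (edgeF (edgeIn Π)) A B i → sat M x (Uχ Π φ ψ) i
        from u with until⇒links u
        ... | j , v , b = j , link-≤ v ,
          star⇒upath (Star.map (λ (s , p , a , _) → p , a , s)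
                               (condense j (m≤m+n j i) v)) b

      Sχ-form : ∀ {i} → sat M x (Sχ Π φ ψ) i iff UntilForm (edgeP (edgeIn Π)) A B i
      Sχ-form {i} = (λ (_ , _ , u) → spath⇒until u) , from
        where
        from : UntilForm (edgeP (edgeIn Π)) A B i → sat M x (Sχ Π φ ψ) i
        from u with since⇒links u
        ... | j , b , v = j , link-≤ v ,
          star⇒spath (firstS b) (Star.map (λ (s , p , _ , a) → p , a , s)
                                          (condense i (m≤m+n i j) v))

-- Checkers

record Enc (A : Set) (k : ℕ) : Set where
  field
    enc     : A → Fin k
    dec     : Fin k → A
    dec-enc : ∀ a → dec (enc a) ≡ a
open Enc

enc-retract : ∀ {A B k} (f : A → B) (g : B → A) → (∀ a → g (f a) ≡ a) → Enc B k → Enc A k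
enc-retract f g p E = record
  { enc = enc E ∘ f ; dec = g ∘ dec E
  ; dec-enc = λ a → trans (cong g (dec-enc E (f a))) (p a) }

enc-⊤ : Enc ⊤ 1
enc-⊤ = record { enc = λ _ → zero ; dec = λ _ → tt ; dec-enc = λ _ → refl }

enc-Bool : Enc Bool 2
enc-Bool = record { enc = to ; dec = from ; dec-enc = λ { true → refl ; false → refl } }
  where
  to : Bool → Fin 2
  to true  = zero
  to false = suc zero
  from : Fin 2 → Bool
  from zero    = true
  from (suc _) = false

enc-× : ∀ {A B k l} → Enc A k → Enc B l → Enc (A × B) (k * l)
enc-× {k = k} {l} E F = record
  { enc = λ (a , b) → combine (enc E a) (enc F b)
  ; dec = λ i → dec E (proj₁ (remQuot {k} l i)) , dec F (proj₂ (remQuot {k} l i))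
  ; dec-enc = λ (a , b) → trans
      (cong (λ p → dec E (proj₁ p) , dec F (proj₂ p)) (remQuot-combine (enc E a) (enc F b)))
      (cong₂ _,_ (dec-enc E a) (dec-enc F b))
  }

enc-Vec : ∀ n → Enc (Vec Bool n) (2 ^ n)
enc-Vec zero    = enc-retract (λ _ → tt) (λ _ → []) (λ { [] → refl }) enc-⊤
enc-Vec (suc n) = enc-retract (λ { (b ∷ v) → b , v }) (λ (b , v) → b ∷ v)
  (λ { (b ∷ v) → refl }) (enc-× enc-Bool (enc-Vec n))

enc-Sym : ∀ n → Enc (Sym n) (2 * 2 ^ n)
enc-Sym n = enc-retract to from inverse (enc-× enc-Bool (enc-Vec n))
  where
  to : Sym n → Bool × Vec Bool n
  to end    = false , replicate n false
  to (lt a) = true , a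
  from : Bool × Vec Bool n → Sym n
  from (false , _) = end
  from (true  , a) = lt a
  inverse : ∀ s → from (to s) ≡ s
  inverse end    = refl
  inverse (lt a) = refl

enc-≟ : ∀ {A k} → Enc A k → DecidableEquality A
enc-≟ E a b = map′
  (λ q → trans (sym (dec-enc E a)) (trans (cong (dec E) q) (dec-enc E b)))
  (cong (enc E)) (enc E a Fin.≟ enc E b)

-- What a state knows about the current edge: whether it joins adjacent
-- positions, the symbols and values of its two ends, and its own attribute.
record View (n : ℕ) (PV AV : Set) : Set where
  constructor view
  field
    near      : Bool
    tsym lsym : Sym n
    tval lval : PV
    att       : AV
open View

mapView : ∀ {n PV PV′ AV AV′} → (PV → PV′) → (AV → AV′) → View n PV AV → View n PV′ AV′
mapView f g v = view (near v) (tsym v) (lsym v) (f (tval v)) (f (lval v)) (g (att v))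

record Checker (n : ℕ) : Set₁ where
  field
    PV AV : Set
    kP kA : ℕ
    encP  : Enc PV kP
    encA  : Enc AV kA
  V : Set
  V = View n PV AV
  field
    InitC FinC EdgeC : V → Set
    PopC             : V → V → V → Set
    initC?           : ∀ v → Dec (InitC v)
    finC?            : ∀ v → Dec (FinC v)
    edgeC?           : ∀ v → Dec (EdgeC v)
    popC?            : ∀ q p v → Dec (PopC q p v)
  -- Values at both ends of an edge and its attribute. Symbols and the adjacency bit are shared by
  -- all subformulas and are counted only once, in the states of the automaton.
  weight : ℕ
  weight = kP * kP * kA

trivial : ∀ {n} → Checker n
trivial = record
  { PV = ⊤ ; AV = ⊤ ; kP = 1 ; kA = 1 ; encP = enc-⊤ ; encA = enc-⊤
  ; InitC = λ _ → ⊤ ; FinC = λ _ → ⊤ ; EdgeC = λ _ → ⊤ ; PopC = λ _ _ _ → ⊤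
  ; initC? = λ _ → yes tt ; finC? = λ _ → yes tt ; edgeC? = λ _ → yes tt
  ; popC? = λ _ _ _ → yes tt }

_⊗_ : ∀ {n} → Checker n → Checker n → Checker n
C ⊗ D = record
  { PV = C.PV × D.PV ; AV = C.AV × D.AV ; kP = C.kP * D.kP ; kA = C.kA * D.kA
  ; encP = enc-× C.encP D.encP ; encA = enc-× C.encA D.encA
  ; InitC = λ v → C.InitC (fst v) × D.InitC (snd v)
  ; FinC  = λ v → C.FinC (fst v) × D.FinC (snd v)
  ; EdgeC = λ v → C.EdgeC (fst v) × D.EdgeC (snd v)
  ; PopC  = λ q p v → C.PopC (fst q) (fst p) (fst v) × D.PopC (snd q) (snd p) (snd v)
  ; initC? = λ v → C.initC? (fst v) ×-dec D.initC? (snd v)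
  ; finC?  = λ v → C.finC? (fst v) ×-dec D.finC? (snd v)
  ; edgeC? = λ v → C.edgeC? (fst v) ×-dec D.edgeC? (snd v)
  ; popC?  = λ q p v → C.popC? (fst q) (fst p) (fst v) ×-dec D.popC? (snd q) (snd p) (snd v)
  }
  where
  module C = Checker C
  module D = Checker D
  fst = mapView {AV = C.AV × D.AV} proj₁ proj₁
  snd = mapView {AV = C.AV × D.AV} proj₂ proj₂

module _ {n : ℕ} {S : Subset n} (M : OPM S) where

  -- The two Booleans of a position are the val and guard of its claim.
  module Node (C : Checker n) (m : Mode)
              (goal : Sym n → Checker.PV C × Bool × Bool → Bool) where
    private module C = Checker C

    NV = View n (C.PV × Bool × Bool) (C.AV × Bool)

    child : NV → C.V
    child = mapView proj₁ proj₁

    observe : NV → Obs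
    observe v = obs (near v) (ext M (tsym v) (lsym v))
      (claim (proj₁ (proj₂ (tval v))) (proj₂ (proj₂ (tval v))) (goal (tsym v) (tval v)))
      (claim (proj₁ (proj₂ (lval v))) (proj₂ (proj₂ (lval v))) (goal (lsym v) (lval v)))
      (proj₂ (att v))

    node : Checker n
    node = record
      { PV = C.PV × Bool × Bool ; AV = C.AV × Bool ; kP = C.kP * 4 ; kA = C.kA * 2
      ; encP = enc-× C.encP (enc-× enc-Bool enc-Bool) ; encA = enc-× C.encA enc-Bool
      ; InitC = λ v → C.InitC (child v) × InitOk m (observe v)
      ; FinC  = λ v → C.FinC (child v) × FinOk m (observe v)
      ; EdgeC = λ v → C.EdgeC (child v) × EdgeOk m (observe v)
      ; PopC  = λ q p v → C.PopC (child q) (child p) (child v) ×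
                          PopOk m (observe q) (observe p) (observe v)
      ; initC? = λ v → C.initC? (child v) ×-dec initOk? m (observe v)
      ; finC?  = λ v → C.finC? (child v) ×-dec finOk? m (observe v)
      ; edgeC? = λ v → C.edgeC? (child v) ×-dec edgeOk? m (observe v)
      ; popC?  = λ q p v → C.popC? (child q) (child p) (child v) ×-dec
                           popOk? m (observe q) (observe p) (observe v)
      }

  module _ (C : Checker n) (x : List (Letter n)) where
    open Checker C
    open Word M x

    viewAt : (ℕ → PV) → (ℕ → ℕ → AV) → ℕ → ℕ → V
    viewAt val at h j = view ⌊ j ≟ suc h ⌋ (P h) (P j) (val h) (val j) (at h j)

    record Consistent (val : ℕ → PV) (at : ℕ → ℕ → AV) : Set where
      field
        init : InitC (viewAt val at 0 1)
        fin  : FinC (viewAt val at 0 (suc N))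
        edge : ∀ {h j} → Edge h j → EdgeC (viewAt val at h j)
        popc : ∀ {h k i j} → Open h k i → Edge i j → r i j ≡ just ⋗ →
               PopC (viewAt val at i j) (viewAt val at h k) (viewAt val at h j)

  -- Soundness is an equivalence in every consistent labelling, as negation requires. Completeness
  -- does not mention `Q`: a labelling must exist whether or not the formula holds anywhere.
  record Computes (C : Checker n) (out : Sym n → Checker.PV C → Bool)
                  (x : List (Letter n)) (Q : ℕ → Set) : Set where
    field
      sound    : ∀ {val at} → Consistent C x val at →
                 ∀ {i} → i ≤ suc (length x) → T (out (pos M x i) (val i)) iff Q i
      complete : ∃₂ (Consistent C x)
  open Computes

  module _ {C : Checker n} {x : List (Letter n)} where
    open Checker C

    computes-map : ∀ {out Q Q′} → (∀ {i} → Q i iff Q′ i) →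
                   Computes C out x Q → Computes C out x Q′
    computes-map q c = record
      { sound = λ k i≤ → iff-trans (sound c k i≤) q ; complete = complete c }

    computes-not : ∀ {out Q} → Computes C out x Q →
                   Computes C (λ s v → not (out s v)) x (λ i → ¬ Q i)
    computes-not c = record
      { sound = λ k i≤ → not-iff (sound c k i≤) ; complete = complete c }

  module _ {C D : Checker n} {x : List (Letter n)} where
    private
      module C = Checker C
      module D = Checker D

    consistent-⊗ : ∀ {val val′ at at′} → Consistent C x val at → Consistent D x val′ at′ →
      Consistent (C ⊗ D) x (λ i → val i , val′ i) (λ i j → at i j , at′ i j)
    consistent-⊗ c d = record
      { init = c.init , d.init ; fin = c.fin , d.fin
      ; edge = λ e → c.edge e , d.edge e ; popc = λ o e q → c.popc o e q , d.popc o e q }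
      where
      module c = Consistent c
      module d = Consistent d

    consistent-fst : ∀ {val at} → Consistent (C ⊗ D) x val at →
                     Consistent C x (proj₁ ∘ val) (λ i j → proj₁ (at i j))
    consistent-fst c = record
      { init = proj₁ c.init ; fin = proj₁ c.fin
      ; edge = λ e → proj₁ (c.edge e) ; popc = λ o e q → proj₁ (c.popc o e q) }
      where module c = Consistent c

    consistent-snd : ∀ {val at} → Consistent (C ⊗ D) x val at →
                     Consistent D x (proj₂ ∘ val) (λ i j → proj₂ (at i j))
    consistent-snd c = record
      { init = proj₂ c.init ; fin = proj₂ c.fin
      ; edge = λ e → proj₂ (c.edge e) ; popc = λ o e q → proj₂ (c.popc o e q) }
      where module c = Consistent c

    ⊗-complete : ∃₂ (Consistent C x) → ∃₂ (Consistent D x) → ∃₂ (Consistent (C ⊗ D) x)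
    ⊗-complete (_ , _ , c) (_ , _ , d) = _ , _ , consistent-⊗ c d

    computes-or : ∀ {o o′ Q Q′} → Computes C o x Q → Computes D o′ x Q′ →
      Computes (C ⊗ D) (λ s (v , w) → o s v ∨ o′ s w) x (λ i → Q i ⊎ Q′ i)
    computes-or c d = record
      { sound = λ k i≤ → ∨-iff (sound c (consistent-fst k) i≤) (sound d (consistent-snd k) i≤)
      ; complete = ⊗-complete (complete c) (complete d) }

    computes-fst : ∀ {o o′ Q Q′} → Computes C o x Q → Computes D o′ x Q′ →
                   Computes (C ⊗ D) (λ s (v , _) → o s v) x Q
    computes-fst c d = record
      { sound = λ k → sound c (consistent-fst k)
      ; complete = ⊗-complete (complete c) (complete d) }

    computes-snd : ∀ {o o′ Q Q′} → Computes C o x Q → Computes D o′ x Q′ →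
                   Computes (C ⊗ D) (λ s (_ , w) → o′ s w) x Q′
    computes-snd c d = record
      { sound = λ k → sound d (consistent-snd k)
      ; complete = ⊗-complete (complete c) (complete d) }

  -- Checkers for modal operators

  module Modal {C : Checker n} (m : Mode)
               (goal : Sym n → Checker.PV C × Bool × Bool → Bool)
               (x : List (Letter n)) (allDefined : Word.AllDefined M x) where
    open Checker C using (PV; AV)
    open Node C m goal
    open Word M x
    open Modes N r r-source r-target allDefined

    consistent-child : ∀ {val at} → Consistent node x val at →
                       Consistent C x (proj₁ ∘ val) (λ i j → proj₁ (at i j))
    consistent-child c = record
      { init = proj₁ c.init ; fin = proj₁ c.fin
      ; edge = λ e → proj₁ (c.edge e) ; popc = λ o e q → proj₁ (c.popc o e q) }
      where module c = Consistent c

    NodeChecks : (ℕ → PV × Bool × Bool) → (ℕ → ℕ → Bool) → Set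
    NodeChecks val = Checks m (proj₁ ∘ proj₂ ∘ val) (proj₂ ∘ proj₂ ∘ val)
                            (λ i → goal (P i) (val i))

    consistent-checks : ∀ {val at} → Consistent node x val at →
                        NodeChecks val (λ i j → proj₂ (at i j))
    consistent-checks c = record
      { init = proj₂ c.init ; fin = proj₂ c.fin
      ; edge = λ e → proj₂ (c.edge e) ; popc = λ o e q → proj₂ (c.popc o e q) }
      where module c = Consistent c

    consistent-node : ∀ {val at acc} →
      Consistent C x (proj₁ ∘ val) at → NodeChecks val acc →
      Consistent node x val (λ i j → at i j , acc i j)
    consistent-node c d = record
      { init = c.init , d.init ; fin = c.fin , d.fin
      ; edge = λ e → c.edge e , d.edge e ; popc = λ o e q → c.popc o e q , d.popc o e q }
      where
      module c = Consistent c
      module d = Checks d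

    module _ {Γ : ℕ → Set} (Γ? : ∀ i → Dec (Γ i)) where

      Reach : ℕ → Set
      Reach i = ∃ λ j → Step m i j × Γ j

      reach? : ∀ i → Dec (Reach i)
      reach? i = bounded-search (suc (suc N)) (λ j → step? m i j ×-dec Γ? j)
                                (s≤s ∘ step-≤ m ∘ proj₁)

      -- The goal may read the very bits that are guessed, as it does for until. The second premise
      -- is the resulting fixpoint condition: with the true bits inserted, the goal must be `Γ`.
      node-complete : ∀ {cval cat} → Consistent C x cval cat →
        (∀ i → T (goal (P i) (cval i , ⌊ reach? i ⌋ , ⌊ guard? m i ⌋)) iff Γ i) →
        ∃₂ (Consistent node x)
      node-complete c g = _ , _ , consistent-node c (proj₂
        (checkable m (λ _ → ⌊⌋-iff (guard? m _)) λ {i} _ →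
          iff-trans (⌊⌋-iff (reach? i))
            (map₂ (map₂ (proj₂ (g _))) , map₂ (map₂ (proj₁ (g _))))))

    private
      until-fuel : ∀ {A B : ℕ → Set} → (∀ i → Dec (A i)) → (∀ i → Dec (B i)) →
        ∀ f i → measure m i < f → Dec (Until (Guard m) (Step m) A B i)
      until-fuel A? B? (suc f) i p with guard? m i | B? i | A? i
      ... | no ng | _ | _ = no λ { (here g _) → ng g ; (there g _ _ _) → ng g }
      ... | yes g | yes b | _ = yes (here g b)
      ... | yes g | no nb | no na = no λ { (here _ b) → nb b ; (there _ a _ _) → na a }
      ... | yes g | no nb | yes a =
        map′ (λ (j , s , u) → there g a s u)
             (λ { (here _ b) → ⊥-elim (nb b) ; (there _ _ s u) → _ , s , u })
             (bounded-search (suc (suc N)) further (s≤s ∘ step-≤ m ∘ proj₁))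
        where
        further : ∀ j → Dec (Step m i j × Until (Guard m) (Step m) _ _ j)
        further j with step? m i j
        ... | no ns = no (ns ∘ proj₁)
        ... | yes s = map′ (s ,_) proj₂
          (until-fuel A? B? f j (<-≤-trans (step-measure m s) (s≤s⁻¹ p)))

    until? : ∀ {A B : ℕ → Set} → (∀ i → Dec (A i)) → (∀ i → Dec (B i)) →
             ∀ i → Dec (Until (Guard m) (Step m) A B i)
    until? A? B? i = until-fuel A? B? _ i ≤-refl

    until-unfold : ∀ {A B : ℕ → Set} {i} →
      Until (Guard m) (Step m) A B i iff
      (Guard m i × (B i ⊎ (A i × ∃ λ j → Step m i j × Until (Guard m) (Step m) A B j)))
    until-unfold =
      (λ { (here g b) → g , inj₁ b ; (there g a s u) → g , inj₂ (a , _ , s , u) }) ,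
      (λ { (g , inj₁ b) → here g b ; (g , inj₂ (a , _ , s , u)) → there g a s u })

    -- The guessed values satisfy the fixpoint equation of Until along a
    -- well-founded relation, which has a single solution.
    until-sound : ∀ {val guard a b bit : ℕ → Bool} {A B : ℕ → Set} →
      (∀ i → bit i ≡ guard i ∧ (b i ∨ (a i ∧ val i))) →
      GuardCorrect m val guard bit → ValCorrect m val guard bit →
      (∀ {i} → i ≤ suc N → T (a i) iff A i) → (∀ {i} → i ≤ suc N → T (b i) iff B i) →
      ∀ {i} → i ≤ suc N → T (bit i) iff Until (Guard m) (Step m) A B i
    until-sound {val} {guard} {a} {b} {bit} {A} {B} eq gc vc ia ib {i} i≤ =
      to (suc (measure m i)) ≤-refl i≤ , from i≤
      where
      to : ∀ f {i} → measure m i < f → i ≤ suc N → T (bit i) →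
           Until (Guard m) (Step m) A B i
      to (suc f) {i} p i≤ t with tg , ts ← proj₁ (T-∧ (guard i)) (subst T (eq i) t)
        with proj₁ (T-∨ (b i)) ts
      ... | inj₁ tb = here (proj₁ (gc i≤) tg) (proj₁ (ib i≤) tb)
      ... | inj₂ tav with ta , tv ← proj₁ (T-∧ (a i)) tav
        with j , s , u ← proj₁ (vc i≤ (proj₁ (gc i≤) tg)) tv =
        there (proj₁ (gc i≤) tg) (proj₁ (ia i≤) ta) s
          (to f (<-≤-trans (step-measure m s) (s≤s⁻¹ p)) (step-≤ m s) u)
      from : ∀ {i} → i ≤ suc N → Until (Guard m) (Step m) A B i → T (bit i)
      from {i} i≤ (here g p) = subst T (sym (eq i))
        (proj₂ (T-∧ (guard i)) (proj₂ (gc i≤) g , proj₂ (T-∨ (b i)) (inj₁ (proj₂ (ib i≤) p))))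
      from {i} i≤ (there g p s u) = subst T (sym (eq i))
        (proj₂ (T-∧ (guard i)) (proj₂ (gc i≤) g , proj₂ (T-∨ (b i)) (inj₂
          (proj₂ (T-∧ (a i)) (proj₂ (ia i≤) p ,
            proj₂ (vc i≤ g) (_ , s , from (step-≤ m s) u))))))

  module NextNode {C : Checker n} (m : Mode) (o : Sym n → Checker.PV C → Bool) where
    open Checker C using (PV)

    nextGoal nextOut : Sym n → PV × Bool × Bool → Bool
    nextGoal s (v , _ , _) = o s v
    nextOut  s (_ , X , G) = G ∧ X

    nextChecker : Checker n
    nextChecker = Node.node C m nextGoal

    computes-next : ∀ {x} (d : Word.AllDefined M x) {Q} → Computes C o x Q →
      Computes nextChecker nextOut x (Semantics.NextForm M x d m Q)
    computes-next {x} d {Q} c = record { sound = snd′ ; complete = cmp }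
      where
      open Modal {C} m nextGoal x d
      open Word M x
      open Modes N r r-source r-target d
      snd′ : ∀ {val at} → Consistent nextChecker x val at → ∀ {i} → i ≤ suc N →
             T (nextOut (P i) (val i)) iff (Guard m i × ∃ λ j → Step m i j × Q j)
      snd′ {val} k {i} i≤ = iff-trans (T-∧ (proj₂ (proj₂ (val i)))) (to , from)
        where
        gc = guards-correct m (consistent-checks k)
        vc = vals-correct m (consistent-checks k)
        s  = sound c (consistent-child k)
        to : _ → _
        to (g , t) with j , st , q ← proj₁ (vc i≤ (proj₁ (gc i≤) g)) t =
          proj₁ (gc i≤) g , j , st , proj₁ (s (step-≤ m st)) q
        from : _ → _
        from (g , j , st , q) =
          proj₂ (gc i≤) g , proj₂ (vc i≤ g) (j , st , proj₂ (s (step-≤ m st)) q)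
      cmp : ∃₂ (Consistent nextChecker x)
      cmp with cval , _ , k ← complete c =
        node-complete (λ i → T? (o (P i) (cval i))) k (λ _ → id , id)

  module UntilNode {C : Checker n} (m : Mode) (a b : Sym n → Checker.PV C → Bool) where
    open Checker C using (PV)

    -- The one-step unfolding of until, where `X` claims that until holds at a related position.
    -- Hence the same function serves as output and as goal.
    untilOut : Sym n → PV × Bool × Bool → Bool
    untilOut s (v , X , G) = G ∧ (b s v ∨ (a s v ∧ X))

    untilChecker : Checker n
    untilChecker = Node.node C m untilOut

    computes-until : ∀ {x} (d : Word.AllDefined M x) {A B} →
      Computes C a x A → Computes C b x B →
      Computes untilChecker untilOut x (Semantics.UntilForm M x d m A B)
    computes-until {x} d {A} {B} ca cb = record { sound = snd′ ; complete = cmp }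
      where
      open Modal {C} m untilOut x d
      open Word M x
      open Modes N r r-source r-target d
      snd′ : ∀ {val at} → Consistent untilChecker x val at → ∀ {i} → i ≤ suc N →
             T (untilOut (P i) (val i)) iff Until (Guard m) (Step m) A B i
      snd′ k = until-sound (λ _ → refl)
        (guards-correct m (consistent-checks k)) (vals-correct m (consistent-checks k))
        (sound ca (consistent-child k)) (sound cb (consistent-child k))
      cmp : ∃₂ (Consistent untilChecker x)
      cmp with cval , _ , k ← complete ca =
        -- Until is formed over the output bits instead of `A` and `B`: these bits are decidable at
        -- every position, so completeness needs no decision procedure for satisfaction.
        node-complete {Γ = Until (Guard m) (Step m) (λ i → T (a (P i) (cval i)))
                                                    (λ i → T (b (P i) (cval i)))}
          U? k λ i → iff-trans
            (∧-iff (⌊⌋-iff (guard? m i)) (∨-iff (id , id) (∧-iff (id , id) (⌊⌋-iff (reach? U? i)))))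
            (iff-sym until-unfold)
        where U? = until? (λ i → T? (a (P i) (cval i))) (λ i → T? (b (P i) (cval i)))

-- The automaton of a formula

module Compilation {n : ℕ} {S : Subset n} (M : OPM S) where

  record Component (φ : Formula n) : Set₁ where
    field
      checker  : Checker n
      out      : Sym n → Checker.PV checker → Bool
      small    : Checker.weight checker ≤ 2 ^ (5 * size φ)
      computes : ∀ {x} → Word.AllDefined M x → Computes M checker out x (sat M x φ)
  open Component

  ⊗-weight : ∀ (C D : Checker n) →
             Checker.weight (C ⊗ D) ≡ Checker.weight C * Checker.weight D
  ⊗-weight C D = lemma C.kP D.kP C.kA D.kA
    where
    module C = Checker C
    module D = Checker D
    lemma : ∀ a b c d → (a * b) * (a * b) * (c * d) ≡ (a * a * c) * (b * b * d)
    lemma = solve-∀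

  -- Two bits at each end and one on the edge multiply the weight by 4 · 4 · 2, which is the origin
  -- of the 5 in all the bounds.
  node-weight : ∀ (C : Checker n) m goal →
                Checker.weight (Node.node M C m goal) ≡ 2 ^ 5 * Checker.weight C
  node-weight C m goal = lemma (Checker.kP C) (Checker.kA C)
    where
    lemma : ∀ a c → (a * 4) * (a * 4) * (c * 2) ≡ 32 * (a * a * c)
    lemma = solve-∀

  ⊗-small : ∀ (C D : Checker n) s t →
            Checker.weight C ≤ 2 ^ (5 * s) → Checker.weight D ≤ 2 ^ (5 * t) →
            Checker.weight (C ⊗ D) ≤ 2 ^ (5 * (s + t))
  ⊗-small C D s t p q = begin
    Checker.weight (C ⊗ D)              ≡⟨ ⊗-weight C D ⟩
    Checker.weight C * Checker.weight D ≤⟨ *-mono-≤ p q ⟩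
    2 ^ (5 * s) * 2 ^ (5 * t)           ≡⟨ ^-distribˡ-+-* 2 (5 * s) (5 * t) ⟨
    2 ^ (5 * s + 5 * t)                 ≡⟨ cong (2 ^_) (*-distribˡ-+ 5 s t) ⟨
    2 ^ (5 * (s + t))                   ∎
    where open ≤-Reasoning

  node-small : ∀ (C : Checker n) m goal s → Checker.weight C ≤ 2 ^ (5 * s) →
               Checker.weight (Node.node M C m goal) ≤ 2 ^ (5 * suc s)
  node-small C m goal s p = begin
    Checker.weight (Node.node M C m goal) ≡⟨ node-weight C m goal ⟩
    2 ^ 5 * Checker.weight C              ≤⟨ *-monoʳ-≤ (2 ^ 5) p ⟩
    2 ^ 5 * 2 ^ (5 * s)                   ≡⟨ ^-distribˡ-+-* 2 5 (5 * s) ⟨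
    2 ^ (5 + 5 * s)                       ≡⟨ cong (2 ^_) (*-suc 5 s) ⟨
    2 ^ (5 * suc s)                       ∎
    where open ≤-Reasoning

  weaken : ∀ {w} s → w ≤ 2 ^ (5 * s) → w ≤ 2 ^ (5 * suc s)
  weaken s p = ≤-trans p (^-monoʳ-≤ 2 (*-monoʳ-≤ 5 (n≤1+n s)))

  holds : Fin n → Sym n → Bool
  holds p end    = false
  holds p (lt a) = ⌊ p ∈? a ⌋

  atomC : ∀ p → Component (atom p)
  atomC p = record
    { checker = trivial
    ; out = λ s _ → holds p s
    ; small = s≤s z≤n
    ; computes = λ {x} _ → record
        { sound = λ _ {i} _ → correct (pos M x i)
        ; complete = (λ _ → tt) , (λ _ _ → tt) , record
            { init = tt ; fin = tt ; edge = λ _ → tt ; popc = λ _ _ _ → tt } }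
    }
    where
    correct : ∀ s → T (holds p s) iff (Σ (Letter n) λ a → s ≡ lt a × p ∈ a)
    correct end    = (λ ()) , λ { (_ , () , _) }
    correct (lt a) = iff-trans (⌊⌋-iff (p ∈? a)) ((λ q → a , refl , q) , λ { (_ , refl , q) → q })

  notC : ∀ {φ} → Component φ → Component (¬f φ)
  notC {φ} c = record
    { checker = checker c ; out = λ s v → not (out c s v) ; small = weaken (size φ) (small c)
    ; computes = λ d → computes-not M (computes c d) }

  orC : ∀ {φ ψ} → Component φ → Component ψ → Component (φ ∨f ψ)
  orC {φ} {ψ} c d = record
    { checker = checker c ⊗ checker d
    ; out = λ s (v , w) → out c s v ∨ out d s w
    ; small = weaken (size φ + size ψ)
        (⊗-small (checker c) (checker d) (size φ) (size ψ) (small c) (small d))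
    ; computes = λ a → computes-or M (computes c a) (computes d a) }

  nextC : ∀ {φ χ} (m : Mode) → size χ ≡ suc (size φ) →
          (∀ x (d : Word.AllDefined M x) {i} → sat M x χ i iff Semantics.NextForm M x d m (sat M x φ) i) →
          Component φ → Component χ
  nextC {φ} m eq form c = record
    { checker = nextChecker ; out = nextOut
    ; small = subst (λ s → Checker.weight nextChecker ≤ 2 ^ (5 * s)) (sym eq)
        (node-small (checker c) m nextGoal (size φ) (small c))
    ; computes = λ {x} d → computes-map M (iff-sym (form x d)) (computes-next d (computes c d)) }
    where open NextNode M {checker c} m (out c)

  untilC : ∀ {φ ψ χ} (m : Mode) → size χ ≡ suc (size φ + size ψ) →
           (∀ x (d : Word.AllDefined M x) {i} → sat M x χ i iff
              Semantics.UntilForm M x d m (sat M x φ) (sat M x ψ) i) →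
           Component φ → Component ψ → Component χ
  untilC {φ} {ψ} m eq form c d = record
    { checker = untilChecker ; out = untilOut
    ; small = subst (λ s → Checker.weight untilChecker ≤ 2 ^ (5 * s)) (sym eq)
        (node-small (checker c ⊗ checker d) m untilOut (size φ + size ψ)
          (⊗-small (checker c) (checker d) (size φ) (size ψ) (small c) (small d)))
    ; computes = λ {x} a → computes-map M (iff-sym (form x a))
        (computes-until a (computes-fst M (computes c a) (computes d a))
                          (computes-snd M (computes c a) (computes d a))) }
    where open UntilNode M {checker c ⊗ checker d} m
                 (λ s (v , _) → out c s v) (λ s (_ , w) → out d s w)

  component : ∀ φ → Component φ
  component (atom p)    = atomC p
  component (¬f φ)      = notC (component φ)
  component (φ ∨f ψ)    = orC (component φ) (component ψ)
  component (nextΠ Π φ) = nextC (edgeF (adjacentIn Π)) refl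
    (λ x d → Semantics.nextΠ-form M x d {φ}) (component φ)
  component (backΠ Π φ) = nextC (edgeP (adjacentIn Π)) refl
    (λ x d → Semantics.backΠ-form M x d {φ}) (component φ)
  component (χF Π φ)    = nextC (edgeF (chainIn Π)) refl
    (λ x d → Semantics.χF-form M x d {φ}) (component φ)
  component (χP Π φ)    = nextC (edgeP (chainIn Π)) refl
    (λ x d → Semantics.χP-form M x d {φ}) (component φ)
  component (nextH hyield φ) = nextC yieldF refl
    (λ x d → Semantics.nextHY-form M x d {φ}) (component φ)
  component (nextH htake φ)  = nextC takeF refl
    (λ x d → Semantics.nextHT-form M x d {φ}) (component φ)
  component (backH hyield φ) = nextC yieldP refl
    (λ x d → Semantics.backHY-form M x d {φ}) (component φ)
  component (backH htake φ)  = nextC takeP refl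
    (λ x d → Semantics.backHT-form M x d {φ}) (component φ)
  component (Uχ Π φ ψ) = untilC (edgeF (edgeIn Π)) refl
    (λ x d → Semantics.Summary.Uχ-form M x d Π {φ} {ψ}) (component φ) (component ψ)
  component (Sχ Π φ ψ) = untilC (edgeP (edgeIn Π)) refl
    (λ x d → Semantics.Summary.Sχ-form M x d Π {φ} {ψ}) (component φ) (component ψ)
  component (UH hyield φ ψ) = untilC yieldF refl
    (λ x d → Semantics.UHY-form M x d {φ} {ψ}) (component φ) (component ψ)
  component (UH htake φ ψ)  = untilC takeF refl
    (λ x d → Semantics.UHT-form M x d {φ} {ψ}) (component φ) (component ψ)
  component (SH hyield φ ψ) = untilC yieldP refl
    (λ x d → Semantics.SHY-form M x d {φ} {ψ}) (component φ) (component ψ)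
  component (SH htake φ ψ)  = untilC takeP refl
    (λ x d → Semantics.SHT-form M x d {φ} {ψ}) (component φ) (component ψ)

  -- The automaton of a checker

  module Automaton (C : Checker n) (out : Sym n → Checker.PV C → Bool) where
    open Checker C

    encV : Enc V (2 * ((2 * 2 ^ n) * ((2 * 2 ^ n) * (kP * (kP * kA)))))
    encV = enc-retract
      (λ v → near v , tsym v , lsym v , tval v , lval v , att v)
      (λ (a , s , t , u , w , c) → view a s t u w c) (λ _ → refl)
      (enc-× enc-Bool (enc-× (enc-Sym n) (enc-× (enc-Sym n) (enc-× encP (enc-× encP encA)))))

    topEnd lookEnd : V → Sym n × PV
    topEnd  v = tsym v , tval v
    lookEnd v = lsym v , lval v

    encE : Enc (Sym n × PV) (2 * 2 ^ n * kP)
    encE = enc-× (enc-Sym n) encP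

    Initial Final : V → Set
    Initial v = T (near v) × tsym v ≡ end × T (out (lsym v) (lval v)) × InitC v × EdgeC v
    Final   v = lsym v ≡ end × FinC v

    -- Push and shift share this relation, since both lead to the adjacent edge out of the position
    -- just read. Its right end is guessed, symbol included; the equation with `lt b` tests the
    -- guess made earlier for the position now being read.
    Read : V → Letter n → V → Set
    Read v b w = lsym v ≡ lt b × T (near w) × topEnd w ≡ lookEnd v × EdgeC w

    -- The new edge takes its left end from the edge on which the handle was begun and its right end
    -- from the popped edge; only its attribute is guessed.
    Pop : V → V → V → Set
    Pop q p v = (¬ T (near v)) × topEnd v ≡ topEnd p × lookEnd v ≡ lookEnd q × EdgeC v × PopC q p v

    initial? : ∀ v → Dec (Initial v)
    initial? v = T? _ ×-dec enc-≟ (enc-Sym n) _ _ ×-dec T? _ ×-dec initC? v ×-dec edgeC? v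

    final? : ∀ v → Dec (Final v)
    final? v = enc-≟ (enc-Sym n) _ _ ×-dec finC? v

    read? : ∀ v b w → Dec (Read v b w)
    read? v b w = enc-≟ (enc-Sym n) _ _ ×-dec T? _ ×-dec enc-≟ encE _ _ ×-dec edgeC? w

    pop? : ∀ q p v → Dec (Pop q p v)
    pop? q p v = ¬? (T? _) ×-dec enc-≟ encE _ _ ×-dec enc-≟ encE _ _ ×-dec
                 edgeC? v ×-dec popC? q p v

    automaton : OPA M _
    automaton = record
      { initial = λ q → ⌊ initial? (dec encV q) ⌋
      ; final   = λ q → ⌊ final? (dec encV q) ⌋
      ; δpush   = λ p b q → ⌊ read? (dec encV p) b (dec encV q) ⌋
      ; δshift  = λ p b q → ⌊ read? (dec encV p) b (dec encV q) ⌋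
      ; δpop    = λ q p s → ⌊ pop? (dec encV q) (dec encV p) (dec encV s) ⌋
      }

    module _ (x : List (Letter n)) where
      open Word M x
      open Runs M x automaton
      open Labelling

      consistent⇒labelling : ∀ {val at} → Consistent M C x val at →
        T (out (P 1) (val 1)) → ∃ Labelling
      consistent⇒labelling {val} {at} c t = (λ h j → enc encV (st h j)) , record
        { initial-ok = fromWitness (subst Initial (code 0 1)
            (tt , refl , t , c.init , c.edge (adj z≤n)))
        ; final-ok   = fromWitness (subst Final (code 0 (suc N)) (P-target , c.fin))
        ; push-ok    = λ e eq _ → read-ok e eq
        ; shift-ok   = λ e eq _ → read-ok e eq
        ; pop-ok     = λ {h} {s} {i} {j} o e q → fromWitness
            (subst (λ v → Pop v (dec encV (enc encV (st h s))) (dec encV (enc encV (st h j)))) (code i j)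
              (subst₂ (λ u v → Pop (st i j) u v) (code h s) (code h j)
                ((λ t → <⇒≱ (edge-< e) (subst (_≤ i) (sym (toWitness t)) (open-< o))) ,
                 refl , refl , c.edge (pop o e q) , c.popc o e q)))
        }
        where
        module c = Consistent c
        st = viewAt M C x val at
        code : ∀ h j → st h j ≡ dec encV (enc encV (st h j))
        code h j = sym (dec-enc encV (st h j))
        read-ok : ∀ {h j b} → Edge h j → P j ≡ lt b →
                  T ⌊ read? (dec encV (enc encV (st h j))) b (dec encV (enc encV (st j (suc j)))) ⌋
        read-ok {h} {j} {b} e eq = fromWitness
          (subst₂ (λ u v → Read u b v) (code h j) (code j (suc j))
            (eq , fromWitness refl , refl , c.edge (adj (inner e))))
          where
          inner : ∀ {h} → Edge h j → j ≤ N
          inner e with m≤n⇒m<n∨m≡n (edge-≤ e)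
          ... | inj₁ p = s≤s⁻¹ p
          ... | inj₂ refl with () ← trans (sym P-target) eq

      module _ (allDefined : AllDefined) {ℓ : ℕ → ℕ → Fin _} (L : Labelling ℓ) where
        open Total r-source r-target allDefined

        st : ℕ → ℕ → V
        st h j = dec encV (ℓ h j)

        at : ℕ → ℕ → AV
        at h j = att (st h j)

        -- The guess about a position is made on the adjacent edge into it. All other edges at this
        -- position copy it, as `look-st` and `top-st` show.
        position : ℕ → Sym n × PV
        position zero    = topEnd (st 0 1)
        position (suc i) = lookEnd (st i (suc i))

        value : ℕ → PV
        value i = proj₂ (position i)

        initial-st : Initial (st 0 1)
        initial-st = toWitness (initial-ok L)

        pop-st : ∀ {h s i j} → Open h s i → Edge i j → r i j ≡ just ⋗ →
                 Pop (st i j) (st h s) (st h j)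
        pop-st o e q = toWitness (pop-ok L o e q)

        entered : ∀ {i} → 1 ≤ i → i ≤ N →
                  ∃₂ λ h b → Edge h i × P i ≡ lt b × Read (st h i) b (st i (suc i))
        entered 1≤i i≤N with entrance 1≤i (m≤n⇒m≤1+n i≤N) | letter-exists 1≤i i≤N
        ... | h , e , n | b , eq with allDefined e
        ...   | ⋖ , q = h , b , e , eq , toWitness (push-ok L e eq q)
        ...   | ≐ , q = h , b , e , eq , toWitness (shift-ok L e eq q)
        ...   | ⋗ , q = ⊥-elim (n q)

        look-st : ∀ {h j} → Edge h j → lookEnd (st h j) ≡ position j
        look-st (adj _)     = refl
        look-st (pop o e q) =
          trans (proj₁ (proj₂ (proj₂ (pop-st o e q)))) (look-st e)

        mutual
          top-st : ∀ {h j} → Edge h j → topEnd (st h j) ≡ position h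
          top-st (adj {zero} _) = refl
          top-st (adj {suc i} p) with entered (s≤s z≤n) p
          ... | _ , _ , e , _ , _ , _ , q , _ = trans q (look-st e)
          top-st (pop o e q) = trans (proj₁ (proj₂ (pop-st o e q))) (top-st-open o)

          top-st-open : ∀ {h s i} → Open h s i → topEnd (st h s) ≡ position h
          top-st-open (start e _ _)  = top-st e
          top-st-open (more o _ _ _) = top-st-open o

        near-st : ∀ {h j} → Edge h j → near (st h j) ≡ ⌊ j ≟ suc h ⌋
        near-st (adj {zero} _) = T-ext ((λ _ → tt) , λ _ → proj₁ initial-st)
        near-st (adj {suc i} p) with entered (s≤s z≤n) p
        ... | _ , _ , _ , _ , _ , t , _ =
          T-ext ((λ _ → fromWitness {a? = suc (suc i) ≟ suc (suc i)} refl) , λ _ → t)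
        near-st (pop {h} {j = j} o e q) = T-ext
          ((λ t → ⊥-elim (proj₁ (pop-st o e q) t)) ,
           (λ t → ⊥-elim (<⇒≱ (edge-< e) (subst (_≤ _) (sym (toWitness t)) (open-< o)))))

        sym-st : ∀ {i} → i ≤ suc N → proj₁ (position i) ≡ P i
        sym-st {zero} _ = proj₁ (proj₂ initial-st)
        sym-st {suc i} i≤ with m≤n⇒m<n∨m≡n i≤
        ... | inj₁ (s≤s i≤N) with entered (s≤s z≤n) i≤N
        ...   | _ , _ , e , eq , q , _ =
          trans (sym (cong proj₁ (look-st e))) (trans q (sym eq))
        -- No letter is ever read at `N + 1`; the symbol guessed there is compared with # by the
        -- final state, on the outer edge.
        sym-st {suc i} i≤ | inj₂ refl =
          trans (sym (cong proj₁ (look-st outer-edge)))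
            (trans (proj₁ (toWitness (final-ok L))) (sym P-target))

        edge-st : ∀ {h j} → Edge h j → EdgeC (st h j)
        edge-st (adj {zero} _) = proj₂ (proj₂ (proj₂ (proj₂ initial-st)))
        edge-st (adj {suc i} p) with entered (s≤s z≤n) p
        ... | _ , _ , _ , _ , _ , _ , _ , c = c
        edge-st (pop o e q) = proj₁ (proj₂ (proj₂ (proj₂ (pop-st o e q))))

        view-st : ∀ {h j} → Edge h j → st h j ≡ viewAt M C x value at h j
        view-st {h} {j} e = assemble (near-st e)
          (trans (cong proj₁ (top-st e)) (sym-st (<⇒≤ (<-≤-trans (edge-< e) (edge-≤ e)))))
          (trans (cong proj₁ (look-st e)) (sym-st (edge-≤ e)))
          (cong proj₂ (top-st e)) (cong proj₂ (look-st e))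
          where
          assemble : ∀ {a s t u w} → near (st h j) ≡ a → tsym (st h j) ≡ s →
            lsym (st h j) ≡ t → tval (st h j) ≡ u → lval (st h j) ≡ w →
            st h j ≡ view a s t u w (at h j)
          assemble refl refl refl refl refl = refl

        labelling⇒consistent : Consistent M C x value at × T (out (P 1) (value 1))
        labelling⇒consistent = record
          { init = subst InitC (view-st (adj z≤n)) (proj₁ (proj₂ (proj₂ (proj₂ initial-st))))
          ; fin  = subst FinC (view-st outer-edge) (proj₂ (toWitness (final-ok L)))
          ; edge = λ e → subst EdgeC (view-st e) (edge-st e)
          ; popc = λ {h} {k} {i} {j} o e q →
              subst (λ v → PopC v (viewAt M C x value at h k) (viewAt M C x value at h j)) (view-st e)
                (subst₂ (λ u v → PopC (st i j) u v) (view-st (proj₁ (open-first o)))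
                  (view-st (pop o e q)) (proj₂ (proj₂ (proj₂ (proj₂ (pop-st o e q))))))
          } ,
          subst (λ s → T (out s (value 1))) (sym-st (s≤s z≤n)) (proj₁ (proj₂ (proj₂ initial-st)))

    recognises : ∀ φ → (∀ {x} → Word.AllDefined M x → Computes M C out x (sat M x φ)) →
                 ∀ x → Accepts M automaton x iff InLang M φ x
    recognises φ c x = to , from
      where
      open Word M x
      open Runs M x automaton
      -- Definedness on all edges comes from the run itself, and only with it does the soundness of
      -- the checker become available.
      correct : Outcome → InLang M φ x
      correct (_ , d , _ , L) = defined⇒compatible d ,
        proj₁ (Computes.sound (c d) (proj₁ (labelling⇒consistent x d L)) (s≤s z≤n))
              (proj₂ (labelling⇒consistent x d L))
      to : Accepts M automaton x → InLang M φ x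
      to = correct ∘ accepts⇒labelling
      realise : (d : AllDefined) → sat M x φ 1 → ∃₂ (Consistent M C x) → ∃ Labelling
      realise d s (_ , _ , k) =
        consistent⇒labelling x k (proj₂ (Computes.sound (c d) k (s≤s z≤n)) s)
      from : InLang M φ x → Accepts M automaton x
      from (compat , s) =
        labelling⇒accepts (proj₂ (realise d s (Computes.complete (c d))))
                          (Total.outer-edge r-source r-target d)
        where
        d : AllDefined
        d = compatible⇒defined compat

theorem3 : (n : ℕ) (S : Subset n) (M : OPM S) →
    ∃ λ (c : ℕ) → (φ : Formula n) →
    ∃ λ (k : ℕ) → Σ (OPA M k) λ A →
    k ≤ 2 ^ (c * size φ) ×
    ((x : List (Letter n)) →
    (Accepts M A x → InLang M φ x) × (InLang M φ x → Accepts M A x))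
theorem3 n S M = 2 * n + 8 , λ φ →
  let open Component (component φ) in
  _ , Automaton.automaton checker out , bound φ , Automaton.recognises checker out φ computes
  where
  open Compilation M
  size≥1 : ∀ (φ : Formula n) → 1 ≤ size φ
  size≥1 (atom _)    = s≤s z≤n
  size≥1 (¬f _)      = s≤s z≤n
  size≥1 (_ ∨f _)    = s≤s z≤n
  size≥1 (nextΠ _ _) = s≤s z≤n
  size≥1 (backΠ _ _) = s≤s z≤n
  size≥1 (χF _ _)    = s≤s z≤n
  size≥1 (χP _ _)    = s≤s z≤n
  size≥1 (Uχ _ _ _)  = s≤s z≤n
  size≥1 (Sχ _ _ _)  = s≤s z≤n
  size≥1 (nextH _ _) = s≤s z≤n
  size≥1 (backH _ _) = s≤s z≤n
  size≥1 (UH _ _ _)  = s≤s z≤n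
  size≥1 (SH _ _ _)  = s≤s z≤n

  -- The adjacency bit and the two flags telling # from a letter give 2 ^ 3, the two letters 2 ^
  -- (2n), and the checker at most 2 ^ (5 |φ|). As |φ| is at least 1, the exponent 3 + 2n is
  -- absorbed into a multiple of |φ|, whence 2n + 8.
  bound : ∀ φ → let open Checker (Component.checker (component φ)) in
          2 * ((2 * 2 ^ n) * ((2 * 2 ^ n) * (kP * (kP * kA)))) ≤ 2 ^ ((2 * n + 8) * size φ)
  bound φ = begin
    2 * ((2 * 2 ^ n) * ((2 * 2 ^ n) * (kP * (kP * kA)))) ≡⟨ regroup (2 ^ n) kP kA ⟩
    8 * (2 ^ n * 2 ^ n) * weight          ≤⟨ *-monoʳ-≤ (8 * (2 ^ n * 2 ^ n)) (Component.small (component φ)) ⟩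
    8 * (2 ^ n * 2 ^ n) * 2 ^ (5 * s)     ≡⟨ cong (λ t → 8 * t * 2 ^ (5 * s)) (^-distribˡ-+-* 2 n n) ⟨
    8 * 2 ^ (n + n) * 2 ^ (5 * s)         ≡⟨ cong (_* 2 ^ (5 * s)) (^-distribˡ-+-* 2 3 (n + n)) ⟨
    2 ^ (3 + (n + n)) * 2 ^ (5 * s)       ≡⟨ ^-distribˡ-+-* 2 (3 + (n + n)) (5 * s) ⟨
    2 ^ (3 + (n + n) + 5 * s)             ≤⟨ ^-monoʳ-≤ 2 (+-monoˡ-≤ (5 * s) (m≤m*n (3 + (n + n)) s)) ⟩
    2 ^ ((3 + (n + n)) * s + 5 * s)       ≡⟨ cong (2 ^_) (collect n s) ⟩
    2 ^ ((2 * n + 8) * s)                 ∎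
    where
    open Checker (Component.checker (component φ))
    open ≤-Reasoning
    s = size φ
    instance _ = >-nonZero (size≥1 φ)
    regroup : ∀ t a c → 2 * ((2 * t) * ((2 * t) * (a * (a * c)))) ≡ 8 * (t * t) * (a * a * c)
    regroup = solve-∀
    collect : ∀ n s → (3 + (n + n)) * s + 5 * s ≡ (2 * n + 8) * s
    collect = solve-∀
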